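{- Let $s$ and $d$ be relatively prime positive integers and let $p\ge 2$ be an integer. Then the mapping $\phi_{(s+d,d)}$ (defined in the context) restricts to a one-to-one correspondence between the set $\mathcal{SC}_{(s,s+d,\dots,s+pd)}$ of self-conjugate $(s,s+d,\dots,s+pd)$-core partitions and the set of paths $P\in\mathcal{F}(\lfloor s/2\rfloor+\lceil d/2\rceil,\,-\lceil d/2\rceil)$ satisfying all of the following: (i) if $p\ge 3$, $P$ has no $UF^iU$ as a consecutive subpath for all $i=0,1,\dots,p-3$; (ii) $P$ does not start with $F^jU$, and (iii) $P$ does not end with $UF^k$, for all $j,k$ in the following ranges: (a) when $s$ is odd and $d$ is even: $j=0,1,\dots,\lfloor (p-4)/2\rfloor$ if $p\ge4$ (no condition on the start of $P$ if $p<4$), and $k=0,1,\dots,\lfloor (p-3)/2\rfloor$ if $p\ge 3$ (no condition on the end of $P$ if $p<3$); (b) when $s$ is odd and $d$ is odd: $j=0,1,\dots,\lfloor (p-4)/2\rfloor$ if $p\ge 4$ (no condition on the start of $P$ if $p<4$), and $k=0,1,\dots,p-2$; (c) when $s$ is even and $d$ is odd: $j=0,1,\dots,\lfloor (p-3)/2\rfloor$ if $p\ge 3$ (no condition on the start of $P$ if $p<3$), and $k=0,1,\dots,p-2$.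
   Context: A partition is a finite (possibly empty) non-increasing sequence of positive integers, identified with its Young diagram. The hook length of a box is the number of boxes to its right in the same row plus the number of boxes below it in the same column plus $1$. A partition is an $s$-core if no box has hook length $s$, and an $(s_1,\dots,s_q)$-core if it is an $s_i$-core for every $i$. A partition is self-conjugate if its Young diagram is invariant under reflection in the main diagonal. $\mathcal{SC}_{(s_1,\dots,s_q)}$ denotes the set of self-conjugate $(s_1,\dots,s_q)$-core partitions. $MD(\lambda)$ denotes the set of hook lengths of the main diagonal boxes of $\lambda$; for self-conjugate $\lambda$ these are distinct odd numbers. Free rational Motzkin paths: $\mathcal{F}(m,t)$ is the set of all lattice paths from $(0,0)$ to $(m,t)$ consisting of steps $U=(1,1)$, $D=(1,-1)$, $F=(1,0)$. A path is written as the word of its steps; $F^i$ is $i$ consecutive $F$ steps ($F^0$ is empty). Abacus: for relatively prime positive integers $s,d$, let $a=a(s,d)$ be the integer such that $-a$ is the smallest odd number among $s$ and $s+d$ (so $a=-s$ if $s$ is odd and $a=-(s+d)$ if $s$ is even). The $(s+d,d;a)$-abacus diagram has rows indexed by $i\in\mathbb{Z}$ and columns indexed by $j\in\{0,1,\dots,\lfloor (s+d-1)/2\rfloor\}$; position $(i,j)$ has label $a+2(s+d)i+2dj$ (all labels are odd). The $(s+d,d;a)$-abacus of a self-conjugate partition $\lambda$ is obtained by placing a bead on each position with label $\ell$ such that $|\ell|\in MD(\lambda)$; positions without a bead are spacers. Abacus function: for $p\ge2$ and $\lambda\in\mathcal{SC}_{(s,s+d,\dots,s+pd)}$, the $(s+d,d;a)$-abacus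 function $f:\{0,1,\dots,\lfloor (s+d-1)/2\rfloor\}\to\mathbb{Z}$ of $\lambda$ is defined as follows. If some position in column $j$ with a positive label carries a bead, then $f(j)$ is the largest $i$ such that position $(i,j)$ carries a bead; otherwise $f(j)$ is the largest $i$ such that position $(i,j)$ is a spacer with a negative label. The map $\phi_{(s+d,d)}:\mathcal{SC}_{(s,s+d,s+2d)}\to\mathcal{F}(\lfloor s/2\rfloor+\lceil d/2\rceil,-\lceil d/2\rceil)$: given $\lambda$ with abacus function $f$, when $d$ is odd additionally set $f(\lfloor s/2\rfloor+(d+1)/2)=-(d+1)/2$. Then $\phi_{(s+d,d)}(\lambda)$ is the path starting at $(0,0)$ whose $j$th step is $(1,f(j)-f(j-1))$ for $j=1,\dots,\lfloor s/2\rfloor+\lceil d/2\rceil$. -}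

module Defs where

open import Data.Bool.Base using (if_then_else_; _∧_)
open import Data.Integer.Base as ℤ using (ℤ; +_; -[1+_]; 0ℤ; 1ℤ; -1ℤ; ∣_∣)
import Data.Integer.Properties as ℤₚ
import Data.Integer.Tactic.RingSolver as ℤSolver
open import Data.List.Base
  using (List; []; _∷_; _++_; length; filter; drop; foldr; replicate; applyUpTo)
open import Data.List.Properties using (length-filter; length-drop)
open import Data.List.Membership.Propositional using (_∈_)
open import Data.List.Relation.Binary.Infix.Heterogeneous using (Infix)
open import Data.List.Relation.Binary.Prefix.Heterogeneous using (Prefix)
open import Data.List.Relation.Binary.Suffix.Heterogeneous using (Suffix)
open import Data.List.Relation.Unary.All as All using (All)
open import Data.List.Relation.Unary.Linked as Linked using (Linked)
open import Data.Nat.Base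
open import Data.Nat.Properties
open import Data.Parity.Base using (0ℙ; 1ℙ)
import Data.Parity.Properties as ℙₚ
open import Data.Product.Base using (_×_; _,_; ∃; ∃-syntax; proj₁; proj₂)
open import Data.Sum.Base using (_⊎_; inj₁; inj₂)
open import Function.Base using (_∘_)
open import Relation.Binary.PropositionalEquality
open import Relation.Nullary
open import Relation.Nullary.Decidable using (map′; ¬?; _×-dec_; ⌊_⌋)
open import Relation.Unary using (Decidable)

Odd Even : ℕ → Set
Odd  n = parity n ≡ 1ℙ
Even n = parity n ≡ 0ℙ

odd? : Decidable Odd
odd? n = parity n ℙₚ.≟ 1ℙ

record Partition : Set where
  constructor mkPartition
  field
    parts         : List ℕ
    nonIncreasing : Linked _≥_ parts
    positive      : All (0 <_) parts

open Partition public

-- Hence _≡_ on Partition is equality of the sequences of parts.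
parts-injective : ∀ {μ ν} → parts μ ≡ parts ν → μ ≡ ν
parts-injective {mkPartition ps l₁ a₁} {mkPartition .ps l₂ a₂} refl =
  cong₂ (mkPartition ps) (Linked.irrelevant ≤-irrelevant l₁ l₂)
                         (All.irrelevant ≤-irrelevant a₁ a₂)

-- Rows and columns are numbered from 0; rows beyond the last part are empty.
rowLength : List ℕ → ℕ → ℕ
rowLength []       _       = 0
rowLength (x ∷ xs) zero    = x
rowLength (x ∷ xs) (suc r) = rowLength xs r

Box : Partition → ℕ → ℕ → Set
Box μ r c = c < rowLength (parts μ) r

arm leg hook : Partition → ℕ → ℕ → ℕ
arm  μ r c = rowLength (parts μ) r ∸ suc c
leg  μ r c = length (filter (c <?_) (drop (suc r) (parts μ)))
hook μ r c = arm μ r c + leg μ r c + 1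

IsCore : ℕ → Partition → Set
IsCore t μ = ∀ r c → Box μ r c → hook μ r c ≢ t

SelfConjugate : Partition → Set
SelfConjugate μ = ∀ r c → Box μ r c → Box μ c r

𝓢𝓒 : List ℕ → Partition → Set
𝓢𝓒 ts μ = SelfConjugate μ × All (λ t → IsCore t μ) ts

progression : ℕ → ℕ → ℕ → List ℕ
progression s d p = applyUpTo (λ i → s + i * d) (suc p)

MD : Partition → ℕ → Set
MD μ h = ∃[ i ] Box μ i i × hook μ i i ≡ h

box⇒row : ∀ xs r {c} → c < rowLength xs r → r < length xs
box⇒row (x ∷ xs) zero    _ = z<s
box⇒row (x ∷ xs) (suc r) b = s<s (box⇒row xs r b)

MD? : ∀ μ → Decidable (MD μ)
MD? μ h = map′ (λ (i , _ , b) → i , b)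
               (λ (i , b , e) → i , box⇒row (parts μ) i b , b , e)
               (anyUpTo? (λ i → (i <? rowLength (parts μ) i) ×-dec (hook μ i i ≟ h))
                         (length (parts μ)))

private
  rowSum : List ℕ → ℕ
  rowSum = foldr _+_ 0

  row≤sum : ∀ xs r → rowLength xs r ≤ rowSum xs
  row≤sum []       _       = z≤n
  row≤sum (x ∷ xs) zero    = m≤m+n x _
  row≤sum (x ∷ xs) (suc r) = ≤-trans (row≤sum xs r) (m≤n+m _ x)

  MD-bound : Partition → ℕ
  MD-bound μ = rowSum (parts μ) + length (parts μ) + 1

  MD≤bound : ∀ μ {h} → MD μ h → h ≤ MD-bound μ
  MD≤bound μ (i , _ , refl) = +-monoˡ-≤ 1 (+-mono-≤
    (≤-trans (m∸n≤m _ (suc i)) (row≤sum (parts μ) i))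
    (≤-trans (length-filter (i <?_) (drop (suc i) (parts μ)))
      (≤-trans (≤-reflexive (length-drop (suc i) (parts μ)))
               (m∸n≤m (length (parts μ)) (suc i)))))

Largest : (ℤ → Set) → ℤ → Set
Largest P i = P i × (∀ i′ → P i′ → i′ ℤ.≤ i)

private
  <sucʳ⇒≤ : ∀ lo n {i} → i ℤ.< lo ℤ.+ + suc n → i ℤ.≤ lo ℤ.+ + n
  <sucʳ⇒≤ lo n {i} lt = subst (i ℤ.≤_) (lemma lo (+ n)) (ℤₚ.i<j⇒i≤pred[j] lt)
    where
    lemma : ∀ x y → -1ℤ ℤ.+ (x ℤ.+ (1ℤ ℤ.+ y)) ≡ x ℤ.+ y
    lemma = ℤSolver.solve-∀

  searchDown : ∀ {P : ℤ → Set} → Decidable P → ∀ lo n →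
               (∀ i → P i → i ℤ.< lo ℤ.+ + n) →
               ∃ (Largest P) ⊎ (∀ i → P i → i ℤ.< lo)
  searchDown P? lo zero    ub = inj₂ λ i p → subst (i ℤ.<_) (ℤₚ.+-identityʳ lo) (ub i p)
  searchDown P? lo (suc n) ub with P? (lo ℤ.+ + n)
  ... | yes p = inj₁ (lo ℤ.+ + n , p , λ i q → <sucʳ⇒≤ lo n (ub i q))
  ... | no ¬p = searchDown P? lo n λ i q →
    ℤₚ.≤∧≢⇒< (<sucʳ⇒≤ lo n (ub i q)) λ { refl → ¬p q }

module _ (s d : ℕ) where

  -- Minus the smallest odd number among s and s + d.
  a : ℤ
  a = if ⌊ odd? s ⌋ then ℤ.- (+ s) else ℤ.- (+ (s + d))

  label : ℤ → ℕ → ℤ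
  label i j = a ℤ.+ + (2 * (s + d)) ℤ.* i ℤ.+ + (2 * d * j)

  -- The column index j is left unbounded here: the abacus has columns
  -- 0 , … , ⌊(s+d-1)/2⌋, and only those are used in φ below.
  Bead Spacer NegativeSpacer : Partition → ℕ → ℤ → Set
  Bead           μ j i = MD μ ∣ label i j ∣
  Spacer         μ j i = ¬ Bead μ j i
  NegativeSpacer μ j i = Spacer μ j i × label i j ℤ.< 0ℤ

  PositiveBead : Partition → ℕ → ℤ → Set
  PositiveBead μ j i = Bead μ j i × 0ℤ ℤ.< label i j

  IsAbacusValue : Partition → ℕ → ℤ → Set
  IsAbacusValue μ j i =
      (∃ (PositiveBead μ j) × Largest (Bead μ j) i)
    ⊎ (¬ ∃ (PositiveBead μ j) × Largest (NegativeSpacer μ j) i)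

module _ (s d : ℕ) .{{_ : NonZero s}} where

  private
    N : ℕ
    N = 2 * (s + d)

    n≤N*n : ∀ n → n ≤ N * n
    n≤N*n n = m≤n*m n N {{m*n≢0 2 (s + d) {{_}} {{>-nonZero (≤-trans (>-nonZero⁻¹ s) (m≤m+n s d))}}}}

    module _ (μ : Partition) (j : ℕ) where

      c : ℤ
      c = a s d ℤ.+ + (2 * d * j)

      C B K : ℕ
      C = ∣ c ∣
      B = MD-bound μ
      K = suc (C + B)

      label-split : ∀ i → label s d i j ≡ c ℤ.+ + N ℤ.* i
      label-split i = lemma (a s d) (+ N ℤ.* i) (+ (2 * d * j))
        where
        lemma : ∀ x y z → x ℤ.+ y ℤ.+ z ≡ (x ℤ.+ z) ℤ.+ y
        lemma = ℤSolver.solve-∀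

      i≤∣i∣ : ∀ i → i ℤ.≤ + ∣ i ∣
      i≤∣i∣ (+ n)    = ℤₚ.≤-refl
      i≤∣i∣ -[1+ n ] = ℤ.-≤+

      -∣i∣≤i : ∀ i → ℤ.- (+ ∣ i ∣) ℤ.≤ i
      -∣i∣≤i (+ n)    = ℤₚ.neg-≤-pos {n} {n}
      -∣i∣≤i -[1+ n ] = ℤₚ.≤-refl

      cancel : ∀ x y → ℤ.- x ℤ.+ (x ℤ.+ y) ≡ y
      cancel = ℤSolver.solve-∀

      high : ∀ n → K ≤ n → + B ℤ.< label s d (+ n) j
      high n K≤n = begin-strict
        + B                            ≡⟨ cancel (+ C) (+ B) ⟨
        ℤ.- (+ C) ℤ.+ + (C + B)        <⟨ ℤₚ.+-monoʳ-< (ℤ.- (+ C)) (ℤ.+<+ (≤-trans K≤n (n≤N*n n))) ⟩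
        ℤ.- (+ C) ℤ.+ + (N * n)        ≤⟨ ℤₚ.+-monoˡ-≤ (+ (N * n)) (-∣i∣≤i c) ⟩
        c ℤ.+ + (N * n)                ≡⟨ cong (λ z → c ℤ.+ z) (ℤₚ.pos-* N n) ⟩
        c ℤ.+ + N ℤ.* + n              ≡⟨ label-split (+ n) ⟨
        label s d (+ n) j              ∎
        where open ℤₚ.≤-Reasoning

      low : ∀ n → K ≤ n → label s d (ℤ.- (+ n)) j ℤ.< ℤ.- (+ B)
      low n K≤n = begin-strict
        label s d (ℤ.- (+ n)) j        ≡⟨ label-split (ℤ.- (+ n)) ⟩
        c ℤ.+ + N ℤ.* ℤ.- (+ n)        ≡⟨ cong (λ z → c ℤ.+ z)
                                            (trans (sym (ℤₚ.neg-distribʳ-* (+ N) (+ n)))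
                                                   (cong ℤ.-_ (sym (ℤₚ.pos-* N n)))) ⟩
        c ℤ.+ ℤ.- (+ (N * n))          ≤⟨ ℤₚ.+-monoˡ-≤ (ℤ.- (+ (N * n))) (i≤∣i∣ c) ⟩
        + C ℤ.+ ℤ.- (+ (N * n))        <⟨ ℤₚ.+-monoʳ-< (+ C) (ℤₚ.neg-mono-< (ℤ.+<+ (≤-trans K≤n (n≤N*n n)))) ⟩
        + C ℤ.+ ℤ.- (+ (C + B))        ≡⟨ cancel′ (+ C) (+ B) ⟩
        ℤ.- (+ B)                      ∎
        where
        open ℤₚ.≤-Reasoning
        cancel′ : ∀ x y → x ℤ.+ ℤ.- (x ℤ.+ y) ≡ ℤ.- y
        cancel′ = ℤSolver.solve-∀

      lo : ℤ
      lo = ℤ.- (+ K)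

      label≤B⇒i<K : ∀ i → label s d i j ℤ.≤ + B → i ℤ.< + K
      label≤B⇒i<K (+ n) le = ℤ.+<+ (≰⇒> λ K≤n → ℤₚ.<-irrefl refl (ℤₚ.<-≤-trans (high n K≤n) le))
      label≤B⇒i<K -[1+ n ] _ = ℤ.-<+

      i<lo⇒label<-B : ∀ i → i ℤ.< lo → label s d i j ℤ.< ℤ.- (+ B)
      i<lo⇒label<-B -[1+ n ] (ℤ.-<- lt) = low (suc n) (s≤s (<⇒≤ lt))

      bead⇒i<K : ∀ i → Bead s d μ j i → i ℤ.< + K
      bead⇒i<K i b = label≤B⇒i<K i
        (ℤₚ.≤-trans (i≤∣i∣ (label s d i j)) (ℤ.+≤+ (MD≤bound μ b)))

      search : ∀ {P : ℤ → Set} → Decidable P → (∀ i → P i → i ℤ.< + K) →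
               ∃ (Largest P) ⊎ (∀ i → P i → i ℤ.< lo)
      search P? ub = searchDown P? lo (K + K) λ i p →
        subst (i ℤ.<_) (sym (cancel (+ K) (+ K))) (ub i p)

      bead? : Decidable (Bead s d μ j)
      bead? i = MD? μ ∣ label s d i j ∣

      -B≤0 : ℤ.- (+ B) ℤ.≤ 0ℤ
      -B≤0 = ℤₚ.neg-≤-pos {B} {0}

      positive⇒≮lo : ∀ {i} → 0ℤ ℤ.< label s d i j → ¬ i ℤ.< lo
      positive⇒≮lo {i} pos lt = ℤₚ.<-asym pos (ℤₚ.<-≤-trans (i<lo⇒label<-B i lt) -B≤0)

      B<∣i∣ : ∀ i → i ℤ.< ℤ.- (+ B) → B < ∣ i ∣
      B<∣i∣ i lt = ≰⇒> λ ∣i∣≤B → ℤₚ.<-irrefl refl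
        (ℤₚ.<-≤-trans lt (ℤₚ.≤-trans (ℤₚ.neg-mono-≤ (ℤ.+≤+ ∣i∣≤B)) (-∣i∣≤i i)))

      lo-negativeSpacer : NegativeSpacer s d μ j lo
      lo-negativeSpacer =
        (λ b → <⇒≱ (B<∣i∣ _ (low K ≤-refl)) (MD≤bound μ b)) ,
        ℤₚ.<-≤-trans (low K ≤-refl) -B≤0

      abacusValue : ∃ (IsAbacusValue s d μ j)
      abacusValue
        with search (λ i → bead? i ×-dec (0ℤ ℤₚ.<? label s d i j)) (λ i → bead⇒i<K i ∘ proj₁)
      ... | inj₁ (i , pb@(b , pos) , _) with search bead? bead⇒i<K
      ...   | inj₁ (k , largest) = k , inj₁ ((i , pb) , largest)
      ...   | inj₂ none          = contradiction (none i b) (positive⇒≮lo pos)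
      abacusValue | inj₂ noPositive
        with search (λ i → ¬? (bead? i) ×-dec (label s d i j ℤₚ.<? 0ℤ))
                    (λ i (_ , neg) → label≤B⇒i<K i (ℤₚ.≤-trans (ℤₚ.<⇒≤ neg) (ℤ.+≤+ z≤n)))
      ... | inj₁ (k , largest) =
              k , inj₂ ((λ (i , pb) → positive⇒≮lo (proj₂ pb) (noPositive i pb)) , largest)
      ... | inj₂ none = contradiction (none lo lo-negativeSpacer) (ℤₚ.<-irrefl refl)

  abacusFunction : Partition → ℕ → ℤ
  abacusFunction μ j = proj₁ (abacusValue μ j)

  abacusFunction-spec : ∀ μ j → IsAbacusValue s d μ j (abacusFunction μ j)
  abacusFunction-spec μ j = proj₂ (abacusValue μ j)

Step Path : Set
Step = ℤ × ℤ
Path = List Step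

U D F : Step
U = 1ℤ , 1ℤ
D = 1ℤ , -1ℤ
F = 1ℤ , 0ℤ

endpoint : Path → ℤ × ℤ
endpoint = foldr (λ (x , y) (x′ , y′) → x ℤ.+ x′ , y ℤ.+ y′) (0ℤ , 0ℤ)

𝓕 : ℕ → ℤ → Path → Set
𝓕 m t P = All (_∈ U ∷ D ∷ F ∷ []) P × endpoint P ≡ (+ m , t)

F^_ : ℕ → Path
F^ i = replicate i F

Contains StartsWith EndsWith : Path → Path → Set
Contains   P Q = Infix  _≡_ Q P
StartsWith P Q = Prefix _≡_ Q P
EndsWith   P Q = Suffix _≡_ Q P

-- ⌊s/2⌋ + ⌈d/2⌉ ; the last abacus column ⌊(s+d-1)/2⌋ has this index if d is
-- even, and this index minus one if d is odd (s and d being coprime).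
width : ℕ → ℕ → ℕ
width s d = ⌊ s /2⌋ + ⌈ d /2⌉

module _ (s d : ℕ) .{{_ : NonZero s}} where

  -- For odd d, width s d = ⌊s/2⌋ + (d+1)/2 and ⌈d/2⌉ = (d+1)/2.
  extendedAbacusFunction : Partition → ℕ → ℤ
  extendedAbacusFunction μ j =
    if ⌊ odd? d ⌋ ∧ ⌊ j ≟ width s d ⌋
    then ℤ.- (+ ⌈ d /2⌉)
    else abacusFunction s d μ j

  φ : Partition → Path
  φ μ = applyUpTo (λ j → 1ℤ , f (suc j) ℤ.- f j) (width s d)
    where f = extendedAbacusFunction μ

NoStart NoEnd : ℕ → Path → Set
NoStart b P = ∀ j → j ≤ b → ¬ StartsWith P (F^ j ++ U ∷ [])
NoEnd   b P = ∀ k → k ≤ b → ¬ EndsWith P (U ∷ F^ k)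

record Admissible (s d p : ℕ) (P : Path) : Set where
  field
    noUFU   : 3 ≤ p → ∀ i → i ≤ p ∸ 3 → ¬ Contains P (U ∷ F^ i ++ U ∷ [])
    oddEven : Odd s → Even d →
              (4 ≤ p → NoStart ⌊ p ∸ 4 /2⌋ P) × (3 ≤ p → NoEnd ⌊ p ∸ 3 /2⌋ P)
    oddOdd  : Odd s → Odd d →
              (4 ≤ p → NoStart ⌊ p ∸ 4 /2⌋ P) × NoEnd (p ∸ 2) P
    evenOdd : Even s → Odd d →
              (3 ≤ p → NoStart ⌊ p ∸ 3 /2⌋ P) × NoEnd (p ∸ 2) P

RestrictsToBijection : {X Y : Set} → (X → Y) → (X → Set) → (Y → Set) → Set
RestrictsToBijection f A B =
    (∀ x → A x → B (f x))
  × (∀ x x′ → A x → A x′ → f x ≡ f x′ → x ≡ x′)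
  × (∀ y → B y → ∃[ x ] A x × f x ≡ y)

{-# OPTIONS --safe #-}
module Submission where

-- The set M = { λ_r - r } of a self-conjugate partition contains exactly one of
-- n and 1 - n, and the partition is a t-core iff M is closed under n ↦ n - t.
-- With n = (label + 1) / 2, position (i, j) of the abacus is e + (s + d) i + d j,
-- which makes sense for all columns j ∈ ℤ.  Write f(j) for the height of M in
-- column j.  Being an (s, …, s + p d)-core means f(j + m) - f(j) ≤ 1 for all j and
-- -1 ≤ m ≤ p - 1 (with f(j) - f(j + 1) ≤ 1 for m = -1), the coordinates give
-- f(j + s + d) = f(j) - d, and the symmetry of M makes the graph of f symmetric
-- about two points, near the two ends of the columns 0, …, K of the abacus.
-- Hence f is determined by its values on these columns, and the inequalities
-- reduce to pairs of columns in 0, …, K, which gives (i), and to pairs on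
-- different sides of one of the two centres, which gives (ii) and (iii).

-- Windows are not bounded by the abacus: p is unrelated to s and d, so p - 1 columns may reach past
-- both centres or around the whole period T = s + d. Pairs with such a wrap follow from short ones:
-- the spare length puts each of the two columns within half a window of a centre, and pairing each
-- column with its own mirror image there gives twice the wanted bound.
--
-- Coordinates are not unique. By Bézout, (i, j) and (i + q d, j - q T) name the same integer and
-- nothing else does, but a column that lies on a centre (column 0 for even s, column K for even d)
-- is also its own mirror image. A set read off from heights is therefore well defined only if these
-- heights are 0 and - d/2, which the inequalities force; so they are established before the set is
-- used.
--
-- For odd d the right centre is K + 1/2, and f(K) + f(K + 1) = - d cannot be split evenly. The
-- value - (d + 1)/2 that the path takes at K + 1 need not be f(K + 1), yet bounds against it are
-- equivalent to the bounds on mirrored pairs.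

module Arithmetic where

  open import Data.Empty using (⊥-elim)
  open import Data.Integer.Base
  open import Data.Integer.DivMod using (n%ℕd<d; a≡a%ℕn+[a/ℕn]*n)
  open import Data.Integer.Properties
  open import Data.Integer.Tactic.RingSolver using (solve-∀; solve)
  open import Data.List.Base using ([]; _∷_)
  import Data.Nat.Base as ℕ
  import Data.Nat.Properties as ℕ
  open import Data.Product.Base using (_×_; _,_; ∃; ∃-syntax; proj₁; proj₂)
  open import Data.Sum.Base using (_⊎_; inj₁; inj₂)
  open import Function.Base using (_∘_)
  open import Relation.Binary.PropositionalEquality
  open import Relation.Nullary
  open import Relation.Nullary.Decidable using (map′)
  open import Relation.Unary using (Decidable)

  -- Integer inequalities by explicit linear certificates

  infixl 6 _⊕_
  _⊕_ : ∀ {a b c e} → a ≤ b → c ≤ e → a + c ≤ b + e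
  _⊕_ = +-mono-≤

  -- Linear inequalities are proved by certificates: `⊕` adds up hypotheses, repeated as often as
  -- their coefficient, and the ring solver checks that the slack of the sum is the slack of the
  -- claim; `0≤1` pads it by one. Contradictions take the form 1 ≤ 0, for `1≰0`.
  from≤ : ∀ {a b x y} → a ≤ b → y - x ≡ b - a → x ≤ y
  from≤ h e = 0≤i-j⇒j≤i (subst (0ℤ ≤_) (sym e) (i≤j⇒0≤j-i h))

  2ℤ : ℤ
  2ℤ = + 2

  1≰0 : ¬ 1ℤ ≤ 0ℤ
  1≰0 (+≤+ ())

  0≤1 : 0ℤ ≤ 1ℤ
  0≤1 = +≤+ ℕ.z≤n

  halve : ∀ w → w + w ≤ 2ℤ → w ≤ 1ℤ
  halve w h = ≮⇒≥ λ 1<w → absurd (i<j⇒suc[i]≤j 1<w)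
    where
    absurd : ¬ 2ℤ ≤ w
    absurd 2≤w = 1≰0 (from≤ (h ⊕ 2≤w ⊕ 2≤w ⊕ 0≤1) (solve (w ∷ [])))

  half-nonpositive : ∀ w → w + w ≤ 1ℤ → w ≤ 0ℤ
  half-nonpositive w h = ≮⇒≥ λ 0<w → absurd (i<j⇒suc[i]≤j 0<w)
    where
    absurd : ¬ 1ℤ ≤ w
    absurd 1≤w = 1≰0 (from≤ (1≤w ⊕ 1≤w ⊕ h) (solve (w ∷ [])))

  half-nonnegative : ∀ w → -1ℤ ≤ w + w → 0ℤ ≤ w
  half-nonnegative w h = ≮⇒≥ λ w<0 → absurd (i<j⇒suc[i]≤j w<0)
    where
    absurd : ¬ 1ℤ + w ≤ 0ℤ
    absurd w<0 = 1≰0 (from≤ (w<0 ⊕ w<0 ⊕ h) (solve (w ∷ [])))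

  double-zero : ∀ w → -1ℤ ≤ w + w → w + w ≤ 1ℤ → w ≡ 0ℤ
  double-zero w l u = ≤-antisym (half-nonpositive w u) (half-nonnegative w l)

  minus-swap : ∀ a b → a - b ≡ - (b - a)
  minus-swap = solve-∀

  sum≤1 : ∀ a b → b - a ≤ 1ℤ → a ≤ 0ℤ → a + b ≤ 1ℤ
  sum≤1 a b p q = from≤ (p ⊕ q ⊕ q) (solve (a ∷ b ∷ []))

  sum≥-1 : ∀ a b → 0ℤ ≤ a → a - b ≤ 1ℤ → -1ℤ ≤ a + b
  sum≥-1 a b p q = from≤ (p ⊕ p ⊕ q) (solve (a ∷ b ∷ []))

  -- Heights at columns which are mirror images in the centre K + ε/2 have sum - d.
  module EvenCentre (d h : ℤ) (d≡ : d ≡ h + h) where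

    mirrored≥ : ∀ a b → b - a ≤ 1ℤ → - h ≤ b → -1ℤ ≤ a + b + d
    mirrored≥ a b p q = from≤ (p ⊕ q ⊕ q ⊕ ≤-reflexive (sym d≡)) (solve (a ∷ b ∷ d ∷ h ∷ []))

    mirrored≤ : ∀ a b → a - b ≤ 1ℤ → b ≡ - h → a + b + d ≤ 1ℤ
    mirrored≤ a b p q = from≤ (p ⊕ ≤-reflexive q ⊕ ≤-reflexive q ⊕ ≤-reflexive d≡) (solve (a ∷ b ∷ d ∷ h ∷ []))

    above-centre : ∀ a → -1ℤ ≤ a + a + d → - h ≤ a
    above-centre a p = from≤ 0≤a+h (solve (a ∷ h ∷ []))
      where
      0≤a+h : 0ℤ ≤ a + h
      0≤a+h = half-nonnegative (a + h) (from≤ (p ⊕ ≤-reflexive d≡) (solve (a ∷ d ∷ h ∷ [])))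

    below-centre : ∀ a → a + a + d ≤ 1ℤ → a ≤ - h
    below-centre a p = from≤ a+h≤0 (solve (a ∷ h ∷ []))
      where
      a+h≤0 : a + h ≤ 0ℤ
      a+h≤0 = half-nonpositive (a + h) (from≤ (p ⊕ ≤-reflexive (sym d≡)) (solve (a ∷ d ∷ h ∷ [])))

  -- The centre lies between two columns and - d is odd. The rounded half - h = - (d + 1)/2, where
  -- the path ends, takes the place of a height on the centre: bounds on a mirrored pair are
  -- exchanged for bounds of single columns against - h.
  module OddCentre (d h : ℤ) (d≡ : d + 1ℤ ≡ h + h) where

    mirrored≥ : ∀ a b → - h ≤ a → - h ≤ b → -1ℤ ≤ a + b + d
    mirrored≥ a b p q = from≤ (p ⊕ q ⊕ ≤-reflexive (sym d≡)) (solve (a ∷ b ∷ d ∷ h ∷ []))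

    mirrored≤ : ∀ a b → a - (- h) ≤ 1ℤ → b - (- h) ≤ 1ℤ → a + b + d ≤ 1ℤ
    mirrored≤ a b p q = from≤ (p ⊕ q ⊕ ≤-reflexive d≡) (solve (a ∷ b ∷ d ∷ h ∷ []))

    last≤ : ∀ a → a + a + d ≤ 1ℤ → a + h ≤ 1ℤ
    last≤ a p = halve (a + h) (from≤ (p ⊕ ≤-reflexive (sym d≡)) (solve (a ∷ d ∷ h ∷ [])))

    rise≤1 : ∀ a b → b + h ≤ 1ℤ → -1ℤ ≤ a + b + d → - h - a ≤ 1ℤ
    rise≤1 a b p q = from≤ (p ⊕ q ⊕ ≤-reflexive d≡) (solve (a ∷ b ∷ d ∷ h ∷ []))

    above-centre : ∀ a b → -1ℤ ≤ a + b + d → b - a ≤ 1ℤ → - h ≤ a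
    above-centre a b p q = from≤ 0≤a+h (solve (a ∷ h ∷ []))
      where
      0≤a+h : 0ℤ ≤ a + h
      0≤a+h = half-nonnegative (a + h) (from≤ (p ⊕ q ⊕ ≤-reflexive d≡) (solve (a ∷ b ∷ d ∷ h ∷ [])))

  -- Height differences between arbitrary columns

  module Windows
    (K ε δ T d P : ℤ)
    (K≥0 : 0ℤ ≤ K) (ε≥0 : 0ℤ ≤ ε) (δ≥0 : 0ℤ ≤ δ) (d≥0 : 0ℤ ≤ d)
    (T≡ : T ≡ K + K + ε + δ) (2≤T : 2ℤ ≤ T) (2≤K+ε+δ : 2ℤ ≤ K + ε + δ)
    -- The graph of f on the columns 0, ..., K, as a relation so that every value brings along the
    -- bounds `lo` and `hi` on its column. `T` is s + d and `P` is p - 1.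
    (G : ℤ → ℤ → Set)
    (lo : ∀ {x a} → G x a → 0ℤ ≤ x) (hi : ∀ {x a} → G x a → x ≤ K)
    where

    -- f(j + m) - f(j) ≤ 1 for two columns in 0, …, K (win) and for a column and the mirror
    -- image of another one in the centre -δ/2 (start) or K + ε/2 (end); the fields ending
    -- in D are the case m = -1.
    record Good : Set where
      field
        win    : ∀ {x y a b} → G x a → G y b → x ≤ y → y ≤ x + P → b - a ≤ 1ℤ
        winD   : ∀ {x y a b} → G x a → G y b → x ≤ y → y ≤ x + 1ℤ → a - b ≤ 1ℤ
        start  : ∀ {x y a b} → G x a → G y b → x + y + δ ≤ P → a + b ≤ 1ℤ
        startD : ∀ {x y a b} → G x a → G y b → x + y + δ ≤ 1ℤ → -1ℤ ≤ a + b
        end    : ∀ {x y a b} → G x a → G y b → K + K + ε ≤ x + y + P → -1ℤ ≤ a + b + d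
        endD   : ∀ {x y a b} → G x a → G y b → K + K + ε ≤ x + y + 1ℤ → a + b + d ≤ 1ℤ

    -- Column x and its mirror image in the centre -δ/2, where f changes sign.
    data Side : Set where
      right left : Side

    position level : Side → ℤ → ℤ
    position right x = x
    position left  x = - δ - x
    level right a = a
    level left  a = - a

    T≥ : K + K + ε + δ ≤ T
    T≥ = ≤-reflexive (sym T≡)

    module _ (good : Good) {x x′ a a′ m : ℤ} (g : G x a) (g′ : G x′ a′) (m≥ : -1ℤ ≤ m) (m≤ : m ≤ P) where
      open Good good

      rr-zero : x - x′ ≡ m + 0ℤ → a - a′ + 0ℤ ≤ 1ℤ
      rr-zero e with ≤-total 0ℤ m
      ... | inj₁ 0≤m = from≤ (win g′ g
              (from≤ (0≤m ⊕ ≤-reflexive (sym e)) (solve (x ∷ x′ ∷ m ∷ [])))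
              (from≤ (m≤ ⊕ ≤-reflexive e) (solve (x ∷ x′ ∷ m ∷ P ∷ []))))
            (solve (a ∷ a′ ∷ []))
      ... | inj₂ m≤0 = from≤ (winD g g′
              (from≤ (m≤0 ⊕ ≤-reflexive e) (solve (x ∷ x′ ∷ m ∷ [])))
              (from≤ (m≥ ⊕ ≤-reflexive (sym e)) (solve (x ∷ x′ ∷ m ∷ []))))
            (solve (a ∷ a′ ∷ []))

      -- Columns in 0, ..., K differ by at most K, and `2≤K+ε+δ` says exactly that K < T - 1.
      rr-pos : ∀ {qT qd} → T ≤ qT → x - x′ ≡ m + qT → a - a′ + qd ≤ 1ℤ
      rr-pos {qT} q≥ e = ⊥-elim (1≰0
        (from≤ (hi g ⊕ lo g′ ⊕ m≥ ⊕ q≥ ⊕ T≥ ⊕ 2≤K+ε+δ ⊕ ≤-reflexive (sym e))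
          (solve (K ∷ ε ∷ δ ∷ T ∷ x ∷ x′ ∷ m ∷ qT ∷ []))))

      -- Here x′ - x ≥ T - P, so `x` is within half a window of the left centre and `x′` within half
      -- a window of the right one. Pairing each with its own mirror image gives 2 a ≤ 1 and 2 a′ ≥
      -- - d - 1. Since `qd` is at most - d, the sum bounds twice the claim by 2.
      rr-neg : ∀ {qT qd} → qT ≤ - T → qd ≤ - d → x - x′ ≡ m + qT → a - a′ + qd ≤ 1ℤ
      rr-neg {qT} {qd} qT≤ qd≤ e = halve (a - a′ + qd)
        (from≤ (start g g start-near ⊕ end g′ g′ end-near ⊕ qd≤ ⊕ qd≤ ⊕ d≥0) (solve (a ∷ a′ ∷ d ∷ qd ∷ [])))
        where
        start-near : x + x + δ ≤ P
        start-near = from≤ (m≤ ⊕ ≤-reflexive e ⊕ qT≤ ⊕ T≥ ⊕ hi g ⊕ hi g′ ⊕ ε≥0)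
          (solve (K ∷ ε ∷ δ ∷ T ∷ P ∷ x ∷ x′ ∷ m ∷ qT ∷ []))
        end-near : K + K + ε ≤ x′ + x′ + P
        end-near = from≤ (m≤ ⊕ ≤-reflexive e ⊕ qT≤ ⊕ T≥ ⊕ lo g ⊕ lo g′ ⊕ δ≥0)
          (solve (K ∷ ε ∷ δ ∷ T ∷ P ∷ x ∷ x′ ∷ m ∷ qT ∷ []))

      rl-zero : x - (- δ - x′) ≡ m + 0ℤ → a - - a′ + 0ℤ ≤ 1ℤ
      rl-zero e = from≤ (start g g′ (from≤ (m≤ ⊕ ≤-reflexive e) (solve (δ ∷ P ∷ x ∷ x′ ∷ m ∷ []))))
        (solve (a ∷ a′ ∷ []))

      -- Now x + x′ + δ ≤ P - T, and the spare T covers the difference of the two columns, so both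
      -- are within half a window of the left centre.
      rl-neg : ∀ {qT qd} → qT ≤ - T → qd ≤ - d → x - (- δ - x′) ≡ m + qT → a - - a′ + qd ≤ 1ℤ
      rl-neg {qT} {qd} qT≤ qd≤ e = halve (a - - a′ + qd)
        (from≤ (start g g near ⊕ start g′ g′ near′ ⊕ qd≤ ⊕ qd≤ ⊕ d≥0 ⊕ d≥0) (solve (a ∷ a′ ∷ d ∷ qd ∷ [])))
        where
        near : x + x + δ ≤ P
        near = from≤ (m≤ ⊕ ≤-reflexive e ⊕ qT≤ ⊕ T≥ ⊕ hi g ⊕ lo g′ ⊕ ε≥0 ⊕ δ≥0 ⊕ K≥0)
          (solve (K ∷ ε ∷ δ ∷ T ∷ P ∷ x ∷ x′ ∷ m ∷ qT ∷ []))
        near′ : x′ + x′ + δ ≤ P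
        near′ = from≤ (m≤ ⊕ ≤-reflexive e ⊕ qT≤ ⊕ T≥ ⊕ hi g′ ⊕ lo g ⊕ ε≥0 ⊕ δ≥0 ⊕ K≥0)
          (solve (K ∷ ε ∷ δ ∷ T ∷ P ∷ x ∷ x′ ∷ m ∷ qT ∷ []))

      -- Since T - δ = 2 K + ε, the left mirror image of `x′` shifted by T is its mirror image in
      -- the right centre.
      rl-one : x - (- δ - x′) ≡ m + T → a - - a′ + d ≤ 1ℤ
      rl-one e = from≤ (endD g g′ (from≤ (m≥ ⊕ ≤-reflexive (sym e) ⊕ T≥)
          (solve (K ∷ ε ∷ δ ∷ T ∷ x ∷ x′ ∷ m ∷ []))))
        (solve (a ∷ a′ ∷ d ∷ []))

      rl-pos : ∀ {qT qd} → T + T ≤ qT → x - (- δ - x′) ≡ m + qT → a - - a′ + qd ≤ 1ℤ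
      rl-pos {qT} q≥ e = ⊥-elim (1≰0
        (from≤ (hi g ⊕ hi g′ ⊕ m≥ ⊕ q≥ ⊕ T≥ ⊕ 2≤T ⊕ ε≥0 ⊕ ≤-reflexive (sym e))
          (solve (K ∷ ε ∷ δ ∷ T ∷ x ∷ x′ ∷ m ∷ qT ∷ []))))

      lr-zero : (- δ - x) - x′ ≡ m + 0ℤ → - a - a′ + 0ℤ ≤ 1ℤ
      lr-zero e = from≤ (startD g g′ (from≤ (m≥ ⊕ ≤-reflexive (sym e)) (solve (δ ∷ x ∷ x′ ∷ m ∷ []))))
        (solve (a ∷ a′ ∷ []))

      lr-pos : ∀ {qT qd} → T ≤ qT → (- δ - x) - x′ ≡ m + qT → - a - a′ + qd ≤ 1ℤ
      lr-pos {qT} q≥ e = ⊥-elim (1≰0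
        (from≤ (lo g ⊕ lo g′ ⊕ m≥ ⊕ q≥ ⊕ 2≤T ⊕ δ≥0 ⊕ ≤-reflexive (sym e))
          (solve (δ ∷ T ∷ x ∷ x′ ∷ m ∷ qT ∷ []))))

      lr-one : (- δ - x) - x′ ≡ m + (- T) → - a - a′ + (- d) ≤ 1ℤ
      lr-one e = from≤ (end g g′ (from≤ (m≤ ⊕ ≤-reflexive e ⊕ T≥)
          (solve (K ∷ ε ∷ δ ∷ T ∷ P ∷ x ∷ x′ ∷ m ∷ []))))
        (solve (a ∷ a′ ∷ d ∷ []))

      lr-neg : ∀ {qT qd} → qT ≤ - T - T → qd ≤ - d - d → (- δ - x) - x′ ≡ m + qT → - a - a′ + qd ≤ 1ℤ
      lr-neg {qT} {qd} qT≤ qd≤ e = halve (- a - a′ + qd)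
        (from≤ (end g g near ⊕ end g′ g′ near′ ⊕ qd≤ ⊕ qd≤ ⊕ d≥0 ⊕ d≥0) (solve (a ∷ a′ ∷ d ∷ qd ∷ [])))
        where
        near : K + K + ε ≤ x + x + P
        near = from≤ (m≤ ⊕ ≤-reflexive e ⊕ qT≤ ⊕ T≥ ⊕ T≥ ⊕ lo g ⊕ hi g′ ⊕ ε≥0 ⊕ δ≥0 ⊕ K≥0)
          (solve (K ∷ ε ∷ δ ∷ T ∷ P ∷ x ∷ x′ ∷ m ∷ qT ∷ []))
        near′ : K + K + ε ≤ x′ + x′ + P
        near′ = from≤ (m≤ ⊕ ≤-reflexive e ⊕ qT≤ ⊕ T≥ ⊕ T≥ ⊕ lo g′ ⊕ hi g ⊕ ε≥0 ⊕ δ≥0 ⊕ K≥0)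
          (solve (K ∷ ε ∷ δ ∷ T ∷ P ∷ x ∷ x′ ∷ m ∷ qT ∷ []))

    -- The product q T is not linear, so the certificates cannot use it directly. This and the next
    -- four lemmas replace it by the few multiples of T, or of d, that the cases call for.
    *-mono : ∀ {t k q} → 0ℤ ≤ t → k ≤ q → k * t ≤ q * t
    *-mono {t} t≥0 = *-monoʳ-≤-nonNeg t {{nonNegative t≥0}}

    0≤T : 0ℤ ≤ T
    0≤T = ≤-trans (+≤+ ℕ.z≤n) 2≤T

    ≥1 : ∀ {t} n → 0ℤ ≤ t → t ≤ +[1+ n ] * t
    ≥1 {t} n t≥0 = subst (_≤ +[1+ n ] * t) (*-identityˡ t) (*-mono {t} {1ℤ} {+[1+ n ]} t≥0 (+≤+ (ℕ.s≤s ℕ.z≤n)))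

    ≥2 : ∀ {t} n → 0ℤ ≤ t → t + t ≤ +[1+ ℕ.suc n ] * t
    ≥2 {t} n t≥0 = subst (_≤ +[1+ ℕ.suc n ] * t) (lemma t)
      (*-mono {t} {2ℤ} {+[1+ ℕ.suc n ]} t≥0 (+≤+ (ℕ.s≤s (ℕ.s≤s ℕ.z≤n))))
      where
      lemma : ∀ t → 2ℤ * t ≡ t + t
      lemma = solve-∀

    ≤-1 : ∀ {t} n → 0ℤ ≤ t → -[1+ n ] * t ≤ - t
    ≤-1 {t} n t≥0 = subst (-[1+ n ] * t ≤_) (-1*i≡-i t) (*-mono {t} { -[1+ n ] } { -1ℤ } t≥0 (-≤- ℕ.z≤n))

    ≤-2 : ∀ {t} n → 0ℤ ≤ t → -[1+ ℕ.suc n ] * t ≤ - t - t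
    ≤-2 {t} n t≥0 = subst (-[1+ ℕ.suc n ] * t ≤_) (lemma t)
      (*-mono {t} { -[1+ ℕ.suc n ] } { -[1+ 1 ] } t≥0 (-≤- (ℕ.s≤s ℕ.z≤n)))
      where
      lemma : ∀ t → -[1+ 1 ] * t ≡ - t - t
      lemma = solve-∀

    -- As f drops by d over a period, its value at `position s′ x′ + q * T` is
    -- `level s′ a′ - q * d`; the claim is the window inequality for any two columns in ℤ. Left
    -- against left is right against right with the columns exchanged.
    level-bound : Good → ∀ {x x′ a a′ m} → G x a → G x′ a′ → -1ℤ ≤ m → m ≤ P → ∀ s s′ q →
                  position s x - position s′ x′ ≡ m + q * T → level s a - level s′ a′ + q * d ≤ 1ℤ
    level-bound good {x} {x′} {a} {a′} {m} g g′ m≥ m≤ = go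
      where
      reflect : ∀ q → position left x - position left x′ ≡ m + q * T → x′ - x ≡ m + q * T
      reflect q e = trans (lemma δ x x′) e
        where
        lemma : ∀ δ x x′ → x′ - x ≡ (- δ - x) - (- δ - x′)
        lemma = solve-∀

      unreflect : ∀ q → a′ - a + q * d ≤ 1ℤ → level left a - level left a′ + q * d ≤ 1ℤ
      unreflect q = subst (_≤ 1ℤ) (lemma a a′ (q * d))
        where
        lemma : ∀ a a′ qd → a′ - a + qd ≡ - a - - a′ + qd
        lemma = solve-∀

      go : ∀ s s′ q → position s x - position s′ x′ ≡ m + q * T → level s a - level s′ a′ + q * d ≤ 1ℤ
      go right right (+ ℕ.zero)    = rr-zero good g g′ m≥ m≤
      go right right +[1+ n ]      = rr-pos good g g′ m≥ m≤ (≥1 n 0≤T)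
      go right right -[1+ n ]      = rr-neg good g g′ m≥ m≤ (≤-1 n 0≤T) (≤-1 n d≥0)
      go left left q@(+ ℕ.zero)    = unreflect q ∘ rr-zero good g′ g m≥ m≤ ∘ reflect q
      go left left q@(+[1+ n ])    = unreflect q ∘ rr-pos good g′ g m≥ m≤ (≥1 n 0≤T) ∘ reflect q
      go left left q@(-[1+ n ])    = unreflect q ∘ rr-neg good g′ g m≥ m≤ (≤-1 n 0≤T) (≤-1 n d≥0) ∘ reflect q
      go right left (+ ℕ.zero)     = rl-zero good g g′ m≥ m≤
      go right left +[1+ ℕ.zero ]  = subst₂ (λ t v → x - (- δ - x′) ≡ m + t → a - - a′ + v ≤ 1ℤ)
        (sym (*-identityˡ T)) (sym (*-identityˡ d)) (rl-one good g g′ m≥ m≤)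
      go right left +[1+ ℕ.suc n ] = rl-pos good g g′ m≥ m≤ (≥2 n 0≤T)
      go right left -[1+ n ]       = rl-neg good g g′ m≥ m≤ (≤-1 n 0≤T) (≤-1 n d≥0)
      go left right (+ ℕ.zero)     = lr-zero good g g′ m≥ m≤
      go left right +[1+ n ]       = lr-pos good g g′ m≥ m≤ (≥1 n 0≤T)
      go left right -[1+ ℕ.zero ]  = subst₂ (λ t v → (- δ - x) - x′ ≡ m + t → - a - a′ + v ≤ 1ℤ)
        (sym (-1*i≡-i T)) (sym (-1*i≡-i d)) (lr-one good g g′ m≥ m≤)
      go left right -[1+ ℕ.suc n ] = lr-neg good g g′ m≥ m≤ (≤-2 n 0≤T) (≤-2 n d≥0)

  -- The set of integers below a height function

  module Abacus
    (K ε δ T d P : ℤ)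
    (K≥0 : 0ℤ ≤ K) (ε≥0 : 0ℤ ≤ ε) (δ≥0 : 0ℤ ≤ δ) (d≥0 : 0ℤ ≤ d)
    (T≡ : T ≡ K + K + ε + δ) (2≤T : 2ℤ ≤ T) (2≤K+ε+δ : 2ℤ ≤ K + ε + δ)
    (D : ℤ) (d≡ : d + ε ≡ D + D)
    (P≥1 : 1ℤ ≤ P) (ε≤1 : ε ≤ 1ℤ) (δ≤1 : δ ≤ 1ℤ)
    -- This equation expresses the reflection n ↦ 1 - n in coordinates: row i goes to 1 - i and
    -- column y to - δ - y, see `point-reflect`.
    (e : ℤ) (e≡ : e + e + T ≡ 1ℤ + d * δ)
    (u v : ℤ) (bézout : T * u + d * v ≡ 1ℤ)
    (G : ℤ → ℤ → Set)
    (lo : ∀ {x a} → G x a → 0ℤ ≤ x) (hi : ∀ {x a} → G x a → x ≤ K)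
    (functional : ∀ {x a b} → G x a → G x b → a ≡ b)
    (defined : ∀ x → 0ℤ ≤ x → x ≤ K → ∃ (G x))
    where

    open Windows K ε δ T d P K≥0 ε≥0 δ≥0 d≥0 T≡ 2≤T 2≤K+ε+δ G lo hi public

    flip : Side → Side
    flip right = left
    flip left  = right

    position-flip : ∀ s x → position (flip s) x ≡ - δ - position s x
    position-flip right x = refl
    position-flip left  x = lemma δ x
      where
      lemma : ∀ δ x → x ≡ - δ - (- δ - x)
      lemma = solve-∀

    level-flip : ∀ s a → level (flip s) a ≡ - level s a
    level-flip right a = refl
    level-flip left  a = sym (neg-involutive a)

    point : ℤ → ℤ → ℤ
    point i y = e + T * i + d * y

    point-reflect : ∀ i y → 1ℤ - point i y ≡ point (1ℤ - i) (- δ - y)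
    point-reflect i y = begin
      1ℤ - (e + T * i + d * y)                              ≡⟨ lemma₁ e T d δ i y ⟩
      (1ℤ + d * δ) - (e + T * i + d * y) - d * δ            ≡⟨ cong (λ z → z - (e + T * i + d * y) - d * δ) e≡ ⟨
      (e + e + T) - (e + T * i + d * y) - d * δ             ≡⟨ lemma₂ e T d δ i y ⟩
      e + T * (1ℤ - i) + d * (- δ - y)                      ∎
      where
      open ≡-Reasoning
      lemma₁ : ∀ e T d δ i y → 1ℤ - (e + T * i + d * y) ≡ (1ℤ + d * δ) - (e + T * i + d * y) - d * δ
      lemma₁ = solve-∀
      lemma₂ : ∀ e T d δ i y → (e + e + T) - (e + T * i + d * y) - d * δ ≡ e + T * (1ℤ - i) + d * (- δ - y)
      lemma₂ = solve-∀

    point-translate : ∀ i y q → point i (y + q * T) ≡ point (i + q * d) y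
    point-translate i y q = lemma e T d i y q
      where
      lemma : ∀ e T d i y q → e + T * i + d * (y + q * T) ≡ e + T * (i + q * d) + d * y
      lemma = solve-∀

    point-hook : ∀ i y m → point i y - (T + m * d) ≡ point (i - 1ℤ) (y - m)
    point-hook i y m = lemma e T d i y m
      where
      lemma : ∀ e T d i y m → e + T * i + d * y - (T + m * d) ≡ e + T * (i - 1ℤ) + d * (y - m)
      lemma = solve-∀

    -- T A + d B = 0 with T and d coprime forces A = - q d and B = q T. Then u B - v A = q (T u + d
    -- v) = q, which is how `q` is read off.
    point-injective : ∀ {i y i′ y′} → point i y ≡ point i′ y′ →
                      ∃[ q ] y - y′ ≡ q * T × i′ ≡ i + q * d
    point-injective {i} {y} {i′} {y′} eq = q , column , row
      where
      open ≡-Reasoning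
      A = i - i′
      B = y - y′
      q = u * B - v * A
      zero-sum : T * A + d * B ≡ 0ℤ
      zero-sum = trans (lemma e T d i y i′ y′) (i≡j⇒i-j≡0 eq)
        where
        lemma : ∀ e T d i y i′ y′ → T * (i - i′) + d * (y - y′) ≡ (e + T * i + d * y) - (e + T * i′ + d * y′)
        lemma = solve-∀
      column : B ≡ q * T
      column = begin
        B                                              ≡⟨ *-identityˡ B ⟨
        1ℤ * B                                         ≡⟨ cong (_* B) bézout ⟨
        (T * u + d * v) * B                            ≡⟨ lemma T d u v A B ⟩
        (u * B - v * A) * T + v * (T * A + d * B)      ≡⟨ cong (λ z → q * T + v * z) zero-sum ⟩
        q * T + v * 0ℤ                                 ≡⟨ lemma₂ (q * T) v ⟩
        q * T                                          ∎
        where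
        lemma : ∀ T d u v A B → (T * u + d * v) * B ≡ (u * B - v * A) * T + v * (T * A + d * B)
        lemma = solve-∀
        lemma₂ : ∀ x v → x + v * 0ℤ ≡ x
        lemma₂ = solve-∀
      row : i′ ≡ i + q * d
      row = begin
        i′                                                   ≡⟨ lemma i i′ ⟩
        i - 1ℤ * A                                           ≡⟨ cong (λ z → i - z * A) bézout ⟨
        i - (T * u + d * v) * A                              ≡⟨ lemma₂ T d u v i A B ⟩
        i + (u * B - v * A) * d - u * (T * A + d * B)        ≡⟨ cong (λ z → i + q * d - u * z) zero-sum ⟩
        i + q * d - u * 0ℤ                                   ≡⟨ lemma₃ (i + q * d) u ⟩
        i + q * d                                            ∎
        where
        lemma : ∀ i i′ → i′ ≡ i - 1ℤ * (i - i′)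
        lemma = solve-∀
        lemma₂ : ∀ T d u v i A B → i - (T * u + d * v) * A ≡ i + (u * B - v * A) * d - u * (T * A + d * B)
        lemma₂ = solve-∀
        lemma₃ : ∀ x v → x - v * 0ℤ ≡ x
        lemma₃ = solve-∀

    -- A name for `n` by a column in 0, ..., K or a mirror image of one. An integer whose column
    -- lies on a centre has two names.
    record Location (n : ℤ) : Set where
      constructor located
      field
        {row column height} : ℤ
        side   : Side
        value  : G column height
        n≡     : n ≡ point row (position side column)

    private
      T-nonZero : ℕ.NonZero ∣ T ∣
      T-nonZero = ℕ.>-nonZero (lemma T 2≤T)
        where
        lemma : ∀ t → 2ℤ ≤ t → 0 ℕ.< ∣ t ∣
        lemma (+ n) (+≤+ h) = ℕ.≤-trans (ℕ.s≤s ℕ.z≤n) h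

      +∣T∣≡T : + ∣ T ∣ ≡ T
      +∣T∣≡T = 0≤i⇒+∣i∣≡i (≤-trans (+≤+ ℕ.z≤n) 2≤T)

    point-surjective : ∀ n → ∃[ i ] ∃[ y ] n ≡ point i y
    point-surjective n = u * (n - e) , v * (n - e) , (begin
      n                                                 ≡⟨ lemma n e ⟩
      e + 1ℤ * (n - e)                                  ≡⟨ cong (λ z → e + z * (n - e)) bézout ⟨
      e + (T * u + d * v) * (n - e)                     ≡⟨ lemma₂ e T d u v (n - e) ⟩
      e + T * (u * (n - e)) + d * (v * (n - e))         ∎)
      where
      open ≡-Reasoning
      lemma : ∀ n e → n ≡ e + 1ℤ * (n - e)
      lemma = solve-∀
      lemma₂ : ∀ e T d u v x → e + (T * u + d * v) * x ≡ e + T * (u * x) + d * (v * x)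
      lemma₂ = solve-∀

    -- The residues modulo T are 0, ..., K together with the mirror images T - δ - x in the right
    -- centre; ε ≤ 1 and δ ≤ 1 are what keep x in 0, ..., K.
    locate : ∀ n → Location n
    locate n with point-surjective n
    ... | i , y , n≡ with r ≤? K
      where
      instance _ = T-nonZero
      r = + (y %ℕ ∣ T ∣)
    ... | yes r≤K = located right (proj₂ (defined r (+≤+ ℕ.z≤n) r≤K))
      (trans n≡ (trans (cong (point i) y≡) (point-translate i r q)))
      where
      instance _ = T-nonZero
      r = + (y %ℕ ∣ T ∣)
      q = y /ℕ ∣ T ∣
      y≡ : y ≡ r + q * T
      y≡ = trans (a≡a%ℕn+[a/ℕn]*n y ∣ T ∣) (cong (λ t → r + q * t) +∣T∣≡T)
    ... | no r≰K = located left (proj₂ (defined x x≥0 x≤K))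
      (trans n≡ (trans (cong (point i) y≡′) (point-translate i (- δ - x) (q + 1ℤ))))
      where
      instance _ = T-nonZero
      r = + (y %ℕ ∣ T ∣)
      q = y /ℕ ∣ T ∣
      x = T - δ - r
      y≡ : y ≡ r + q * T
      y≡ = trans (a≡a%ℕn+[a/ℕn]*n y ∣ T ∣) (cong (λ t → r + q * t) +∣T∣≡T)
      y≡′ : y ≡ (- δ - x) + (q + 1ℤ) * T
      y≡′ = trans y≡ (lemma T δ r q)
        where
        lemma : ∀ T δ r q → r + q * T ≡ (- δ - (T - δ - r)) + (q + 1ℤ) * T
        lemma = solve-∀
      x≤K : x ≤ K
      x≤K = bound r (i<j⇒suc[i]≤j (≰⇒> r≰K))
        where
        bound : ∀ r → 1ℤ + K ≤ r → T - δ - r ≤ K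
        bound r h = from≤ (h ⊕ ε≤1 ⊕ ≤-reflexive T≡) (solve (T ∷ K ∷ ε ∷ δ ∷ r ∷ []))
      x≥0 : 0ℤ ≤ x
      x≥0 = bound r (i<j⇒suc[i]≤j (subst (r <_) +∣T∣≡T (+<+ (n%ℕd<d y ∣ T ∣))))
        where
        bound : ∀ r → 1ℤ + r ≤ T → 0ℤ ≤ T - δ - r
        bound r h = from≤ (h ⊕ δ≤1) (solve (T ∷ δ ∷ r ∷ []))

    -- Stated for the name that `locate` happens to pick; independence of that choice needs `Good`
    -- and is the content of `member⁺` and `member⁻`. Being a record, it lets `n` be inferred from
    -- the type.
    record Member (n : ℤ) : Set where
      constructor member
      field
        row≤level : Location.row (locate n) ≤ level (Location.side (locate n)) (Location.height (locate n))

    open Member public using (row≤level)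

    member? : Decidable Member
    member? n = map′ member row≤level (_ ≤? _)

    private
      T≤ : T ≤ K + K + ε + δ
      T≤ = ≤-reflexive T≡

    module _ (good : Good) where
      open Good good

      private
        rr : ∀ {x x′ a a′} → G x a → G x′ a′ → ∀ q → x - x′ ≡ q * T → a′ ≡ a + q * d
        rr {x} {x′} {a} {a′} g g′ (+ ℕ.zero) e =
          trans (functional g′ (subst (λ z → G z a) (i-j≡0⇒i≡j x x′ e) g)) (sym (+-identityʳ a))
        rr {x} {x′} g g′ q@(+[1+ n ]) e = ⊥-elim (1≰0 (contra (q * T) (≥1 n 0≤T) e))
          where
          contra : ∀ qT → T ≤ qT → x - x′ ≡ qT → 1ℤ ≤ 0ℤ
          contra qT q≥ e = from≤ (hi g ⊕ lo g′ ⊕ q≥ ⊕ T≥ ⊕ 2≤K+ε+δ ⊕ 0≤1 ⊕ ≤-reflexive (sym e))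
            (solve (K ∷ ε ∷ δ ∷ T ∷ x ∷ x′ ∷ qT ∷ []))
        rr {x} {x′} g g′ q@(-[1+ n ]) e = ⊥-elim (1≰0 (contra (q * T) (≤-1 n 0≤T) e))
          where
          contra : ∀ qT → qT ≤ - T → x - x′ ≡ qT → 1ℤ ≤ 0ℤ
          contra qT q≤ e = from≤ (hi g′ ⊕ lo g ⊕ q≤ ⊕ T≥ ⊕ 2≤K+ε+δ ⊕ 0≤1 ⊕ ≤-reflexive e)
            (solve (K ∷ ε ∷ δ ∷ T ∷ x ∷ x′ ∷ qT ∷ []))

        -- A column and a mirror image coincide only on a centre: q = 0 forces x = x′ = 0, and q = 1
        -- forces x = x′ = K. The pair of that column with itself is bounded from both sides, which
        -- pins 2 a to 0 and to - d respectively.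
        rl : ∀ {x x′ a a′} → G x a → G x′ a′ → ∀ q → x - (- δ - x′) ≡ q * T → - a′ ≡ a + q * d
        rl {x} {x′} {a} {a′} g g′ (+ ℕ.zero) e =
          subst (λ z → - z ≡ a + 0ℤ * d) a≡a′ (trans (cong -_ a≡0) (cong (_+ 0ℤ) (sym a≡0)))
          where
          x≡x′ : x ≡ x′
          x≡x′ = ≤-antisym
            (from≤ (≤-reflexive e ⊕ lo g′ ⊕ lo g′ ⊕ δ≥0) (solve (x ∷ x′ ∷ δ ∷ [])))
            (from≤ (≤-reflexive e ⊕ lo g ⊕ lo g ⊕ δ≥0) (solve (x ∷ x′ ∷ δ ∷ [])))
          a≡a′ : a ≡ a′
          a≡a′ = functional (subst (λ z → G z a) x≡x′ g) g′
          a≡0 : a ≡ 0ℤ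
          a≡0 = double-zero a
            (subst (λ z → -1ℤ ≤ a + z) (sym a≡a′)
            (startD g g′ (from≤ (≤-reflexive e ⊕ 0≤1) (solve (x ∷ x′ ∷ δ ∷ [])))))
            (subst (λ z → a + z ≤ 1ℤ) (sym a≡a′)
            (start g g′ (from≤ (≤-reflexive e ⊕ 0≤1 ⊕ P≥1) (solve (x ∷ x′ ∷ δ ∷ P ∷ [])))))
        rl {x} {x′} {a} {a′} g g′ +[1+ ℕ.zero ] e =
          subst (λ z → - z ≡ a + 1ℤ * d) a≡a′ (solution a+D≡0)
          where
          e′ : x - (- δ - x′) ≡ T
          e′ = trans e (*-identityˡ T)
          x≡x′ : x ≡ x′
          x≡x′ = ≤-antisym
            (from≤ (≤-reflexive (sym e′) ⊕ hi g ⊕ hi g ⊕ T≥ ⊕ ε≥0) (solve (x ∷ x′ ∷ δ ∷ ε ∷ T ∷ K ∷ [])))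
            (from≤ (≤-reflexive (sym e′) ⊕ hi g′ ⊕ hi g′ ⊕ T≥ ⊕ ε≥0) (solve (x ∷ x′ ∷ δ ∷ ε ∷ T ∷ K ∷ [])))
          ε≤0 : ε ≤ 0ℤ
          ε≤0 = from≤ (≤-reflexive (sym e′) ⊕ hi g ⊕ hi g′ ⊕ T≥) (solve (x ∷ x′ ∷ δ ∷ ε ∷ T ∷ K ∷ []))
          d≡2D : d ≡ D + D
          d≡2D = trans (sym (+-identityʳ d)) (trans (cong (λ z → d + z) (≤-antisym ε≥0 ε≤0)) d≡)
          a≡a′ : a ≡ a′
          a≡a′ = functional (subst (λ z → G z a) x≡x′ g) g′
          lower : -1ℤ ≤ a + a + d
          lower = subst (λ z → -1ℤ ≤ a + z + d) (sym a≡a′)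
            (end g g′ (from≤ (≤-reflexive (sym e′) ⊕ T≥ ⊕ 0≤1 ⊕ P≥1) (solve (x ∷ x′ ∷ δ ∷ ε ∷ T ∷ K ∷ P ∷ []))))
          upper : a + a + d ≤ 1ℤ
          upper = subst (λ z → a + z + d ≤ 1ℤ) (sym a≡a′)
            (endD g g′ (from≤ (≤-reflexive (sym e′) ⊕ T≥ ⊕ 0≤1) (solve (x ∷ x′ ∷ δ ∷ ε ∷ T ∷ K ∷ []))))
          a+D≡0 : a + D ≡ 0ℤ
          a+D≡0 = double-zero (a + D)
            (from≤ (lower ⊕ ≤-reflexive d≡2D) (solve (a ∷ d ∷ D ∷ [])))
            (from≤ (upper ⊕ ≤-reflexive (sym d≡2D)) (solve (a ∷ d ∷ D ∷ [])))
          solution : a + D ≡ 0ℤ → - a ≡ a + 1ℤ * d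
          solution e₀ = begin
            - a                          ≡⟨ lemma a D ⟩
            a + (D + D) - (a + D + (a + D))  ≡⟨ cong₂ (λ y z → a + y - (z + z)) (sym d≡2D) e₀ ⟩
            a + d - 0ℤ                   ≡⟨ lemma₂ a d ⟩
            a + 1ℤ * d                   ∎
            where
            open ≡-Reasoning
            lemma : ∀ a D → - a ≡ a + (D + D) - (a + D + (a + D))
            lemma = solve-∀
            lemma₂ : ∀ a d → a + d - 0ℤ ≡ a + 1ℤ * d
            lemma₂ = solve-∀
        rl {x} {x′} g g′ q@(+[1+ ℕ.suc n ]) e = ⊥-elim (1≰0 (contra (q * T) (≥2 n 0≤T) e))
          where
          contra : ∀ qT → T + T ≤ qT → x - (- δ - x′) ≡ qT → 1ℤ ≤ 0ℤ
          contra qT q≥ e = from≤ (hi g ⊕ hi g′ ⊕ q≥ ⊕ T≥ ⊕ 2≤T ⊕ ε≥0 ⊕ 0≤1 ⊕ ≤-reflexive (sym e))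
            (solve (K ∷ ε ∷ δ ∷ T ∷ x ∷ x′ ∷ qT ∷ []))
        rl {x} {x′} g g′ q@(-[1+ n ]) e = ⊥-elim (1≰0 (contra (q * T) (≤-1 n 0≤T) e))
          where
          contra : ∀ qT → qT ≤ - T → x - (- δ - x′) ≡ qT → 1ℤ ≤ 0ℤ
          contra qT q≤ e = from≤ (lo g ⊕ lo g′ ⊕ q≤ ⊕ 2≤T ⊕ δ≥0 ⊕ 0≤1 ⊕ ≤-reflexive e)
            (solve (δ ∷ T ∷ x ∷ x′ ∷ qT ∷ []))

      level-unique : ∀ {x x′ a a′} → G x a → G x′ a′ → ∀ s s′ q →
                     position s x - position s′ x′ ≡ q * T → level s′ a′ ≡ level s a + q * d
      level-unique g g′ right right q e = rr g g′ q e
      level-unique g g′ right left  q e = rl g g′ q e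
      level-unique {x} {x′} {a} {a′} g g′ left left q e = lemma a a′ (q * d) (rr g′ g q (trans (lemma₂ δ x x′) e))
        where
        lemma : ∀ a a′ qd → a ≡ a′ + qd → - a′ ≡ - a + qd
        lemma a a′ qd refl = lemma₀ a′ qd
          where
          lemma₀ : ∀ a′ qd → - a′ ≡ - (a′ + qd) + qd
          lemma₀ = solve-∀
        lemma₂ : ∀ δ x x′ → x′ - x ≡ (- δ - x) - (- δ - x′)
        lemma₂ = solve-∀
      level-unique {x} {x′} {a} {a′} g g′ left right q e =
        lemma a a′ q d (rl g′ g (- q) (trans (lemma₂ δ x x′) (trans (cong -_ e) (neg-distribˡ-* q T))))
        where
        lemma : ∀ a a′ q d → - a ≡ a′ + - q * d → a′ ≡ - a + q * d
        lemma a a′ q d e = trans (lemma₀ a′ q d) (cong (_+ q * d) (sym e))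
          where
          lemma₀ : ∀ a′ q d → a′ ≡ a′ + - q * d + q * d
          lemma₀ = solve-∀
        lemma₂ : ∀ δ x x′ → x′ - (- δ - x) ≡ - ((- δ - x) - x′)
        lemma₂ = solve-∀

      module _ {x a} (g : G x a) (s : Side) (i : ℤ) where
        private
          n = point i (position s x)
          open Location (locate n)
          shift = point-injective {i} {position s x} {row} (n≡)
          q = proj₁ shift
          row≡ : row ≡ i + q * d
          row≡ = proj₂ (proj₂ shift)
          level≡ : level side height ≡ level s a + q * d
          level≡ = level-unique g value s side q (proj₁ (proj₂ shift))

        member⁺ : i ≤ level s a → Member n
        member⁺ i≤ = member (subst₂ _≤_ (sym row≡) (sym level≡) (+-monoˡ-≤ (q * d) i≤))

        member⁻ : Member n → i ≤ level s a
        member⁻ m = cancel i (level s a) (q * d) (subst₂ _≤_ row≡ level≡ (row≤level m))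
          where
          cancel : ∀ i l c → i + c ≤ l + c → i ≤ l
          cancel i l c h = from≤ h (solve (i ∷ l ∷ c ∷ []))

      -- Subtracting T + m d lowers the row by one and moves column y to y - m. The result stays in
      -- the set because the height at y exceeds that at y - m by at most 1, for names on any sides.
      member-closed : ∀ m → -1ℤ ≤ m → m ≤ P → ∀ n → Member n → Member (n - (T + m * d))
      member-closed m m≥ m≤ n n∈ = member (from≤ (row≤level n∈ ⊕ bound ⊕ ≤-reflexive row≡)
        (lemma L.row (level L.side L.height) L′.row (level L′.side L′.height) (q * d)))
        where
        module L = Location (locate n)
        module L′ = Location (locate (n - (T + m * d)))
        shift = point-injective {L.row - 1ℤ} {position L.side L.column - m} {L′.row}
          (trans (sym (point-hook L.row _ m)) (trans (cong (_- (T + m * d)) (sym L.n≡)) L′.n≡))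
        q = proj₁ shift
        row≡ : L′.row ≡ L.row - 1ℤ + q * d
        row≡ = proj₂ (proj₂ shift)
        column≡ : ∀ y m y′ z → (y - m) - y′ ≡ z → y - y′ ≡ m + z
        column≡ y m y′ z e = trans (lemma y m y′) (cong (λ z → m + z) e)
          where
          lemma : ∀ y m y′ → y - y′ ≡ m + (y - m - y′)
          lemma = solve-∀
        bound : level L.side L.height - level L′.side L′.height + q * d ≤ 1ℤ
        bound = level-bound good L.value L′.value m≥ m≤ L.side L′.side q
          (column≡ (position L.side L.column) m _ _ (proj₁ (proj₂ shift)))
        lemma : ∀ i l i′ l′ qd → l′ - i′ ≡ l + 1ℤ + (i - 1ℤ + qd) - (i + (l - l′ + qd) + i′)
        lemma = solve-∀

      private
        reflected : ∀ n → let open Location (locate n) in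
                    1ℤ - n ≡ point (1ℤ - row) (position (flip side) column)
        reflected n = begin
          1ℤ - n                                               ≡⟨ cong (λ z → 1ℤ - z) n≡ ⟩
          1ℤ - point row (position side column)                ≡⟨ point-reflect row (position side column) ⟩
          point (1ℤ - row) (- δ - position side column)        ≡⟨ cong (point (1ℤ - row)) (position-flip side column) ⟨
          point (1ℤ - row) (position (flip side) column)       ∎
          where
          open ≡-Reasoning
          open Location (locate n)

        member-reflect⁺ : ∀ n → let open Location (locate n) in
                          1ℤ - row ≤ - level side height → Member (1ℤ - n)
        member-reflect⁺ n h = subst Member (sym (reflected n))
          (member⁺ value (flip side) (1ℤ - row) (≤-trans h (≤-reflexive (sym (level-flip side height)))))
          where
          open Location (locate n)

        member-reflect⁻ : ∀ n → let open Location (locate n) in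
                          Member (1ℤ - n) → 1ℤ - row ≤ - level side height
        member-reflect⁻ n m = ≤-trans
          (member⁻ value (flip side) (1ℤ - row) (subst Member (reflected n) m))
          (≤-reflexive (level-flip side height))
          where
          open Location (locate n)

      member-exclusive : ∀ n → Member n → ¬ Member (1ℤ - n)
      member-exclusive n n∈ n∈′ = 1≰0 (from≤ (row≤level n∈ ⊕ member-reflect⁻ n n∈′) (lemma row (level side height)))
        where
        open Location (locate n)
        lemma : ∀ i l → 0ℤ - 1ℤ ≡ l + - l - (i + (1ℤ - i))
        lemma = solve-∀

      member-total : ∀ n → Member n ⊎ Member (1ℤ - n)
      member-total n = decide row (level side height) member (member-reflect⁺ n)
        where
        open Location (locate n)
        bound : ∀ i l → 1ℤ + l ≤ i → 1ℤ - i ≤ - l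
        bound i l h = from≤ h (solve (i ∷ l ∷ []))
        decide : ∀ i l {A B : Set} → (i ≤ l → A) → (1ℤ - i ≤ - l → B) → A ⊎ B
        decide i l inside outside with i ≤? l
        ... | yes i≤l = inj₁ (inside i≤l)
        ... | no i≰l  = inj₂ (outside (bound i l (i<j⇒suc[i]≤j (≰⇒> i≰l))))

      -- Rows are at most B and columns at most K. This upper bound is what allows the set to come
      -- from a finite diagram.
      member-bounded : ∀ B → (∀ {x a} → G x a → a ≤ B × - a ≤ B) → ∀ n → Member n → n ≤ point B K
      member-bounded B height≤ n n∈ = subst (_≤ point B K) (sym n≡)
        (+-mono-≤ (+-monoʳ-≤ e (*-monoˡ-≤-nonNeg T {{nonNegative 0≤T}} (≤-trans (row≤level n∈) (level≤ side))))
                  (*-monoˡ-≤-nonNeg d {{nonNegative d≥0}} (position≤ side)))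
        where
        open Location (locate n)
        level≤ : ∀ s → level s height ≤ B
        level≤ right = proj₁ (height≤ value)
        level≤ left  = proj₂ (height≤ value)
        position≤ : ∀ s → position s column ≤ K
        position≤ right = hi value
        position≤ left  = bound column (lo value)
          where
          bound : ∀ x → 0ℤ ≤ x → - δ - x ≤ K
          bound x h = from≤ (h ⊕ δ≥0 ⊕ K≥0) (solve (K ∷ δ ∷ x ∷ []))

    module _ {M : ℤ → Set}
      (exclusive : ∀ n → M n → ¬ M (1ℤ - n)) (total : ∀ n → M n ⊎ M (1ℤ - n))
      (closed : ∀ m → -1ℤ ≤ m → m ≤ P → ∀ n → M n → M (n - (T + m * d)))
      (below : ∀ {x a} → G x a → ∀ i → i ≤ a → M (point i x))
      (above : ∀ {x a} → G x a → ∀ i → M (point i x) → i ≤ a)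
      where

      private
        reflected : ∀ x i → 1ℤ - point i (- δ - x) ≡ point (1ℤ - i) x
        reflected x i = trans (point-reflect i (- δ - x)) (cong (point (1ℤ - i)) (lemma δ x))
          where
          lemma : ∀ δ x → - δ - (- δ - x) ≡ x
          lemma = solve-∀

        below′ : ∀ s {x a} → G x a → ∀ i → i ≤ level s a → M (point i (position s x))
        below′ right g i i≤a = below g i i≤a
        below′ left {x} {a} g i i≤-a with total (point i (- δ - x))
        ... | inj₁ m = m
        ... | inj₂ m = ⊥-elim (contra (above g (1ℤ - i) (subst M (reflected x i) m)))
          where
          contra : ¬ 1ℤ - i ≤ a
          contra h = 1≰0 (from≤ (h ⊕ i≤-a) (solve (i ∷ a ∷ [])))

        above′ : ∀ s {x a} → G x a → ∀ i → M (point i (position s x)) → i ≤ level s a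
        above′ right g i m = above g i m
        above′ left {x} {a} g i m = bound (i<j⇒suc[i]≤j (≰⇒> λ h →
          exclusive _ m (subst M (sym (reflected x i)) (below g (1ℤ - i) h))))
          where
          bound : 1ℤ + a ≤ 1ℤ - i → i ≤ - a
          bound h = from≤ h (solve (i ∷ a ∷ []))

        -- The hook takes the top point of the first column, in row l, to row l - 1 + q d of the
        -- second column, where it may not lie above the top.
        bounded : ∀ {x x′ a a′} → G x a → G x′ a′ → ∀ m → -1ℤ ≤ m → m ≤ P → ∀ s s′ q →
                  position s x - position s′ x′ ≡ m + q * T → level s a - level s′ a′ + q * d ≤ 1ℤ
        bounded {x} {x′} {a} {a′} g g′ m m≥ m≤ s s′ q e = from≤ (above′ s′ g′ (l - 1ℤ + q * d) (subst M hooked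
            (closed m m≥ m≤ _ (below′ s g l ≤-refl)))) (lemma l (level s′ a′) (q * d))
          where
          l = level s a
          lemma : ∀ l l′ qd → 1ℤ - (l - l′ + qd) ≡ l′ - (l - 1ℤ + qd)
          lemma = solve-∀
          shift : ∀ y m y′ z → y - y′ ≡ m + z → y - m ≡ y′ + z
          shift y m y′ z e = trans (lemma₁ y m y′) (trans (cong (λ w → w + y′ - m) e) (lemma₂ m y′ z))
            where
            lemma₁ : ∀ y m y′ → y - m ≡ (y - y′) + y′ - m
            lemma₁ = solve-∀
            lemma₂ : ∀ m y′ z → m + z + y′ - m ≡ y′ + z
            lemma₂ = solve-∀
          hooked : point l (position s x) - (T + m * d) ≡ point (l - 1ℤ + q * d) (position s′ x′)
          hooked = trans (point-hook l (position s x) m)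
            (trans (cong (point (l - 1ℤ)) (shift (position s x) m (position s′ x′) (q * T) e))
                   (point-translate (l - 1ℤ) (position s′ x′) q))

        bounded-rr : ∀ {x x′ a a′} → G x a → G x′ a′ → ∀ m → -1ℤ ≤ m → m ≤ P → ∀ q →
                     x - x′ ≡ m + q * T → a - a′ + q * d ≤ 1ℤ
        bounded-rr g g′ m m≥ m≤ = bounded g g′ m m≥ m≤ right right

        bounded-rl : ∀ {x x′ a a′} → G x a → G x′ a′ → ∀ m → -1ℤ ≤ m → m ≤ P → ∀ q →
                     x - (- δ - x′) ≡ m + q * T → a - - a′ + q * d ≤ 1ℤ
        bounded-rl g g′ m m≥ m≤ = bounded g g′ m m≥ m≤ right left

        bounded-lr : ∀ {x x′ a a′} → G x a → G x′ a′ → ∀ m → -1ℤ ≤ m → m ≤ P → ∀ q →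
                     (- δ - x) - x′ ≡ m + q * T → - a - a′ + q * d ≤ 1ℤ
        bounded-lr g g′ m m≥ m≤ = bounded g g′ m m≥ m≤ left right

      member⇒ : ∀ n → Member n → M n
      member⇒ n h = subst M (sym n≡) (below′ side value row (row≤level h))
        where open Location (locate n)

      ⇒member : ∀ n → M n → Member n
      ⇒member n m = member (above′ side value row (subst M n≡ m))
        where open Location (locate n)

      -- For each field, `m` is the offset between one column and the other or its mirror image. The
      -- fields of the right centre use q = -1 and q = 1, because its mirror images are those of the
      -- left centre shifted by T.
      closed⇒good : Good
      closed⇒good = record
        { win = λ {x} {y} {a} {b} g h x≤y y≤x+P → from≤
            (bounded-rr h g (y - x) (from≤ (x≤y ⊕ 0≤1) (solve (x ∷ y ∷ []))) (from≤ y≤x+P (solve (x ∷ y ∷ P ∷ [])))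
              0ℤ (solve (x ∷ y ∷ T ∷ [])))
            (solve (a ∷ b ∷ d ∷ []))
        ; winD = λ {x} {y} {a} {b} g h x≤y y≤x+1 → from≤
            (bounded-rr g h (x - y) (from≤ y≤x+1 (solve (x ∷ y ∷ [])))
            (from≤ (x≤y ⊕ P≥1 ⊕ 0≤1) (solve (x ∷ y ∷ P ∷ [])))
              0ℤ (solve (x ∷ y ∷ T ∷ [])))
            (solve (a ∷ b ∷ d ∷ []))
        ; start = λ {x} {y} {a} {b} g h near → from≤
            (bounded-rl g h (x + y + δ) (from≤ (lo g ⊕ lo h ⊕ δ≥0 ⊕ 0≤1) (solve (x ∷ y ∷ δ ∷ []))) near
              0ℤ (solve (x ∷ y ∷ δ ∷ T ∷ [])))
            (solve (a ∷ b ∷ d ∷ []))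
        ; startD = λ {x} {y} {a} {b} g h near → from≤
            (bounded-lr g h (- δ - x - y) (from≤ near (solve (x ∷ y ∷ δ ∷ [])))
              (from≤ (lo g ⊕ lo h ⊕ δ≥0 ⊕ P≥1 ⊕ 0≤1) (solve (x ∷ y ∷ δ ∷ P ∷ [])))
              0ℤ (solve (x ∷ y ∷ δ ∷ T ∷ [])))
            (solve (a ∷ b ∷ d ∷ []))
        ; end = λ {x} {y} {a} {b} g h near → from≤
            (bounded-lr g h (T - δ - x - y)
              (from≤ (hi g ⊕ hi h ⊕ ε≥0 ⊕ T≥ ⊕ 0≤1) (solve (x ∷ y ∷ δ ∷ ε ∷ T ∷ K ∷ [])))
              (from≤ (near ⊕ T≤) (solve (x ∷ y ∷ δ ∷ ε ∷ T ∷ K ∷ P ∷ [])))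
              -1ℤ (solve (x ∷ y ∷ δ ∷ T ∷ [])))
            (solve (a ∷ b ∷ d ∷ []))
        ; endD = λ {x} {y} {a} {b} g h near → from≤
            (bounded-rl g h (x + y + δ - T)
              (from≤ (near ⊕ T≤) (solve (x ∷ y ∷ δ ∷ ε ∷ T ∷ K ∷ [])))
              (from≤ (hi g ⊕ hi h ⊕ ε≥0 ⊕ T≥ ⊕ P≥1 ⊕ 0≤1) (solve (x ∷ y ∷ δ ∷ ε ∷ T ∷ K ∷ P ∷ [])))
              1ℤ (solve (x ∷ y ∷ δ ∷ T ∷ [])))
            (solve (a ∷ b ∷ d ∷ []))
        }

open import Defs
open import Data.Bool.Base using (if_then_else_; _∧_)
open import Data.Empty using (⊥-elim)
open import Data.Integer.Base as ℤ using (ℤ; +_; -_; -[1+_]; 0ℤ; 1ℤ; -1ℤ; ∣_∣)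
import Data.Integer.Properties as ℤₚ
open import Data.Integer.Tactic.RingSolver using (solve-∀; solve)
open import Data.List.Base using ([]; _∷_; _++_; length; filter; drop; applyUpTo)
open import Data.List.Membership.Propositional using (_∈_)
open import Data.List.Properties
  using (filter-accept; filter-reject; length-applyUpTo; length-drop; length-replicate; drop-drop)
import Data.List.Relation.Binary.Infix.Heterogeneous as Infix
import Data.List.Relation.Binary.Pointwise as Pointwise
open import Data.List.Relation.Binary.Prefix.Heterogeneous using ([]; _∷_)
import Data.List.Relation.Binary.Suffix.Heterogeneous as Suffix
open import Data.List.Relation.Unary.All using (All; []; _∷_)
import Data.List.Relation.Unary.All.Properties as Allₚ
open import Data.List.Relation.Unary.Any using (here; there)
open import Data.List.Relation.Unary.Linked using (Linked; []; [-]; _∷_)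
import Data.List.Relation.Unary.Linked.Properties as Linkedₚ
open import Data.Nat.Base
open import Data.Nat.Coprimality using (Coprime; coprime-+; coprime-Bézout)
open import Data.Nat.Divisibility using (_∣_; divides)
open import Data.Nat.GCD using (module Bézout)
open import Data.Nat.Induction using (<-wellFounded)
open import Data.Nat.Properties
import Data.Nat.Tactic.RingSolver as ℕSolver
open import Data.Parity.Base using (0ℙ; 1ℙ)
open import Data.Product.Base using (_×_; _,_; ∃; ∃-syntax; proj₁; proj₂)
open import Data.Sum.Base as Sum using (_⊎_; inj₁; inj₂)
open import Function.Base using (_∘_; case_of_)
open import Induction.WellFounded using (Acc; acc)
open import Relation.Binary.Definitions using (tri<; tri≈; tri>)
open import Relation.Binary.PropositionalEquality
open import Relation.Nullary
open import Relation.Nullary.Decidable using (⌊_⌋)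
open import Relation.Unary using (Decidable)
open Arithmetic

-- Self-conjugate diagrams and their boundary sets

Symmetric : (ℕ → ℕ) → Set
Symmetric l = ∀ r c → c < l r → r < l c

-- The first-column hook set, shifted so that the boundary of the diagram is
-- symmetric about 1/2: row r contributes l r - r.
Maya : (ℕ → ℕ) → ℤ → Set
Maya l n = ∃[ r ] + l r ≡ n ℤ.+ + r

<-cancel : ∀ {m n} → (∀ c → c < m → c < n) → m ≤ n
<-cancel {zero}  h = z≤n
<-cancel {suc m} h = h m ≤-refl

module _ {l : ℕ → ℕ} (sym-l : Symmetric l) where

  -- Symmetry turns the comparison of two rows into one inside a column: c < l r′ gives r ≤ r′ < l
  -- c, and hence c < l r.
  antitone : ∀ {r r′} → r ≤ r′ → l r′ ≤ l r
  antitone {r} {r′} r≤r′ = <-cancel λ c c<lr′ →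
    sym-l c r (≤-<-trans r≤r′ (sym-l r′ c c<lr′))

  hookℕ : ℕ → ℕ → ℕ
  hookℕ r c = (l r ∸ suc c) + (l c ∸ suc r) + 1

  -- Together with `non-box-sum` this is the dichotomy behind all that follows: l r + l c exceeds r
  -- + c + 1 by a positive hook length at a box and is at most r + c elsewhere, so the value r + c +
  -- 1 never occurs.
  hook-sum : ∀ r c → c < l r → l r + l c ≡ hookℕ r c + suc (r + c)
  hook-sum r c b = begin
    l r + l c                                      ≡⟨ cong₂ _+_ (m∸n+n≡m b) (m∸n+n≡m (sym-l r c b)) ⟨
    (l r ∸ suc c + suc c) + (l c ∸ suc r + suc r)  ≡⟨ lemma (l r ∸ suc c) (l c ∸ suc r) r c ⟩
    hookℕ r c + suc (r + c)                        ∎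
    where
    open ≡-Reasoning
    lemma : ∀ a b r c → (a + suc c) + (b + suc r) ≡ (a + b + 1) + suc (r + c)
    lemma = ℕSolver.solve-∀

  hook-positive : ∀ r c → 0 < hookℕ r c
  hook-positive r c = m≤n+m 1 _

  non-box-sum : ∀ r c → ¬ c < l r → l r + l c ≤ r + c
  non-box-sum r c ¬b = subst (l r + l c ≤_) (+-comm c r)
    (+-mono-≤ (≮⇒≥ ¬b) (≮⇒≥ (¬b ∘ sym-l c r)))

  maya-sum : ∀ {n t r c} → + l r ≡ n ℤ.+ + r → + l c ≡ 1ℤ ℤ.- (n ℤ.- + t) ℤ.+ + c →
             l r + l c ≡ t + suc (r + c)
  maya-sum {n} {t} {r} {c} e₁ e₂ = ℤₚ.+-injective
    (trans (cong₂ ℤ._+_ e₁ e₂) (lemma n (+ t) (+ r) (+ c)))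
    where
    lemma : ∀ n t r c → (n ℤ.+ r) ℤ.+ (1ℤ ℤ.- (n ℤ.- t) ℤ.+ c) ≡ t ℤ.+ (1ℤ ℤ.+ (r ℤ.+ c))
    lemma = solve-∀

  maya-exclusive : ∀ n → Maya l n → ¬ Maya l (1ℤ ℤ.- n)
  maya-exclusive n (r , e₁) (c , e₂) = case c <? l r of λ where
      (yes b) → <⇒≢ (m<n+m (suc (r + c)) (hook-positive r c)) (trans (sym total) (hook-sum r c b))
      (no ¬b) → <⇒≱ ≤-refl (subst (_≤ r + c) total (non-box-sum r c ¬b))
    where
    total : l r + l c ≡ suc (r + c)
    total = maya-sum {n} {0} e₁
      (trans e₂ (cong (λ z → 1ℤ ℤ.- z ℤ.+ + c) (sym (ℤₚ.+-identityʳ n))))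

  -- Walk up from row l 0, where l r ≤ r + k. Either some row has l r = r + k + 1 and is the first
  -- member, or the lengths jump past that value between rows r and r + 1. Then column r + 1 + k
  -- ends just below row r, so its length r + 1 gives the member - k; if row 0 is reached, column k
  -- is empty and gives it.
  maya-total-positive : ∀ k → Maya l (+ suc k) ⊎ Maya l (1ℤ ℤ.- + suc k)
  maya-total-positive k = go (l 0) (≤-trans (antitone {0} z≤n) (m≤m+n (l 0) k))
    where
    column : ∀ r → l (r + k) ≡ r → Maya l (1ℤ ℤ.- + suc k)
    column r e = r + k , trans (cong +_ e) (lemma (+ r) (+ k))
      where
      lemma : ∀ r k → r ≡ 1ℤ ℤ.- (1ℤ ℤ.+ k) ℤ.+ (r ℤ.+ k)
      lemma = solve-∀

    outside : ∀ r → l r ≤ r + k → l (r + k) ≤ r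
    outside r le = ≮⇒≥ λ lt → <⇒≱ (sym-l (r + k) r lt) le

    go : ∀ r → l r ≤ r + k → Maya l (+ suc k) ⊎ Maya l (1ℤ ℤ.- + suc k)
    go zero    le = inj₂ (column 0 (n≤0⇒n≡0 (outside 0 le)))
    go (suc r) le with <-cmp (l r) (suc (r + k))
    ... | tri< lt _ _ = go r (s≤s⁻¹ lt)
    ... | tri≈ _ e _  = inj₁ (r , cong +_ (trans e (cong suc (+-comm r k))))
    ... | tri> _ _ gt = inj₂ (column (suc r) (≤-antisym (outside (suc r) le) (sym-l r _ gt)))

  maya-total : ∀ n → Maya l n ⊎ Maya l (1ℤ ℤ.- n)
  maya-total (+ suc k) = maya-total-positive k
  maya-total (+ zero)  = Sum.swap (maya-total-positive 0)
  maya-total -[1+ k ]  = Sum.swap (maya-total-positive (suc k))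

  -- If n - t is missing, then 1 - (n - t) is present. The rows r and c of n and of 1 - (n - t)
  -- satisfy l r + l c = t + r + c + 1, so (r, c) is a box with hook length t.
  hooks⇒maya-closed : ∀ t → 0 < t → (∀ r c → c < l r → hookℕ r c ≢ t) →
                      ∀ n → Maya l n → Maya l (n ℤ.- + t)
  hooks⇒maya-closed t 0<t core n (r , e) with maya-total (n ℤ.- + t)
  ... | inj₁ m = m
  ... | inj₂ (c , e′) with c <? l r
  ...   | yes b = contradiction
    (+-cancelʳ-≡ (suc (r + c)) _ _ (trans (sym (hook-sum r c b)) (maya-sum {n} {t} e e′)))
    (core r c b)
  ...   | no ¬b = contradiction (subst (_≤ r + c) (maya-sum {n} {t} e e′) (non-box-sum r c ¬b))
    (<⇒≱ (≤-trans (n<1+n (r + c)) (m≤n+m _ t)))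

  maya-closed⇒hooks : ∀ t → (∀ n → Maya l n → Maya l (n ℤ.- + t)) →
                      ∀ r c → c < l r → hookℕ r c ≢ t
  maya-closed⇒hooks t closed r c b refl =
    maya-exclusive (n ℤ.- + t) (closed n (r , lemma₁ (+ l r) (+ r))) (c , e)
    where
    n = + l r ℤ.- + r
    lemma₁ : ∀ x y → x ≡ x ℤ.- y ℤ.+ y
    lemma₁ = solve-∀
    lemma₂ : ∀ x y t r c → x ℤ.+ y ≡ t ℤ.+ (1ℤ ℤ.+ (r ℤ.+ c)) →
             y ≡ (t ℤ.+ (1ℤ ℤ.+ (r ℤ.+ c))) ℤ.- x
    lemma₂ x y t r c e = trans (lemma₃ x y) (cong (ℤ._- x) e)
      where
      lemma₃ : ∀ x y → y ≡ (x ℤ.+ y) ℤ.- x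
      lemma₃ = solve-∀
    e : + l c ≡ 1ℤ ℤ.- (n ℤ.- + t) ℤ.+ + c
    e = trans (lemma₂ (+ l r) (+ l c) (+ t) (+ r) (+ c) (cong +_ (hook-sum r c b)))
              (lemma₄ (+ l r) (+ t) (+ r) (+ c))
      where
      lemma₄ : ∀ x t r c → (t ℤ.+ (1ℤ ℤ.+ (r ℤ.+ c))) ℤ.- x ≡ 1ℤ ℤ.- ((x ℤ.- r) ℤ.- t) ℤ.+ c
      lemma₄ = solve-∀

maya-injective : ∀ {l l′} → Symmetric l → Symmetric l′ →
                 (∀ n → Maya l n → Maya l′ n) → (∀ n → Maya l′ n → Maya l n) →
                 ∀ r → l r ≡ l′ r
maya-injective {l} {l′} sym-l sym-l′ to from r = wf r (<-wellFounded r)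
  where
  lemma : ∀ x y → x ≡ x ℤ.- y ℤ.+ y
  lemma = solve-∀

  -- Row r of `l` has a partner k in `l′` with l r - r = l′ k - k. The values l r - r strictly
  -- decrease, so k < r would contradict l k = l′ k. Hence k ≥ r and l r ≤ l′ k ≤ l′ r.
  half : ∀ {l l′} → Symmetric l → Symmetric l′ → (∀ n → Maya l n → Maya l′ n) →
         ∀ r → (∀ {k} → k < r → l k ≡ l′ k) → l r ≤ l′ r
  half {l} {l′} sym-l sym-l′ to r ih = case k <? r of λ where
      (yes k<r) → contradiction (+-mono-≤-< (antitone sym-l (<⇒≤ k<r)) k<r)
        (≤⇒≯ (≤-reflexive (trans (cong (_+ r) (ih k<r)) e′)))
      (no k≮r) → ≤-trans
        (+-cancelʳ-≤ r _ _ (≤-trans (+-monoʳ-≤ (l r) (≮⇒≥ k≮r)) (≤-reflexive (sym e′))))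
        (antitone sym-l′ (≮⇒≥ k≮r))
    where
    row = to (+ l r ℤ.- + r) (r , lemma (+ l r) (+ r))
    k = proj₁ row
    lemma₂ : ∀ x y z → (x ℤ.- y ℤ.+ z) ℤ.+ y ≡ x ℤ.+ z
    lemma₂ = solve-∀
    e′ : l′ k + r ≡ l r + k
    e′ = ℤₚ.+-injective (trans (cong (ℤ._+ + r) (proj₂ row)) (lemma₂ (+ l r) (+ r) (+ k)))

  wf : ∀ r → Acc _<_ r → l r ≡ l′ r
  wf r (acc rs) = ≤-antisym (half sym-l sym-l′ to r λ k<r → wf _ (rs k<r))
                            (half sym-l′ sym-l from r λ k<r → sym (wf _ (rs k<r)))

rowLength-drop : ∀ k xs r → rowLength (drop k xs) r ≡ rowLength xs (k + r)
rowLength-drop zero    xs       r = refl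
rowLength-drop (suc k) []       r = refl
rowLength-drop (suc k) (x ∷ xs) r = rowLength-drop k xs r

length-filter-rows : ∀ c xs n → (∀ r → c < rowLength xs r → r < n) →
                     (∀ r → r < n → c < rowLength xs r) → length (filter (c <?_) xs) ≡ n
length-filter-rows c []       zero    to from = refl
length-filter-rows c []       (suc n) to from = contradiction (from 0 z<s) λ ()
length-filter-rows c (x ∷ xs) n       to from = go n to from (c <? x)
  where
  go : ∀ n → (∀ r → c < rowLength (x ∷ xs) r → r < n) → (∀ r → r < n → c < rowLength (x ∷ xs) r) →
       Dec (c < x) → length (filter (c <?_) (x ∷ xs)) ≡ n
  go zero    to from (yes c<x) = contradiction (to 0 c<x) λ ()
  go (suc n) to from (yes c<x) = trans (cong length (filter-accept (c <?_) c<x))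
    (cong suc (length-filter-rows c xs n (λ r → s<s⁻¹ ∘ to (suc r)) (λ r → from (suc r) ∘ s<s)))
  go (suc n) to from (no c≮x)  = contradiction (from 0 z<s) c≮x
  go zero    to from (no c≮x)  = trans (cong length (filter-reject (c <?_) c≮x))
    (length-filter-rows c xs zero (λ r b → contradiction (to (suc r) b) λ ()) (λ r → λ ()))

rows : Partition → ℕ → ℕ
rows μ = rowLength (parts μ)

-- By symmetry the rows below r that reach past column c are r + 1, ..., l c - 1, so counting them
-- gives l c - (r + 1).
hook≡hookℕ : ∀ μ (sc : SelfConjugate μ) r c → hook μ r c ≡ hookℕ {rows μ} sc r c
hook≡hookℕ μ sc r c = cong (λ x → (rows μ r ∸ suc c) + x + 1)
  (length-filter-rows c (drop (suc r) (parts μ)) (rows μ c ∸ suc r)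
    (λ k b → m+n≤o⇒n≤o∸m (sc (suc r + k) c (subst (c <_) (rowLength-drop (suc r) (parts μ) k) b)))
    (λ k lt → subst (c <_) (sym (rowLength-drop (suc r) (parts μ) k)) (sc c (suc r + k) (n<o∸m⇒m+n<o lt))))
  where
  m+n≤o⇒n≤o∸m : ∀ {k n} → suc r + k < n → k < n ∸ suc r
  m+n≤o⇒n≤o∸m {k} {n} lt = subst (_≤ n ∸ suc r) (m+n∸m≡n (suc r) (suc k))
    (∸-monoˡ-≤ (suc r) (subst (_≤ n) (cong suc (sym (+-suc r k))) lt))
  n<o∸m⇒m+n<o : ∀ {k n} → k < n ∸ suc r → suc r + k < n
  n<o∸m⇒m+n<o {k} {n} lt = subst (_≤ n) (cong suc (+-suc r k))
    (subst (suc r + suc k ≤_) (m+[n∸m]≡n le) (+-monoʳ-≤ (suc r) lt))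
    where
    le : suc r ≤ n
    le = ≮⇒≥ λ n<sr → contradiction (subst (k <_) (m≤n⇒m∸n≡0 (<⇒≤ n<sr)) lt) λ ()

module _ (μ : Partition) (sc : SelfConjugate μ) where

  core⇒maya-closed : ∀ t → 0 < t → IsCore t μ → ∀ n → Maya (rows μ) n → Maya (rows μ) (n ℤ.- + t)
  core⇒maya-closed t 0<t core = hooks⇒maya-closed sc t 0<t
    λ r c b e → core r c b (trans (hook≡hookℕ μ sc r c) e)

  maya-closed⇒core : ∀ t → (∀ n → Maya (rows μ) n → Maya (rows μ) (n ℤ.- + t)) → IsCore t μ
  maya-closed⇒core t closed r c b e =
    maya-closed⇒hooks sc t closed r c b (trans (sym (hook≡hookℕ μ sc r c)) e)

  diagonal-hook : ∀ r u → rows μ r ≡ u + suc r → hook μ r r ≡ suc (u + u)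
  diagonal-hook r u e = begin
    hook μ r r                                    ≡⟨ hook≡hookℕ μ sc r r ⟩
    rows μ r ∸ suc r + (rows μ r ∸ suc r) + 1     ≡⟨ cong (λ x → x + x + 1)
      (trans (cong (_∸ suc r) e) (m+n∸n≡m u (suc r))) ⟩
    u + u + 1                                     ≡⟨ +-comm (u + u) 1 ⟩
    suc (u + u)                                   ∎
    where open ≡-Reasoning

  MD⇒maya : ∀ u → MD μ (suc (u + u)) → Maya (rows μ) (+ suc u)
  MD⇒maya u (r , b , e) = r , cong +_ (trans split (trans (cong (_+ suc r) v≡u) (+-suc u r)))
    where
    v = rows μ r ∸ suc r
    split : rows μ r ≡ v + suc r
    split = sym (m∸n+n≡m b)
    v≡u : v ≡ u
    v≡u = *-cancelˡ-≡ v u 2 (trans (lemma v) (trans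
      (suc-injective (trans (sym (diagonal-hook r v split)) e)) (sym (lemma u))))
      where
      lemma : ∀ x → 2 * x ≡ x + x
      lemma = ℕSolver.solve-∀

  maya⇒MD : ∀ u → Maya (rows μ) (+ suc u) → MD μ (suc (u + u))
  maya⇒MD u (r , e) = r , subst (r <_) (sym e′) (m≤n+m (suc r) u) , diagonal-hook r u e′
    where
    e′ : rows μ r ≡ u + suc r
    e′ = trans (ℤₚ.+-injective e) (sym (+-suc u r))

rows-injective : ∀ {μ ν} → (∀ r → rows μ r ≡ rows ν r) → μ ≡ ν
rows-injective {μ} {ν} e = parts-injective (go (positive μ) (positive ν) e)
  where
  go : ∀ {xs ys} → All (0 <_) xs → All (0 <_) ys → (∀ r → rowLength xs r ≡ rowLength ys r) → xs ≡ ys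
  go []       []       e = refl
  go []       (p ∷ _)  e = contradiction (e 0) (<⇒≢ p)
  go (p ∷ _)  []       e = contradiction (sym (e 0)) (<⇒≢ p)
  go (_ ∷ ps) (_ ∷ qs) e = cong₂ _∷_ (e 0) (go ps qs (e ∘ suc))

-- Building a self-conjugate partition from its diagonal hooks

rowLength-applyUpTo : ∀ f {m r} → r < m → rowLength (applyUpTo f m) r ≡ f r
rowLength-applyUpTo f {suc m} {zero}  _  = refl
rowLength-applyUpTo f {suc m} {suc r} lt = rowLength-applyUpTo (f ∘ suc) (s<s⁻¹ lt)

applyUpTo-row : ∀ f {m r c} → c < rowLength (applyUpTo f m) r → r < m
applyUpTo-row f {suc m} {zero}  _ = z<s
applyUpTo-row f {suc m} {suc r} b = s<s (applyUpTo-row (f ∘ suc) b)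

module _ (μ : Partition) (sc : SelfConjugate μ) (m : ℕ) (fits : rows μ 0 ≤ m) where

  -- The diagram with a new outermost diagonal hook of length 2 m + 1. An old row r becomes row r +
  -- 1 and grows by one box, so its contribution l r - r is unchanged; the new row 0 contributes m +
  -- 1.
  addHook : Partition
  addHook = mkPartition (suc m ∷ applyUpTo (suc ∘ rows μ) m)
    (linked m fits) (z<s ∷ Allₚ.applyUpTo⁺₂ (suc ∘ rows μ) m λ _ → z<s)
    where
    linked : ∀ m → rows μ 0 ≤ m → Linked _≥_ (suc m ∷ applyUpTo (suc ∘ rows μ) m)
    linked zero    _   = [-]
    linked (suc m) fits = s≤s fits ∷ Linkedₚ.applyUpTo⁺₂ (suc ∘ rows μ) (suc m) λ r → s≤s (antitone sc (n≤1+n r))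

  addHook-row : ∀ {r} → r < m → rows addHook (suc r) ≡ suc (rows μ r)
  addHook-row = rowLength-applyUpTo (suc ∘ rows μ)

  addHook-selfConjugate : SelfConjugate addHook
  addHook-selfConjugate zero    zero    b = b
  addHook-selfConjugate zero    (suc c) b = subst (0 <_) (sym (addHook-row (s<s⁻¹ b))) z<s
  addHook-selfConjugate (suc r) zero    b = s<s (applyUpTo-row (suc ∘ rows μ) b)
  addHook-selfConjugate (suc r) (suc c) b =
    subst (suc r <_) (sym (addHook-row c<m)) (s<s (sc r c c<r))
    where
    c<r : c < rows μ r
    c<r = s<s⁻¹ (subst (suc c <_) (addHook-row (applyUpTo-row (suc ∘ rows μ) b)) b)
    c<m : c < m
    c<m = <-≤-trans c<r (≤-trans (antitone sc z≤n) fits)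

  addHook-maya⁻ : ∀ u → Maya (rows addHook) (+ suc u) → u ≡ m ⊎ Maya (rows μ) (+ suc u)
  addHook-maya⁻ u (zero , e)  = inj₁ (suc-injective (trans (sym (+-identityʳ (suc u))) (sym (ℤₚ.+-injective e))))
  addHook-maya⁻ u (suc r , e) = inj₂ (r , cong +_
    (suc-injective (trans (sym (addHook-row r<m)) (trans e′ (+-suc (suc u) r)))))
    where
    e′ : rows addHook (suc r) ≡ suc u + suc r
    e′ = ℤₚ.+-injective e
    r<m : r < m
    r<m = applyUpTo-row (suc ∘ rows μ) (subst (0 <_) (sym e′) z<s)

  addHook-maya-new : Maya (rows addHook) (+ suc m)
  addHook-maya-new = 0 , cong +_ (sym (+-identityʳ (suc m)))

  addHook-maya-old : ∀ u → Maya (rows μ) (+ suc u) → Maya (rows addHook) (+ suc u)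
  addHook-maya-old u (r , e) = suc r , cong +_
    (trans (addHook-row r<m) (trans (cong suc e′) (sym (+-suc (suc u) r))))
    where
    e′ : rows μ r ≡ suc u + r
    e′ = ℤₚ.+-injective e
    r<m : r < m
    r<m = ≤-trans (subst (r <_) (sym e′) (s≤s (m≤n+m r u))) (≤-trans (antitone sc z≤n) fits)

module _ {Q : ℕ → Set} (Q? : Decidable Q) where

  -- Hooks are added in increasing order, so that each new one is outermost; the bound on row 0 is
  -- what lets it fit around the diagram built so far.
  fromDiagonal : ∀ b → ∃[ μ ] SelfConjugate μ × rows μ 0 ≤ b ×
    (∀ u → (Maya (rows μ) (+ suc u) → u < b × Q u) × (u < b → Q u → Maya (rows μ) (+ suc u)))
  fromDiagonal zero = mkPartition [] [] [] , (λ _ _ ()) , z≤n , λ u → (λ { (r , ()) }) , λ ()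
  fromDiagonal (suc b) with fromDiagonal b | Q? b
  ... | μ , sc , fits , spec | no ¬q = μ , sc , m≤n⇒m≤1+n fits , λ u →
    (λ m → let u<b , q = proj₁ (spec u) m in m<n⇒m<1+n u<b , q) ,
    λ u<1+b q → proj₂ (spec u) (≤∧≢⇒< (s≤s⁻¹ u<1+b) λ { refl → ¬q q }) q
  ... | μ , sc , fits , spec | yes q =
    addHook μ sc b fits , addHook-selfConjugate μ sc b fits , ≤-refl , λ u → to u , from u
    where
    to : ∀ u → Maya (rows (addHook μ sc b fits)) (+ suc u) → u < suc b × Q u
    to u m with addHook-maya⁻ μ sc b fits u m
    ... | inj₁ refl = ≤-refl , q
    ... | inj₂ m′   = let u<b , q′ = proj₁ (spec u) m′ in m<n⇒m<1+n u<b , q′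
    from : ∀ u → u < suc b → Q u → Maya (rows (addHook μ sc b fits)) (+ suc u)
    from u u<1+b q′ with u ≟ b
    ... | yes refl = addHook-maya-new μ sc b fits
    ... | no u≢b   = addHook-maya-old μ sc b fits u (proj₂ (spec u) (≤∧≢⇒< (s≤s⁻¹ u<1+b) u≢b) q′)

-- The diagram is built from the positive elements. In either set n ≤ 0 occurs exactly when 1 - n
-- does not, so agreement on the positive integers extends to all.
realise : ∀ {M : ℤ → Set} → Decidable M → (∀ n → M n → ¬ M (1ℤ ℤ.- n)) →
          (∀ n → M n ⊎ M (1ℤ ℤ.- n)) → ∀ b → (∀ u → M (+ suc u) → u < b) →
          ∃[ μ ] SelfConjugate μ × (∀ n → Maya (rows μ) n → M n) × (∀ n → M n → Maya (rows μ) n)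
realise {M} M? exclusive total b bounded with fromDiagonal (λ u → M? (+ suc u)) b
... | μ , sc , _ , spec = μ , sc , to , from
  where
  to⁺ : ∀ u → Maya (rows μ) (+ suc u) → M (+ suc u)
  to⁺ u = proj₂ ∘ proj₁ (spec u)

  from⁺ : ∀ u → M (+ suc u) → Maya (rows μ) (+ suc u)
  from⁺ u m = proj₂ (spec u) (bounded u m) m

  to-neg : ∀ u → Maya (rows μ) (1ℤ ℤ.- + suc u) → M (1ℤ ℤ.- + suc u)
  to-neg u m with total (+ suc u)
  ... | inj₁ m′ = contradiction m (maya-exclusive sc (+ suc u) (from⁺ u m′))
  ... | inj₂ m′ = m′

  from-neg : ∀ u → M (1ℤ ℤ.- + suc u) → Maya (rows μ) (1ℤ ℤ.- + suc u)
  from-neg u m with maya-total sc (+ suc u)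
  ... | inj₁ m′ = contradiction m (exclusive (+ suc u) (to⁺ u m′))
  ... | inj₂ m′ = m′

  to : ∀ n → Maya (rows μ) n → M n
  to (+ suc u) = to⁺ u
  to (+ zero)  = to-neg 0
  to -[1+ u ]  = to-neg (suc u)

  from : ∀ n → M n → Maya (rows μ) n
  from (+ suc u) = from⁺ u
  from (+ zero)  = from-neg 0
  from -[1+ u ]  = from-neg (suc u)

-- Lattice paths: forbidden patterns and height bounds

height : Path → ℕ → ℤ
height _             zero    = 0ℤ
height []            (suc m) = 0ℤ
height ((_ , y) ∷ P) (suc m) = y ℤ.+ height P m

total : Path → ℤ
total []            = 0ℤ
total ((_ , y) ∷ P) = y ℤ.+ total P

Motzkin : Path → Set
Motzkin = All (_∈ U ∷ D ∷ F ∷ [])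

pattern isU = here refl
pattern isD = there (here refl)
pattern isF = there (there (here refl))

private
  0+≤ : ∀ {x y} → x ℤ.≤ y → 0ℤ ℤ.+ x ℤ.≤ y
  0+≤ = subst (ℤ._≤ _) (sym (ℤₚ.+-identityˡ _))

-- The height bound for windows turns "no F^i U at the start" into a bound on
-- all short initial heights: after a first D, the window adds at most 1 again.
prefix-nonpositive : ∀ n Q → Motzkin Q → (∀ i → i < n → ¬ StartsWith Q (F^ i ++ U ∷ [])) →
                     (∀ j m → m ≤ n → height (drop j Q) m ℤ.≤ 1ℤ) →
                     ∀ m → m ≤ n → height Q m ℤ.≤ 0ℤ
prefix-nonpositive n       Q       steps        noFU win zero    _       = ℤₚ.≤-refl
prefix-nonpositive n       []      steps        noFU win (suc m) _       = ℤₚ.≤-refl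
prefix-nonpositive (suc n) (_ ∷ Q) (isU ∷ _)    noFU win (suc m) _       =
  ⊥-elim (noFU 0 z<s (refl ∷ []))
prefix-nonpositive (suc n) (_ ∷ Q) (isD ∷ _)    noFU win (suc m) (s≤s m≤n) =
  ℤₚ.+-monoʳ-≤ -1ℤ (win 1 m (m≤n⇒m≤1+n m≤n))
prefix-nonpositive (suc n) (_ ∷ Q) (isF ∷ steps) noFU win (suc m) (s≤s m≤n) =
  0+≤ (prefix-nonpositive n Q steps (λ i i<n → noFU (suc i) (s<s i<n) ∘ (refl ∷_))
    (λ j k k≤n → win (suc j) k (m≤n⇒m≤1+n k≤n)) m m≤n)

-- Induction along the path. After a leading U the rest of the window does not begin with F^i U, so
-- `prefix-nonpositive` bounds it by 0; a leading D pays for the 1 that the tail may gain.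
noUFU⇒windows : ∀ n Q → Motzkin Q → (∀ i → 2 + i ≤ n → ¬ Contains Q (U ∷ F^ i ++ U ∷ [])) →
                ∀ j m → m ≤ n → height (drop j Q) m ℤ.≤ 1ℤ
noUFU⇒windows n Q        steps       noUFU zero    zero    _   = 0≤1
noUFU⇒windows n []       steps       noUFU zero    (suc m) _   = 0≤1
noUFU⇒windows n []       steps       noUFU (suc j) zero    _   = 0≤1
noUFU⇒windows n []       steps       noUFU (suc j) (suc m) _   = 0≤1
noUFU⇒windows n (_ ∷ Q)  (_ ∷ steps) noUFU (suc j) m       m≤n =
  noUFU⇒windows n Q steps (λ i le → noUFU i le ∘ Infix.there) j m m≤n
noUFU⇒windows (suc n) (_ ∷ Q) (isU ∷ steps) noUFU zero (suc m) (s≤s m≤n) =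
  ℤₚ.+-monoʳ-≤ 1ℤ (prefix-nonpositive n Q steps
    (λ i i<n p → noUFU i (s≤s i<n) (Infix.here (refl ∷ p)))
    (λ j k k≤n → noUFU⇒windows (suc n) Q steps (λ i le → noUFU i le ∘ Infix.there) j k (m≤n⇒m≤1+n k≤n))
    m m≤n)
noUFU⇒windows (suc n) (_ ∷ Q) (isD ∷ steps) noUFU zero (suc m) (s≤s m≤n) =
  ℤₚ.≤-trans (ℤₚ.+-monoʳ-≤ -1ℤ
    (noUFU⇒windows (suc n) Q steps (λ i le → noUFU i le ∘ Infix.there) zero m (m≤n⇒m≤1+n m≤n))) 0≤1
noUFU⇒windows (suc n) (_ ∷ Q) (isF ∷ steps) noUFU zero (suc m) (s≤s m≤n) =
  0+≤ (noUFU⇒windows (suc n) Q steps (λ i le → noUFU i le ∘ Infix.there) zero m (m≤n⇒m≤1+n m≤n))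

-- The first step other than F cannot be U, because of the prefixes, nor D, because the suffix after
-- it would then have to rise.
flat : ∀ Q → Motzkin Q → (∀ j → total (drop j Q) ℤ.≤ 0ℤ) →
       (∀ m → m ≤ length Q → height Q m ℤ.≤ 0ℤ) → 0ℤ ℤ.≤ total Q → Q ≡ F^ length Q
flat []      _               _   _   _  = refl
flat (_ ∷ Q) (isU ∷ _)       suf pre 0≤ with pre 1 (s≤s z≤n)
... | ℤ.+≤+ ()
flat (_ ∷ Q) (isD ∷ _)       suf pre 0≤ with ℤₚ.≤-trans 0≤ (ℤₚ.+-monoʳ-≤ -1ℤ (suf 1))
... | ()
flat (_ ∷ Q) (isF ∷ steps)   suf pre 0≤ = cong (F ∷_) (flat Q steps (suf ∘ suc)
  (λ m m≤ → subst (ℤ._≤ 0ℤ) (ℤₚ.+-identityˡ _) (pre (suc m) (s≤s m≤)))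
  (subst (0ℤ ℤ.≤_) (ℤₚ.+-identityˡ _) 0≤))

-- A shortest suffix with positive total starts with U and goes on with total 0. The window bound
-- keeps the prefixes after that U at most 0 and minimality does so for the suffixes, so by `flat`
-- the path ends with U F^k.
suffix-nonpositive : ∀ n Q → Motzkin Q → (∀ k → k < n → ¬ EndsWith Q (U ∷ F^ k)) →
                     (∀ j m → m ≤ n → height (drop j Q) m ℤ.≤ 1ℤ) → length Q ≤ n →
                     ∀ j → total (drop j Q) ℤ.≤ 0ℤ
suffix-nonpositive n [] _ _ _ _ zero    = ℤₚ.≤-refl
suffix-nonpositive n [] _ _ _ _ (suc j) = ℤₚ.≤-refl
suffix-nonpositive n (q ∷ Q) (st ∷ steps) noEnd win len≤ j = go st j
  where
  tails : ∀ j → total (drop j Q) ℤ.≤ 0ℤ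
  tails = suffix-nonpositive n Q steps (λ k k<n → noEnd k k<n ∘ Suffix.there) (win ∘ suc) (<⇒≤ len≤)

  go : q ∈ U ∷ D ∷ F ∷ [] → ∀ j → total (drop j (q ∷ Q)) ℤ.≤ 0ℤ
  go _   (suc j) = tails j
  go isF zero    = 0+≤ (tails 0)
  go isD zero    = ℤₚ.≤-trans (ℤₚ.+-monoʳ-≤ -1ℤ (tails 0)) ℤ.-≤+
  go isU zero    with total Q ℤₚ.<? 0ℤ
  ... | yes neg = ℤₚ.i<j⇒suc[i]≤j neg
  ... | no ¬neg = ⊥-elim (noEnd (length Q) len≤
    (subst (λ R → EndsWith (U ∷ R) (U ∷ F^ length Q)) (sym Q≡F)
                    (Suffix.here (Pointwise.refl refl))))
    where
    Q≡F : Q ≡ F^ length Q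
    Q≡F = flat Q steps tails
      (λ m m≤ → from≤ (win 0 (suc m) (≤-trans (s≤s m≤) len≤)) (lemma (height Q m)))
      (ℤₚ.≮⇒≥ ¬neg)
      where
      lemma : ∀ h → 0ℤ ℤ.- h ≡ 1ℤ ℤ.- (1ℤ ℤ.+ h)
      lemma = solve-∀

endsWith-drop : ∀ j {P Q} → EndsWith (drop j P) Q → EndsWith P Q
endsWith-drop zero    e = e
endsWith-drop (suc j) {[]}    e = e
endsWith-drop (suc j) {_ ∷ P} e = Suffix.there (endsWith-drop j e)

endsWith⇒drop : ∀ {P Q} → EndsWith P Q → ∃[ j ] drop j P ≡ Q × j + length Q ≡ length P
endsWith⇒drop (Suffix.here e)  with refl ← Pointwise.Pointwise-≡⇒≡ e = 0 , refl , refl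
endsWith⇒drop (Suffix.there e) = let j , eq , len = endsWith⇒drop e in suc j , eq , cong suc len

startsWith⇒height : ∀ i {Q} → StartsWith Q (F^ i ++ U ∷ []) → height Q (suc i) ≡ 1ℤ
startsWith⇒height zero    (refl ∷ []) = refl
startsWith⇒height (suc i) (refl ∷ p)  = trans (ℤₚ.+-identityˡ _) (startsWith⇒height i p)

startsWith⇒length : ∀ i {Q} → StartsWith Q (F^ i ++ U ∷ []) → suc i ≤ length Q
startsWith⇒length zero    (_ ∷ _) = s≤s z≤n
startsWith⇒length (suc i) (_ ∷ p) = s≤s (startsWith⇒length i p)

contains⇒height : ∀ i {P} → Contains P (U ∷ F^ i ++ U ∷ []) →
  ∃[ j ] 2 + i + j ≤ length P × height (drop j P) (2 + i) ≡ + 2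
contains⇒height i (Infix.here (refl ∷ p)) =
  0 , s≤s (≤-trans (≤-reflexive (+-identityʳ (suc i))) (startsWith⇒length i p)) ,
  cong (λ z → 1ℤ ℤ.+ z) (startsWith⇒height i p)
contains⇒height i (Infix.there c) = let j , le , e = contains⇒height i c in
  suc j , ≤-trans (≤-reflexive (+-suc (2 + i) j)) (s≤s le) , e

total-F^ : ∀ k → total (F^ k) ≡ 0ℤ
total-F^ zero    = refl
total-F^ (suc k) = trans (ℤₚ.+-identityˡ _) (total-F^ k)

height-drop : ∀ j P m → height (drop j P) m ≡ height P (j + m) ℤ.- height P j
height-drop zero    P       m       = sym (ℤₚ.+-identityʳ _)
height-drop (suc j) []      zero    = refl
height-drop (suc j) []      (suc m) = refl
height-drop (suc j) ((_ , y) ∷ P) m = trans (height-drop j P m) (lemma y (height P (j + m)) (height P j))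
  where
  lemma : ∀ y a b → a ℤ.- b ≡ (y ℤ.+ a) ℤ.- (y ℤ.+ b)
  lemma = solve-∀

height-total : ∀ P → height P (length P) ≡ total P
height-total []            = refl
height-total ((_ , y) ∷ P) = cong (λ z → y ℤ.+ z) (height-total P)

height-applyUpTo : ∀ (f : ℕ → ℤ) n m → m ≤ n →
                   height (applyUpTo (λ j → 1ℤ , f (suc j) ℤ.- f j) n) m ≡ f m ℤ.- f 0
height-applyUpTo f n       zero    _         = sym (ℤₚ.+-inverseʳ (f 0))
height-applyUpTo f (suc n) (suc m) (s≤s m≤n) =
  trans (cong (λ z → (f 1 ℤ.- f 0) ℤ.+ z) (height-applyUpTo (f ∘ suc) n m m≤n)) (lemma (f 0) (f 1) (f (suc m)))
  where
  lemma : ∀ a b c → (b ℤ.- a) ℤ.+ (c ℤ.- b) ≡ c ℤ.- a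
  lemma = solve-∀

module _ (n δ : ℕ) (near : ℕ → Set) where

  -- The range of j: F^j U reaches height 1 at column j + 1, whose mirror image in the left centre
  -- is 2 (j + 1) + δ columns away. The two heights differ by 2, which is forbidden as soon as this
  -- distance fits into a window.
  record Patterns (P : Path) : Set where
    field
      noUFU   : ∀ i → 2 + i ≤ n → ¬ Contains P (U ∷ F^ i ++ U ∷ [])
      noStart : ∀ j → suc j + suc j + δ ≤ n → ¬ StartsWith P (F^ j ++ U ∷ [])
      noEnd   : ∀ k → near (suc k) → ¬ EndsWith P (U ∷ F^ k)

  -- Across a centre only the simplest comparisons are kept: a column with its own mirror image at
  -- the start, and with the last value of the path at the end. The remaining pairs are recovered in
  -- `shape⇒good`.
  record Shape (h : ℕ → ℤ) (W : ℕ) : Set where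
    field
      win   : ∀ j m → j + m ≤ W → m ≤ n → h (j + m) ℤ.- h j ℤ.≤ 1ℤ
      start : ∀ m → m ≤ W → m + m + δ ≤ n → h m ℤ.≤ 0ℤ
      end   : ∀ j l → j + l ≡ W → near l → h W ℤ.≤ h j

  patterns⇒shape : (∀ {k l} → k ≤ l → near l → near k) → (∀ {l} → near l → l ≤ n) →
                   ∀ {P} → Motzkin P → Patterns P → Shape (height P) (length P)
  patterns⇒shape near-mono near≤ {P} steps patterns = record
    { win   = λ j m _ m≤n → subst (ℤ._≤ 1ℤ) (height-drop j P m) (windows j m m≤n)
    ; start = λ m _ m≤ → prefix-nonpositive m P steps
        (λ i i<m → noStart i (≤-trans (+-monoˡ-≤ δ (+-mono-≤ i<m i<m)) m≤))
        (λ j k k≤m → windows j k (≤-trans k≤m (≤-trans (≤-trans (m≤m+n m m) (m≤m+n (m + m) δ)) m≤)))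
        m ≤-refl
    ; end = λ j l j+l≡W near-l → ends j l j+l≡W near-l
    }
    where
    open Patterns patterns

    windows : ∀ j m → m ≤ n → height (drop j P) m ℤ.≤ 1ℤ
    windows = noUFU⇒windows n P steps noUFU

    ends : ∀ j l → j + l ≡ length P → near l → height P (length P) ℤ.≤ height P j
    ends j l j+l≡W near-l = ℤₚ.i-j≤0⇒i≤j (subst (ℤ._≤ 0ℤ) total≡
      (suffix-nonpositive l (drop j P) (Allₚ.drop⁺ j steps)
        (λ k k<l → noEnd k (near-mono k<l near-l) ∘ endsWith-drop j)
        (λ k m m≤l → subst (λ Q → height Q m ℤ.≤ 1ℤ) (sym (drop-drop j k P))
          (windows (j + k) m (≤-trans m≤l (near≤ near-l))))
        (≤-reflexive length≡) 0))
      where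
      length≡ : length (drop j P) ≡ l
      length≡ = trans (length-drop j P) (trans (cong (_∸ j) (sym j+l≡W)) (m+n∸m≡n j l))
      total≡ : total (drop j P) ≡ height P (length P) ℤ.- height P j
      total≡ = begin
        total (drop j P)                        ≡⟨ height-total (drop j P) ⟨
        height (drop j P) (length (drop j P))   ≡⟨ cong (height (drop j P)) length≡ ⟩
        height (drop j P) l                     ≡⟨ height-drop j P l ⟩
        height P (j + l) ℤ.- height P j         ≡⟨ cong (λ k → height P k ℤ.- height P j) j+l≡W ⟩
        height P (length P) ℤ.- height P j      ∎
        where open ≡-Reasoning

  shape⇒patterns : (∀ {l} → near l → l ≤ n) →
                   ∀ {P} → Shape (height P) (length P) → Patterns P
  shape⇒patterns near≤ {P} shape = record
    { noUFU   = λ i 2+i≤n c → let j , le , e = contains⇒height i c in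
        absurd₂ (subst (ℤ._≤ 1ℤ) (trans (sym (height-drop j P (2 + i))) e)
          (win j (2 + i) (≤-trans (≤-reflexive (+-comm j (2 + i))) le) 2+i≤n))
    ; noStart = λ j le p → absurd₁ (subst (ℤ._≤ 0ℤ) (startsWith⇒height j p) (start (suc j) (startsWith⇒length j p) le))
    ; noEnd   = λ k near-k e → let j , eq , len = endsWith⇒drop e in
        absurd₁ (subst (ℤ._≤ 0ℤ) (rise k j eq len)
          (ℤₚ.i≤j⇒i-j≤0 (end j (suc k) (trans (cong (λ z → j + suc z) (sym (length-replicate k))) len) near-k)))
    }
    where
    open Shape shape
    absurd₁ : ¬ 1ℤ ℤ.≤ 0ℤ
    absurd₁ (ℤ.+≤+ ())
    absurd₂ : ¬ + 2 ℤ.≤ 1ℤ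
    absurd₂ (ℤ.+≤+ (s≤s ()))
    rise : ∀ k j → drop j P ≡ U ∷ F^ k → j + suc (length (F^ k)) ≡ length P → height P (length P) ℤ.- height P j ≡ 1ℤ
    rise k j eq len = begin
      height P (length P) ℤ.- height P j            ≡⟨ cong (λ m → height P m ℤ.- height P j) len ⟨
      height P (j + length (U ∷ F^ k)) ℤ.- height P j  ≡⟨ height-drop j P (length (U ∷ F^ k)) ⟨
      height (drop j P) (length (U ∷ F^ k))         ≡⟨ cong (λ Q → height Q (length (U ∷ F^ k))) eq ⟩
      height (U ∷ F^ k) (length (U ∷ F^ k))         ≡⟨ height-total (U ∷ F^ k) ⟩
      1ℤ ℤ.+ total (F^ k)                           ≡⟨ cong (λ z → 1ℤ ℤ.+ z) (total-F^ k) ⟩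
      1ℤ                                            ∎
      where open ≡-Reasoning

-- The end of the path is the centre of symmetry of f for even d (ε = 0); for odd d it
-- replaces the first column beyond that centre.
Near : ℕ → ℕ → ℕ → Set
Near n zero    l = l + l ≤ n
Near n (suc _) l = l ≤ n

Near-mono : ∀ n ε {k l} → k ≤ l → Near n ε l → Near n ε k
Near-mono n zero    k≤l near = ≤-trans (+-mono-≤ k≤l k≤l) near
Near-mono n (suc _) k≤l near = ≤-trans k≤l near

Near≤ : ∀ n ε {l} → Near n ε l → l ≤ n
Near≤ n zero    {l} near = ≤-trans (m≤m+n l l) near
Near≤ n (suc _)     near = near

-- K is the last column of the abacus, ε and δ are the parities of d and s, Δ = ⌈ d /2⌉,
-- and position (i, j) has label 2 (e + (s + d) i + d j) - 1.
record Parameters (s d : ℕ) : Set where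
  field
    K ε δ Δ : ℕ
    ε≤1     : ε ≤ 1
    δ≤1     : δ ≤ 1
    1≤ε+δ   : 1 ≤ ε + δ
    size    : s + d ≡ K + K + ε + δ
    2≤size  : 2 ≤ s + d
    halves  : d + ε ≡ Δ + Δ
    e       : ℤ
    origin  : e ℤ.+ e ℤ.+ + (s + d) ≡ 1ℤ ℤ.+ + d ℤ.* + δ
    u v     : ℤ
    bézout  : + (s + d) ℤ.* u ℤ.+ + d ℤ.* v ≡ 1ℤ

  W : ℕ
  W = K + ε

  2≤K+ε+δ : 2 ≤ K + ε + δ
  2≤K+ε+δ = go K size
    where
    go : ∀ K → s + d ≡ K + K + ε + δ → 2 ≤ K + ε + δ
    go zero    e = subst (2 ≤_) e 2≤size
    go (suc k) _ = s≤s (≤-trans 1≤ε+δ (≤-trans (m≤n+m (ε + δ) k) (≤-reflexive (sym (+-assoc k ε δ)))))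

-- Path conditions against window inequalities

module Profile {s d : ℕ} (params : Parameters s d) (n : ℕ) (1≤n : 1 ≤ n) (h : ℕ → ℤ) where

  open Parameters params

  Column : ℤ → ℤ → Set
  Column x a = ∃[ k ] k ≤ K × + k ≡ x × h k ≡ a

  private
    lo : ∀ {x a} → Column x a → 0ℤ ℤ.≤ x
    lo (k , _ , refl , _) = ℤ.+≤+ z≤n

    hi : ∀ {x a} → Column x a → x ℤ.≤ + K
    hi (k , k≤K , refl , _) = ℤ.+≤+ k≤K

    functional : ∀ {x a b} → Column x a → Column x b → a ≡ b
    functional (k , _ , refl , refl) (.k , _ , refl , refl) = refl

    defined : ∀ x → 0ℤ ℤ.≤ x → x ℤ.≤ + K → ∃ (Column x)
    defined (+ k) _ (ℤ.+≤+ k≤K) = h k , k , k≤K , refl , refl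

  open Abacus (+ K) (+ ε) (+ δ) (+ (s + d)) (+ d) (+ n)
    (ℤ.+≤+ z≤n) (ℤ.+≤+ z≤n) (ℤ.+≤+ z≤n) (ℤ.+≤+ z≤n)
    (cong +_ size) (ℤ.+≤+ 2≤size) (ℤ.+≤+ 2≤K+ε+δ) (+ Δ) (cong +_ halves)
    (ℤ.+≤+ 1≤n) (ℤ.+≤+ ε≤1) (ℤ.+≤+ δ≤1) e origin u v bézout
    Column lo hi functional defined public

  private
    column : ∀ {k} → k ≤ K → Column (+ k) (h k)
    column {k} k≤K = k , k≤K , refl , refl

    wlog : ∀ (R : ℕ → ℕ → Set) → (∀ {j k} → R j k → R k j) →
           (∀ {j k} → j ≤ k → k ≤ K → R j k) → ∀ {j k} → j ≤ K → k ≤ K → R j k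
    wlog R symmetric f {j} {k} j≤K k≤K with ≤-total j k
    ... | inj₁ j≤k = f j≤k k≤K
    ... | inj₂ k≤j = symmetric (f k≤j j≤K)

    K≤W : K ≤ W
    K≤W = m≤m+n K ε

  private
    HalfRound : Set
    HalfRound = (ε ≡ 0 × + d ≡ + Δ ℤ.+ + Δ) ⊎ (ε ≡ 1 × + d ℤ.+ 1ℤ ≡ + Δ ℤ.+ + Δ)

    halfRound : HalfRound
    halfRound = go ε ε≤1 halves
      where
      go : ∀ ε → ε ≤ 1 → d + ε ≡ Δ + Δ → (ε ≡ 0 × + d ≡ + Δ ℤ.+ + Δ) ⊎ (ε ≡ 1 × + d ℤ.+ 1ℤ ≡ + Δ ℤ.+ + Δ)
      go zero          _         e = inj₁ (refl , cong +_ (trans (sym (+-identityʳ d)) e))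
      go (suc zero)    _         e = inj₂ (refl , cong +_ e)
      go (suc (suc _)) (s≤s ())

  module _ (h0 : h 0 ≡ 0ℤ) (hW : h W ≡ ℤ.- + Δ)
           (stepD : ∀ j → j < W → h j ℤ.- h (suc j) ℤ.≤ 1ℤ)
           (shape : Shape n δ (Near n ε) h W) where

    open Shape shape

    private
      winD′ : ∀ {j k} → j ≤ k → k ≤ W → k ≤ suc j → h j ℤ.- h k ℤ.≤ 1ℤ
      winD′ {j} {k} j≤k k≤W k≤1+j with m≤n⇒m<n∨m≡n j≤k
      ... | inj₂ refl = subst (ℤ._≤ 1ℤ) (sym (ℤₚ.+-inverseʳ (h j))) (ℤ.+≤+ z≤n)
      ... | inj₁ j<k  = subst (λ k → h j ℤ.- h k ℤ.≤ 1ℤ) (≤-antisym j<k k≤1+j) (stepD j (≤-trans j<k k≤W))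

      win′ : ∀ {j k} → j ≤ k → k ≤ W → k ≤ j + n → h k ℤ.- h j ℤ.≤ 1ℤ
      win′ {j} {k} j≤k k≤W k≤j+n = subst (λ k → h k ℤ.- h j ℤ.≤ 1ℤ) (m+[n∸m]≡n j≤k)
        (win j (k ∸ j) (≤-trans (≤-reflexive (m+[n∸m]≡n j≤k)) k≤W) (m≤n+o⇒m∸n≤o k j k≤j+n))

      -- Write h j + h k = (h k - h j) + 2 h j. A window bounds the difference, and the smaller
      -- column is within half a window of the centre, where h j ≤ 0.
      start′ : ∀ {j k} → j ≤ k → k ≤ K → j + k + δ ≤ n → h j ℤ.+ h k ℤ.≤ 1ℤ
      start′ {j} {k} j≤k k≤K near = sum≤1 (h j) (h k)
        (win′ j≤k (≤-trans k≤K K≤W) (≤-trans (≤-trans (≤-trans (m≤n+m k j) (m≤m+n (j + k) δ)) near) (m≤n+m n j)))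
        (start j (≤-trans j≤k (≤-trans k≤K K≤W)) (≤-trans (+-monoˡ-≤ δ (+-monoʳ-≤ j j≤k)) near))

      startD′ : ∀ {j k} → j ≤ k → k ≤ K → j + k + δ ≤ 1 → -1ℤ ℤ.≤ h j ℤ.+ h k
      startD′ {zero} {k} j≤k k≤K near = sum≥-1 (h 0) (h k) (ℤₚ.≤-reflexive (sym h0))
          (winD′ {0} j≤k (≤-trans k≤K K≤W) (≤-trans (m≤m+n k δ) near))
      startD′ {suc j} {zero}  ()
      startD′ {suc j} {suc k} _ _ (s≤s near) =
        contradiction (n≤0⇒n≡0 (≤-trans (m≤m+n (j + suc k) δ) near)) (m+1+n≢0 j)

      bottom : ∀ j l → j + l ≡ W → Near n ε l → ℤ.- + Δ ℤ.≤ h j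
      bottom j l e near = subst (ℤ._≤ h j) hW (end j l e near)

    private
      -- As at the start, but now the larger column is the one within half a window of the centre K,
      -- so that h k ≥ - Δ.
      end-even : ε ≡ 0 → + d ≡ + Δ ℤ.+ + Δ → ∀ {j k} → j ≤ k → k ≤ K → K + K ≤ j + k + n →
             -1ℤ ℤ.≤ h j ℤ.+ h k ℤ.+ + d
      end-even refl d≡ {j} {k} j≤k k≤K near = EvenCentre.mirrored≥ (+ d) (+ Δ) d≡ (h j) (h k)
          (win′ j≤k (≤-trans k≤K K≤W) (+-cancelˡ-≤ k k (j + n) (≤-trans (+-mono-≤ k≤K k≤K)
            (≤-trans near (≤-reflexive (swap j k n))))))
          (bottom k (K ∸ k) (trans (m+[n∸m]≡n k≤K) (sym (+-identityʳ K))) (+-cancelˡ-≤ (k + k) _ n (≤-trans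
            (≤-reflexive (trans (interchange k (K ∸ k)) (cong₂ _+_ (m+[n∸m]≡n k≤K) (m+[n∸m]≡n k≤K))))
            (≤-trans near (+-monoˡ-≤ n (+-monoˡ-≤ k j≤k))))))
        where
        swap : ∀ j k n → j + k + n ≡ k + (j + n)
        swap j k n = trans (cong (_+ n) (+-comm j k)) (+-assoc k j n)
        interchange : ∀ k l → k + k + (l + l) ≡ (k + l) + (k + l)
        interchange k l = trans (+-assoc k k (l + l))
          (trans (cong (λ z → k + z) (trans (sym (+-assoc k l l)) (+-comm (k + l) l)))
          (trans (sym (+-assoc k l (k + l))) refl))

      -- Since either column is at most K, the other is within a full window of the end K + 1. Both
      -- heights are therefore at least - Δ, and d = 2 Δ - 1.
      end-odd : ε ≡ 1 → + d ℤ.+ 1ℤ ≡ + Δ ℤ.+ + Δ → ∀ {j k} → j ≤ K → k ≤ K → K + K + 1 ≤ j + k + n →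
                -1ℤ ℤ.≤ h j ℤ.+ h k ℤ.+ + d
      end-odd refl d≡ {j} {k} j≤K k≤K near = OddCentre.mirrored≥ (+ d) (+ Δ) d≡ (h j) (h k)
          (side j≤K k≤K near) (side k≤K j≤K (≤-trans near (≤-reflexive (cong (_+ n) (+-comm j k)))))
        where
        side : ∀ {j k} → j ≤ K → k ≤ K → K + K + 1 ≤ j + k + n → ℤ.- + Δ ℤ.≤ h j
        side {j} {k} j≤K k≤K near = bottom j (K + 1 ∸ j) (m+[n∸m]≡n (≤-trans j≤K K≤W))
          (m≤n+o⇒m∸n≤o (K + 1) j (+-cancelˡ-≤ K _ _ (≤-trans (≤-reflexive (sym (+-assoc K K 1)))
            (≤-trans near (≤-trans (≤-reflexive (trans (cong (_+ n) (+-comm j k)) (+-assoc k j n)))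
              (+-monoˡ-≤ (j + n) k≤K))))))

      endD-even : ε ≡ 0 → + d ≡ + Δ ℤ.+ + Δ → ∀ {j k} → j ≤ k → k ≤ K → K + K ≤ j + k + 1 →
                  h j ℤ.+ h k ℤ.+ + d ℤ.≤ 1ℤ
      endD-even refl d≡ {j} {k} j≤k k≤K near = EvenCentre.mirrored≤ (+ d) (+ Δ) d≡ (h j) (h k)
          (winD′ j≤k (≤-trans k≤K K≤W) (+-cancelˡ-≤ k k (suc j) (≤-trans (+-mono-≤ k≤K k≤K)
            (≤-trans near (≤-reflexive (swap j k))))))
          (trans (cong h k≡W) hW)
        where
        swap : ∀ j k → j + k + 1 ≡ k + suc j
        swap j k = trans (+-comm (j + k) 1) (trans (cong suc (+-comm j k)) (sym (+-suc k j)))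
        k≡W : k ≡ K + 0
        k≡W = trans (≤-antisym k≤K (≮⇒≥ λ k<K → <⇒≱ (n<1+n (k + suc k)) (≤-trans (+-mono-≤ k<K k<K)
          (≤-trans near (≤-trans (≤-reflexive (swap j k)) (+-monoʳ-≤ k (s≤s j≤k))))))) (sym (+-identityʳ K))

      endD-odd : ε ≡ 1 → + d ℤ.+ 1ℤ ≡ + Δ ℤ.+ + Δ → ∀ {j k} → j ≤ K → k ≤ K → K + K + 1 ≤ j + k + 1 →
                 h j ℤ.+ h k ℤ.+ + d ℤ.≤ 1ℤ
      endD-odd refl d≡ {j} {k} j≤K k≤K near = OddCentre.mirrored≤ (+ d) (+ Δ) d≡ (h j) (h k)
          (top (≤-antisym j≤K (+-cancelʳ-≤ K K j (≤-trans near′ (+-monoʳ-≤ j k≤K)))))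
          (top (≤-antisym k≤K (+-cancelˡ-≤ K K k (≤-trans near′ (+-monoˡ-≤ k j≤K)))))
        where
        near′ : K + K ≤ j + k
        near′ = +-cancelʳ-≤ 1 (K + K) (j + k) near
        top : ∀ {k} → k ≡ K → h k ℤ.- (ℤ.- + Δ) ℤ.≤ 1ℤ
        top refl = subst (λ z → h K ℤ.- z ℤ.≤ 1ℤ) hW
          (winD′ {K} K≤W ≤-refl (≤-reflexive (+-comm K 1)))

    shape⇒good : Good
    shape⇒good = record
      { win    = λ { (j , _ , refl , refl) (k , k≤K , refl , refl) (ℤ.+≤+ j≤k) (ℤ.+≤+ near) →
          win′ j≤k (≤-trans k≤K K≤W) near }
      ; winD   = λ { (j , _ , refl , refl) (k , k≤K , refl , refl) (ℤ.+≤+ j≤k) (ℤ.+≤+ near) →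
          winD′ j≤k (≤-trans k≤K K≤W) (≤-trans near (≤-reflexive (+-comm j 1))) }
      ; start  = λ { (j , j≤K , refl , refl) (k , k≤K , refl , refl) (ℤ.+≤+ near) →
          wlog (λ j k → j + k + δ ≤ n → h j ℤ.+ h k ℤ.≤ 1ℤ)
            (λ {j} {k} r near → subst (ℤ._≤ 1ℤ) (ℤₚ.+-comm (h j) (h k)) (r (subst (λ z → z + δ ≤ n) (+-comm k j) near)))
            start′ j≤K k≤K near }
      ; startD = λ { (j , j≤K , refl , refl) (k , k≤K , refl , refl) (ℤ.+≤+ near) →
          wlog (λ j k → j + k + δ ≤ 1 → -1ℤ ℤ.≤ h j ℤ.+ h k)
            (λ {j} {k} r near → subst (-1ℤ ℤ.≤_) (ℤₚ.+-comm (h j) (h k)) (r (subst (λ z → z + δ ≤ 1) (+-comm k j) near)))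
            startD′ j≤K k≤K near }
      ; end    = λ { (j , j≤K , refl , refl) (k , k≤K , refl , refl) (ℤ.+≤+ near) → end-case halfRound j≤K k≤K near }
      ; endD   = λ { (j , j≤K , refl , refl) (k , k≤K , refl , refl) (ℤ.+≤+ near) → endD-case halfRound j≤K k≤K near }
      }
      where
      drop0 : ∀ {m} → ε ≡ 0 → K + K + ε ≤ m → K + K ≤ m
      drop0 e = ≤-trans (≤-trans (≤-reflexive (sym (+-identityʳ (K + K)))) (≤-reflexive (cong (λ z → K + K + z) (sym e))))
      drop1 : ∀ {m} → ε ≡ 1 → K + K + ε ≤ m → K + K + 1 ≤ m
      drop1 e = ≤-trans (≤-reflexive (cong (λ z → K + K + z) (sym e)))
      end-case : HalfRound →
                 ∀ {j k} → j ≤ K → k ≤ K → K + K + ε ≤ j + k + n → -1ℤ ℤ.≤ h j ℤ.+ h k ℤ.+ + d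
      end-case (inj₁ (ε≡0 , d≡)) j≤K k≤K near =
        wlog (λ j k → K + K ≤ j + k + n → -1ℤ ℤ.≤ h j ℤ.+ h k ℤ.+ + d)
          (λ {j} {k} r near → subst (λ z → -1ℤ ℤ.≤ z ℤ.+ + d) (ℤₚ.+-comm (h j) (h k))
            (r (subst (λ z → K + K ≤ z + n) (+-comm k j) near)))
          (end-even ε≡0 d≡) j≤K k≤K (drop0 ε≡0 near)
      end-case (inj₂ (ε≡1 , d≡)) j≤K k≤K near = end-odd ε≡1 d≡ j≤K k≤K (drop1 ε≡1 near)
      endD-case : HalfRound →
                  ∀ {j k} → j ≤ K → k ≤ K → K + K + ε ≤ j + k + 1 → h j ℤ.+ h k ℤ.+ + d ℤ.≤ 1ℤ
      endD-case (inj₁ (ε≡0 , d≡)) j≤K k≤K near =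
        wlog (λ j k → K + K ≤ j + k + 1 → h j ℤ.+ h k ℤ.+ + d ℤ.≤ 1ℤ)
          (λ {j} {k} r near → subst (λ z → z ℤ.+ + d ℤ.≤ 1ℤ) (ℤₚ.+-comm (h j) (h k))
            (r (subst (λ z → K + K ≤ z + 1) (+-comm k j) near)))
          (endD-even ε≡0 d≡) j≤K k≤K (drop0 ε≡0 near)
      endD-case (inj₂ (ε≡1 , d≡)) j≤K k≤K near = endD-odd ε≡1 d≡ j≤K k≤K (drop1 ε≡1 near)

  module _ (good : Good) (last : ε ≡ 1 → h W ≡ ℤ.- + Δ) where

    open Good good

    private
      column-0 : Column 0ℤ (h 0)
      column-0 = column z≤n

      column-K : Column (+ K) (h K)
      column-K = column ≤-refl

    good⇒h0 : h 0 ≡ 0ℤ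
    good⇒h0 = double-zero (h 0) (startD column-0 column-0 (ℤ.+≤+ δ≤1)) (start column-0 column-0 (ℤ.+≤+ (≤-trans δ≤1 1≤n)))

    private
      last-even : ε ≡ 0 → + d ≡ + Δ ℤ.+ + Δ → h K ≡ ℤ.- + Δ
      last-even refl d≡ = ℤₚ.≤-antisym
          (below-centre (h K) (endD column-K column-K (ℤ.+≤+ (+-monoʳ-≤ (K + K) z≤n))))
          (above-centre (h K) (end column-K column-K (ℤ.+≤+ (+-monoʳ-≤ (K + K) z≤n))))
        where open EvenCentre (+ d) (+ Δ) d≡

      -- `Good` does not speak of the end of the path, which is no abacus column here. Its
      -- inequalities come from pairing a column with K, because the mirror image of K is K + 1,
      -- where the path takes the value - Δ.
      module OddLast (ε≡1 : ε ≡ 1) (d≡ : + d ℤ.+ 1ℤ ≡ + Δ ℤ.+ + Δ) where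
        w = h K ℤ.+ + Δ

        W≡1+K : W ≡ suc K
        W≡1+K = trans (cong (λ z → K + z) ε≡1) (+-comm K 1)

        near : ∀ {m} → K + K + 1 ≤ m → + K ℤ.+ + K ℤ.+ + ε ℤ.≤ + m
        near {m = m} le = ℤ.+≤+ (subst (λ z → K + K + z ≤ m) (sym ε≡1) le)

        w≤1 : w ℤ.≤ 1ℤ
        w≤1 = OddCentre.last≤ (+ d) (+ Δ) d≡ (h K) (endD column-K column-K (near ≤-refl))

        end-rise : ∀ {j} → j ≤ K → K + 1 ≤ j + n → -1ℤ ℤ.≤ h j ℤ.+ h K ℤ.+ + d
        end-rise {j} j≤K le = end (column j≤K) column-K (near
          (≤-trans (≤-reflexive (+-assoc K K 1)) (≤-trans (+-monoʳ-≤ K le) (≤-reflexive (swap K j n)))))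
          where
          swap : ∀ k j n → k + (j + n) ≡ j + k + n
          swap k j n = trans (sym (+-assoc k j n)) (cong (_+ n) (+-comm k j))

        win-last : ∀ {j} → j ≤ K → K + 1 ≤ j + n → h W ℤ.- h j ℤ.≤ 1ℤ
        win-last {j} j≤K le = subst (λ z → z ℤ.- h j ℤ.≤ 1ℤ) (sym (last ε≡1))
          (OddCentre.rise≤1 (+ d) (+ Δ) d≡ (h j) (h K) w≤1 (end-rise j≤K le))

        end-last : ∀ {j} → j ≤ K → K + 1 ≤ j + n → h W ℤ.≤ h j
        end-last {j} j≤K le = subst (ℤ._≤ h j) (sym (last ε≡1))
          (OddCentre.above-centre (+ d) (+ Δ) d≡ (h j) (h K) (end-rise j≤K le)
            (win (column j≤K) column-K (ℤ.+≤+ j≤K) (ℤ.+≤+ (≤-trans (m≤m+n K 1) le))))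

    good⇒hW : h W ≡ ℤ.- + Δ
    good⇒hW with halfRound
    ... | inj₁ (ε≡0 , d≡) = trans (cong h (trans (cong (λ z → K + z) ε≡0) (+-identityʳ K))) (last-even ε≡0 d≡)
    ... | inj₂ (ε≡1 , _)  = last ε≡1

    private
      below-W : ε ≡ 0 → ∀ {j} → j ≤ W → j ≤ K
      below-W refl j≤W = ≤-trans j≤W (≤-reflexive (+-identityʳ K))

      split : ∀ {j} → j ≤ W → j ≤ K ⊎ (j ≡ W × ε ≡ 1 × + d ℤ.+ 1ℤ ≡ + Δ ℤ.+ + Δ)
      split {j} j≤W with halfRound
      ... | inj₁ (ε≡0 , _) = inj₁ (below-W ε≡0 j≤W)
      ... | inj₂ (ε≡1 , d≡) with j ≤? K
      ...   | yes j≤K = inj₁ j≤K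
      ...   | no j≰K  = inj₂ (≤-antisym j≤W (≤-trans (≤-reflexive (OddLast.W≡1+K ε≡1 d≡)) (≰⇒> j≰K)) , ε≡1 , d≡)

    good⇒steps : ∀ j → j < W → (h (suc j) ℤ.- h j ℤ.≤ 1ℤ) × (h j ℤ.- h (suc j) ℤ.≤ 1ℤ)
    good⇒steps j j<W with split j<W
    ... | inj₁ j<K = win (column (<⇒≤ j<K)) (column j<K) (ℤ.+≤+ (n≤1+n j))
       (ℤ.+≤+ (≤-trans (≤-reflexive (+-comm 1 j)) (+-monoʳ-≤ j 1≤n)))
                   , winD (column (<⇒≤ j<K)) (column j<K) (ℤ.+≤+ (n≤1+n j)) (ℤ.+≤+ (≤-reflexive (+-comm 1 j)))
    ... | inj₂ (1+j≡W , ε≡1 , d≡) = subst₂ (λ i k → (h i ℤ.- h k ℤ.≤ 1ℤ) × (h k ℤ.- h i ℤ.≤ 1ℤ)) (sym 1+j≡W) (sym j≡K)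
        ( win-last ≤-refl (+-monoʳ-≤ K 1≤n)
        , subst (λ z → h K ℤ.- z ℤ.≤ 1ℤ) (sym (last ε≡1))
          (subst (λ z → h K ℤ.+ z ℤ.≤ 1ℤ) (sym (ℤₚ.neg-involutive (+ Δ))) w≤1))
      where
      open OddLast ε≡1 d≡
      j≡K : j ≡ K
      j≡K = suc-injective (trans 1+j≡W W≡1+K)

    good⇒shape : Shape n δ (Near n ε) h W
    good⇒shape = record { win = window ; start = beginning ; end = ending }
      where
      window : ∀ j m → j + m ≤ W → m ≤ n → h (j + m) ℤ.- h j ℤ.≤ 1ℤ
      window j m j+m≤W m≤n with split j+m≤W
      ... | inj₁ j+m≤K = win (column (≤-trans (m≤m+n j m) j+m≤K)) (column j+m≤K)
        (ℤ.+≤+ (m≤m+n j m)) (ℤ.+≤+ (+-monoʳ-≤ j m≤n))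
      window j zero _ _ | inj₂ _ = subst (λ z → h z ℤ.- h j ℤ.≤ 1ℤ) (sym (+-identityʳ j))
        (subst (ℤ._≤ 1ℤ) (sym (ℤₚ.+-inverseʳ (h j))) (ℤ.+≤+ z≤n))
      window j (suc m) j+m≤W m≤n | inj₂ (j+m≡W , ε≡1 , d≡) =
        subst (λ z → h z ℤ.- h j ℤ.≤ 1ℤ) (sym j+m≡W)
          (win-last (s≤s⁻¹ (≤-trans (s≤s (m≤m+n j m)) (≤-reflexive 1+j+m≡1+K)))
          (≤-trans (≤-reflexive (trans (+-comm K 1) (sym 1+j+m≡1+K)))
            (≤-trans (≤-reflexive (sym (+-suc j m))) (+-monoʳ-≤ j m≤n))))
        where
        open OddLast ε≡1 d≡
        1+j+m≡1+K : suc (j + m) ≡ suc K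
        1+j+m≡1+K = trans (sym (+-suc j m)) (trans j+m≡W W≡1+K)

      beginning : ∀ m → m ≤ W → m + m + δ ≤ n → h m ℤ.≤ 0ℤ
      beginning m m≤W le with split m≤W
      ... | inj₁ m≤K = half-nonpositive (h m) (start (column m≤K) (column m≤K) (ℤ.+≤+ le))
      ... | inj₂ (m≡W , ε≡1 , _) = subst (ℤ._≤ 0ℤ) (sym (trans (cong h m≡W) (last ε≡1))) (ℤₚ.neg-≤-pos {Δ} {0})

      ending : ∀ j l → j + l ≡ W → Near n ε l → h W ℤ.≤ h j
      ending j l j+l≡W near-l with halfRound
      ... | inj₁ (ε≡0 , d≡) = subst (ℤ._≤ h j) (sym good⇒hW) (even ε≡0 d≡ near-l)
        where
        even : ε ≡ 0 → + d ≡ + Δ ℤ.+ + Δ → Near n ε l → ℤ.- + Δ ℤ.≤ h j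
        even refl d≡ l+l≤n = EvenCentre.above-centre (+ d) (+ Δ) d≡ (h j) (end (column j≤K) (column j≤K) (ℤ.+≤+
          (≤-trans (≤-reflexive (trans (+-identityʳ (K + K)) (trans (cong₂ _+_ (sym j+l≡K) (sym j+l≡K)) (interchange j l))))
            (+-monoʳ-≤ (j + j) l+l≤n))))
          where
          j+l≡K : j + l ≡ K
          j+l≡K = trans j+l≡W (+-identityʳ K)
          j≤K : j ≤ K
          j≤K = ≤-trans (m≤m+n j l) (≤-reflexive j+l≡K)
          interchange : ∀ k l → (k + l) + (k + l) ≡ k + k + (l + l)
          interchange k l = sym (trans (+-assoc k k (l + l))
            (trans (cong (λ z → k + z) (trans (sym (+-assoc k l l)) (+-comm (k + l) l)))
            (sym (+-assoc k l (k + l)))))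
      ... | inj₂ (ε≡1 , d≡) with split (≤-trans (m≤m+n j l) (≤-reflexive j+l≡W))
      ...   | inj₂ (j≡W , _) = ℤₚ.≤-reflexive (cong h (sym j≡W))
      ...   | inj₁ j≤K = OddLast.end-last ε≡1 d≡ j≤K
        (≤-trans (≤-reflexive (trans (cong (λ z → K + z) (sym ε≡1)) (sym j+l≡W))) (+-monoʳ-≤ j (Near≤ n ε near-l)))

-- Parity cases and index ranges

even-double : ∀ n → Even n → n ≡ ⌊ n /2⌋ + ⌊ n /2⌋
even-double zero          _ = refl
even-double (suc (suc n)) e = cong suc (trans (cong suc (even-double n e)) (sym (+-suc ⌊ n /2⌋ ⌊ n /2⌋)))

odd-double : ∀ n → Odd n → n ≡ suc (⌊ n /2⌋ + ⌊ n /2⌋)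
odd-double (suc zero)    _ = refl
odd-double (suc (suc n)) o = cong suc (trans (cong suc (odd-double n o)) (cong suc (sym (+-suc ⌊ n /2⌋ ⌊ n /2⌋))))

even-⌈/2⌉ : ∀ n → Even n → n + 0 ≡ ⌈ n /2⌉ + ⌈ n /2⌉
even-⌈/2⌉ zero          _ = refl
even-⌈/2⌉ (suc (suc n)) e = cong suc (trans (cong suc (even-⌈/2⌉ n e)) (sym (+-suc ⌈ n /2⌉ ⌈ n /2⌉)))

odd-⌈/2⌉ : ∀ n → Odd n → ⌈ n /2⌉ ≡ suc ⌊ n /2⌋
odd-⌈/2⌉ (suc zero)    _ = refl
odd-⌈/2⌉ (suc (suc n)) o = cong suc (odd-⌈/2⌉ n o)

even-or-odd : ∀ n → Even n ⊎ Odd n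
even-or-odd n with parity n
... | 0ℙ = inj₁ refl
... | 1ℙ = inj₂ refl

even⇒¬odd : ∀ n → Even n → ¬ Odd n
even⇒¬odd n e o with () ← trans (sym e) o

data Parities (s d : ℕ) : (δ ε : ℕ) → Set where
  oddEven : Odd s → Even d → Parities s d 1 0
  oddOdd  : Odd s → Odd d → Parities s d 1 1
  evenOdd : Even s → Odd d → Parities s d 0 1

record Setting (s d : ℕ) : Set where
  field
    params   : Parameters s d
  open Parameters params public
  field
    parities : Parities s d δ ε
    Δ≡       : Δ ≡ ⌈ d /2⌉
    width≡W  : width s d ≡ W
    a≡       : a s d ≡ e ℤ.+ e ℤ.- 1ℤ

a-odd : ∀ s d → Odd s → a s d ≡ ℤ.- + s
a-odd s d o with odd? s
... | yes _ = refl
... | no ¬o = contradiction o ¬o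

a-even : ∀ s d → Even s → a s d ≡ ℤ.- + (s + d)
a-even s d e with odd? s
... | yes o = contradiction o (even⇒¬odd s e)
... | no _  = refl

private
  origin-odd : ∀ {s} σ d → s ≡ suc (σ + σ) → ℤ.- + σ ℤ.+ ℤ.- + σ ℤ.+ + (s + d) ≡ 1ℤ ℤ.+ + d ℤ.* + 1
  origin-odd σ d refl = lemma (+ σ) (+ d)
    where
    lemma : ∀ σ d → ℤ.- σ ℤ.+ ℤ.- σ ℤ.+ (1ℤ ℤ.+ (σ ℤ.+ σ) ℤ.+ d) ≡ 1ℤ ℤ.+ d ℤ.* 1ℤ
    lemma = solve-∀

  a-odd-centre : ∀ s d → Odd s → a s d ≡ ℤ.- + ⌊ s /2⌋ ℤ.+ ℤ.- + ⌊ s /2⌋ ℤ.- 1ℤ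
  a-odd-centre s d o = trans (a-odd s d o)
    (trans (cong (λ n → ℤ.- + n) (odd-double s o)) (lemma (+ ⌊ s /2⌋)))
    where
    lemma : ∀ σ → ℤ.- (1ℤ ℤ.+ (σ ℤ.+ σ)) ≡ ℤ.- σ ℤ.+ ℤ.- σ ℤ.- 1ℤ
    lemma = solve-∀

bézout-ℤ : ∀ s d → Coprime s d → ∃[ u ] ∃[ v ] + (s + d) ℤ.* u ℤ.+ + d ℤ.* v ≡ 1ℤ
bézout-ℤ s d c with coprime-Bézout {s + d} {d} (subst (λ m → Coprime m d) (+-comm d s) (coprime-+ c))
... | Bézout.+- x y e = + x , ℤ.- + y ,
  trans (lemma (+ (s + d)) (+ d) (+ x) (+ y))
    (trans (cong (λ z → z ℤ.- + y ℤ.* + d) (sym e′)) (lemma₂ (+ y) (+ d)))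
  where
  e′ : 1ℤ ℤ.+ + y ℤ.* + d ≡ + x ℤ.* + (s + d)
  e′ = trans (cong (λ z → 1ℤ ℤ.+ z) (sym (ℤₚ.pos-* y d))) (trans (cong +_ e) (ℤₚ.pos-* x (s + d)))
  lemma : ∀ T d x y → T ℤ.* x ℤ.+ d ℤ.* (ℤ.- y) ≡ x ℤ.* T ℤ.- y ℤ.* d
  lemma = solve-∀
  lemma₂ : ∀ y d → 1ℤ ℤ.+ y ℤ.* d ℤ.- y ℤ.* d ≡ 1ℤ
  lemma₂ = solve-∀
... | Bézout.-+ x y e = ℤ.- + x , + y ,
  trans (lemma (+ (s + d)) (+ d) (+ x) (+ y))
    (trans (cong (λ z → z ℤ.- + x ℤ.* + (s + d)) (sym e′)) (lemma₂ (+ x) (+ (s + d))))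
  where
  e′ : 1ℤ ℤ.+ + x ℤ.* + (s + d) ≡ + y ℤ.* + d
  e′ = trans (cong (λ z → 1ℤ ℤ.+ z) (sym (ℤₚ.pos-* x (s + d)))) (trans (cong +_ e) (ℤₚ.pos-* y d))
  lemma : ∀ T d x y → T ℤ.* (ℤ.- x) ℤ.+ d ℤ.* y ≡ y ℤ.* d ℤ.- x ℤ.* T
  lemma = solve-∀
  lemma₂ : ∀ y d → 1ℤ ℤ.+ y ℤ.* d ℤ.- y ℤ.* d ≡ 1ℤ
  lemma₂ = solve-∀

-- Both even contradicts coprimality; the three other cases are those of the theorem. Each time K =
-- ⌊(s + d - 1)/2⌋ and e = (a + 1)/2, which is - ⌊s/2⌋ for odd s and - (⌊s/2⌋ + ⌊d/2⌋) for even s.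
setting : ∀ s d → .{{_ : NonZero s}} → .{{_ : NonZero d}} → Coprime s d → Setting s d
setting s d c with bézout-ℤ s d c | even-or-odd s | even-or-odd d
... | _ | inj₁ s-even | inj₁ d-even = contradiction (c (2∣ s s-even , 2∣ d d-even)) λ ()
  where
  2∣ : ∀ n → Even n → 2 ∣ n
  2∣ n e = divides ⌊ n /2⌋ (trans (even-double n e) (lemma ⌊ n /2⌋))
    where
    lemma : ∀ h → h + h ≡ h * 2
    lemma = ℕSolver.solve-∀
... | u , v , bz | inj₂ s-odd | inj₁ d-even = record
  { params = record
    { K = σ + Δ ; ε = 0 ; δ = 1 ; Δ = Δ ; ε≤1 = z≤n ; δ≤1 = s≤s z≤n ; 1≤ε+δ = s≤s z≤n
    ; size = trans (cong₂ _+_ s≡ d≡) (lemma σ Δ)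
    ; 2≤size = +-mono-≤ (>-nonZero⁻¹ s) (>-nonZero⁻¹ d)
    ; halves = even-⌈/2⌉ d d-even ; e = ℤ.- + σ
    ; origin = origin-odd σ d s≡
    ; u = u ; v = v ; bézout = bz }
  ; parities = oddEven s-odd d-even
  ; Δ≡ = refl
  ; width≡W = sym (+-identityʳ (σ + Δ))
  ; a≡ = a-odd-centre s d s-odd
  }
  where
  σ = ⌊ s /2⌋
  Δ = ⌈ d /2⌉
  s≡ : s ≡ suc (σ + σ)
  s≡ = odd-double s s-odd
  d≡ : d ≡ Δ + Δ
  d≡ = trans (sym (+-identityʳ d)) (even-⌈/2⌉ d d-even)
  lemma : ∀ σ Δ → suc (σ + σ) + (Δ + Δ) ≡ σ + Δ + (σ + Δ) + 0 + 1
  lemma = ℕSolver.solve-∀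
... | u , v , bz | inj₂ s-odd | inj₂ d-odd = record
  { params = record
    { K = σ + τ ; ε = 1 ; δ = 1 ; Δ = suc τ ; ε≤1 = s≤s z≤n ; δ≤1 = s≤s z≤n ; 1≤ε+δ = s≤s z≤n
    ; size = trans (cong₂ _+_ s≡ d≡) (lemma σ τ)
    ; 2≤size = +-mono-≤ (>-nonZero⁻¹ s) (>-nonZero⁻¹ d)
    ; halves = trans (cong (_+ 1) d≡) (lemma₁ τ) ; e = ℤ.- + σ
    ; origin = origin-odd σ d s≡
    ; u = u ; v = v ; bézout = bz }
  ; parities = oddOdd s-odd d-odd
  ; Δ≡ = sym (odd-⌈/2⌉ d d-odd)
  ; width≡W = trans (cong (λ z → σ + z) (trans (odd-⌈/2⌉ d d-odd) (+-comm 1 τ))) (sym (+-assoc σ τ 1))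
  ; a≡ = a-odd-centre s d s-odd
  }
  where
  σ = ⌊ s /2⌋
  τ = ⌊ d /2⌋
  s≡ : s ≡ suc (σ + σ)
  s≡ = odd-double s s-odd
  d≡ : d ≡ suc (τ + τ)
  d≡ = odd-double d d-odd
  lemma : ∀ σ τ → suc (σ + σ) + suc (τ + τ) ≡ σ + τ + (σ + τ) + 1 + 1
  lemma = ℕSolver.solve-∀
  lemma₁ : ∀ τ → suc (τ + τ) + 1 ≡ suc τ + suc τ
  lemma₁ = ℕSolver.solve-∀
... | u , v , bz | inj₁ s-even | inj₂ d-odd = record
  { params = record
    { K = σ + τ ; ε = 1 ; δ = 0 ; Δ = suc τ ; ε≤1 = s≤s z≤n ; δ≤1 = z≤n ; 1≤ε+δ = s≤s z≤n
    ; size = trans (cong₂ _+_ s≡ d≡) (lemma σ τ)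
    ; 2≤size = +-mono-≤ (>-nonZero⁻¹ s) (>-nonZero⁻¹ d)
    ; halves = trans (cong (_+ 1) d≡) (lemma₁ τ) ; e = ℤ.- + (σ + τ)
    ; origin = trans (cong₂ (λ x y → ℤ.- + (σ + τ) ℤ.+ ℤ.- + (σ + τ) ℤ.+ (+ x ℤ.+ + y)) s≡ d≡)
        (trans (lemma₂ (+ σ) (+ τ)) (cong (λ z → 1ℤ ℤ.+ z) (sym (ℤₚ.*-zeroʳ (+ d)))))
    ; u = u ; v = v ; bézout = bz }
  ; parities = evenOdd s-even d-odd
  ; Δ≡ = sym (odd-⌈/2⌉ d d-odd)
  ; width≡W = trans (cong (λ z → σ + z) (trans (odd-⌈/2⌉ d d-odd) (+-comm 1 τ))) (sym (+-assoc σ τ 1))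
  ; a≡ = trans (a-even s d s-even) (trans (cong₂ (λ x y → ℤ.- + (x + y)) s≡ d≡) (lemma₃ (+ σ) (+ τ)))
  }
  where
  σ = ⌊ s /2⌋
  τ = ⌊ d /2⌋
  s≡ : s ≡ σ + σ
  s≡ = even-double s s-even
  d≡ : d ≡ suc (τ + τ)
  d≡ = odd-double d d-odd
  lemma : ∀ σ τ → σ + σ + suc (τ + τ) ≡ σ + τ + (σ + τ) + 1 + 0
  lemma = ℕSolver.solve-∀
  lemma₁ : ∀ τ → suc (τ + τ) + 1 ≡ suc τ + suc τ
  lemma₁ = ℕSolver.solve-∀
  lemma₂ : ∀ σ τ → ℤ.- (σ ℤ.+ τ) ℤ.+ ℤ.- (σ ℤ.+ τ) ℤ.+ (σ ℤ.+ σ ℤ.+ (1ℤ ℤ.+ (τ ℤ.+ τ))) ≡ 1ℤ ℤ.+ 0ℤ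
  lemma₂ = solve-∀
  lemma₃ : ∀ σ τ → ℤ.- (σ ℤ.+ σ ℤ.+ (1ℤ ℤ.+ (τ ℤ.+ τ))) ≡ ℤ.- (σ ℤ.+ τ) ℤ.+ ℤ.- (σ ℤ.+ τ) ℤ.- 1ℤ
  lemma₃ = solve-∀

2*⌊n/2⌋≤n : ∀ n → ⌊ n /2⌋ + ⌊ n /2⌋ ≤ n
2*⌊n/2⌋≤n n = ≤-trans (+-monoʳ-≤ ⌊ n /2⌋ (⌊n/2⌋≤⌈n/2⌉ n)) (≤-reflexive (⌊n/2⌋+⌈n/2⌉≡n n))

double≤⇒≤half : ∀ {k m} → k + k ≤ m → k ≤ ⌊ m /2⌋
double≤⇒≤half {k} {m} h = subst (_≤ ⌊ m /2⌋) (sym (n≡⌊n+n/2⌋ k)) (⌊n/2⌋-mono h)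

-- The bounds of (i)–(iii), stated with n = p - 1.
module Ranges {n : ℕ} where

  gap⁺ : ∀ {i} → 2 + i ≤ n → 3 ≤ suc n × i ≤ suc n ∸ 3
  gap⁺ {i} h = s≤s (≤-trans (m≤m+n 2 i) h) , m+n≤o⇒m≤o∸n i (subst (_≤ n) (+-comm 2 i) h)

  gap⁻ : ∀ {i} → 3 ≤ suc n → i ≤ suc n ∸ 3 → 2 + i ≤ n
  gap⁻ {i} (s≤s 2≤n) h = ≤-trans (+-monoʳ-≤ 2 h) (≤-reflexive (m+[n∸m]≡n 2≤n))

  half⁺ : ∀ c {j} → c + (j + j) ≤ n → c ≤ n × j ≤ ⌊ n ∸ c /2⌋
  half⁺ c {j} h = ≤-trans (m≤m+n c (j + j)) h ,
    double≤⇒≤half (m+n≤o⇒m≤o∸n (j + j) (subst (_≤ n) (+-comm c (j + j)) h))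

  half⁻ : ∀ c {j} → c ≤ n → j ≤ ⌊ n ∸ c /2⌋ → c + (j + j) ≤ n
  half⁻ c {j} c≤n h = ≤-trans (+-monoʳ-≤ c (≤-trans (+-mono-≤ h h) (2*⌊n/2⌋≤n (n ∸ c)))) (≤-reflexive (m+[n∸m]≡n c≤n))

  pair-even : ∀ j → suc j + suc j ≡ 2 + (j + j)
  pair-even j = cong suc (+-suc j j)

  pair-0 : ∀ j → suc j + suc j + 0 ≡ 2 + (j + j)
  pair-0 j = trans (+-identityʳ _) (pair-even j)

  pair-1 : ∀ j → suc j + suc j + 1 ≡ 3 + (j + j)
  pair-1 j = trans (+-comm (suc j + suc j) 1) (cong suc (pair-even j))

module _ {s d n : ℕ} {P : Path} where
  open Ranges {n}

  private
    start-0⁺ : (3 ≤ suc n → NoStart ⌊ suc n ∸ 3 /2⌋ P) → ∀ j → suc j + suc j + 0 ≤ n → ¬ StartsWith P (F^ j ++ U ∷ [])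
    start-0⁺ avoids j h = let c≤n , j≤ = half⁺ 2 (subst (_≤ n) (pair-0 j) h) in avoids (s≤s c≤n) j j≤

    start-1⁺ : (4 ≤ suc n → NoStart ⌊ suc n ∸ 4 /2⌋ P) → ∀ j → suc j + suc j + 1 ≤ n → ¬ StartsWith P (F^ j ++ U ∷ [])
    start-1⁺ avoids j h = let c≤n , j≤ = half⁺ 3 (subst (_≤ n) (pair-1 j) h) in avoids (s≤s c≤n) j j≤

    end-0⁺ : (3 ≤ suc n → NoEnd ⌊ suc n ∸ 3 /2⌋ P) → ∀ k → suc k + suc k ≤ n → ¬ EndsWith P (U ∷ F^ k)
    end-0⁺ avoids k h = let c≤n , k≤ = half⁺ 2 (subst (_≤ n) (pair-even k) h) in avoids (s≤s c≤n) k k≤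

    end-1⁺ : NoEnd (suc n ∸ 2) P → ∀ k → suc k ≤ n → ¬ EndsWith P (U ∷ F^ k)
    end-1⁺ avoids k h = avoids k (m+n≤o⇒m≤o∸n k (subst (_≤ n) (+-comm 1 k) h))

    start-0⁻ : (∀ j → suc j + suc j + 0 ≤ n → ¬ StartsWith P (F^ j ++ U ∷ [])) → 3 ≤ suc n → NoStart ⌊ suc n ∸ 3 /2⌋ P
    start-0⁻ avoids (s≤s c≤n) j j≤ = avoids j (subst (_≤ n) (sym (pair-0 j)) (half⁻ 2 c≤n j≤))

    start-1⁻ : (∀ j → suc j + suc j + 1 ≤ n → ¬ StartsWith P (F^ j ++ U ∷ [])) → 4 ≤ suc n → NoStart ⌊ suc n ∸ 4 /2⌋ P
    start-1⁻ avoids (s≤s c≤n) j j≤ = avoids j (subst (_≤ n) (sym (pair-1 j)) (half⁻ 3 c≤n j≤))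

    end-0⁻ : (∀ k → suc k + suc k ≤ n → ¬ EndsWith P (U ∷ F^ k)) → 3 ≤ suc n → NoEnd ⌊ suc n ∸ 3 /2⌋ P
    end-0⁻ avoids (s≤s c≤n) k k≤ = avoids k (subst (_≤ n) (sym (pair-even k)) (half⁻ 2 c≤n k≤))

    end-1⁻ : 1 ≤ n → (∀ k → suc k ≤ n → ¬ EndsWith P (U ∷ F^ k)) → NoEnd (suc n ∸ 2) P
    end-1⁻ 1≤n avoids k k≤ = avoids k (≤-trans (s≤s k≤) (≤-reflexive (m+[n∸m]≡n 1≤n)))

  admissible⇒patterns : ∀ {δ ε} → Parities s d δ ε → Admissible s d (suc n) P → Patterns n δ (Near n ε) P
  admissible⇒patterns parities adm = record
    { noUFU   = λ i h → let 3≤p , i≤ = gap⁺ h in Admissible.noUFU adm 3≤p i i≤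
    ; noStart = starts parities
    ; noEnd   = ends parities
    }
    where
    starts : ∀ {δ ε} → Parities s d δ ε → ∀ j → suc j + suc j + δ ≤ n → ¬ StartsWith P (F^ j ++ U ∷ [])
    starts (oddEven s-odd d-even) = start-1⁺ (proj₁ (Admissible.oddEven adm s-odd d-even))
    starts (oddOdd s-odd d-odd)  = start-1⁺ (proj₁ (Admissible.oddOdd adm s-odd d-odd))
    starts (evenOdd s-even d-odd) = start-0⁺ (proj₁ (Admissible.evenOdd adm s-even d-odd))
    ends : ∀ {δ ε} → Parities s d δ ε → ∀ k → Near n ε (suc k) → ¬ EndsWith P (U ∷ F^ k)
    ends (oddEven s-odd d-even) = end-0⁺ (proj₂ (Admissible.oddEven adm s-odd d-even))
    ends (oddOdd s-odd d-odd)  = end-1⁺ (proj₂ (Admissible.oddOdd adm s-odd d-odd))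
    ends (evenOdd s-even d-odd) = end-1⁺ (proj₂ (Admissible.evenOdd adm s-even d-odd))

  patterns⇒admissible : ∀ {δ ε} → Parities s d δ ε → 1 ≤ n → Patterns n δ (Near n ε) P → Admissible s d (suc n) P
  patterns⇒admissible parities 1≤n patterns = record
    { noUFU   = λ 3≤p i i≤ → noUFU i (gap⁻ 3≤p i≤)
    ; oddEven = λ s-odd d-even → case-oddEven parities s-odd d-even noStart noEnd
    ; oddOdd  = λ s-odd d-odd → case-oddOdd parities s-odd d-odd noStart noEnd
    ; evenOdd = λ s-even d-odd → case-evenOdd parities s-even d-odd noStart noEnd
    }
    where
    open Patterns patterns
    Starts : ℕ → Set
    Starts δ = ∀ j → suc j + suc j + δ ≤ n → ¬ StartsWith P (F^ j ++ U ∷ [])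
    Ends : ℕ → Set
    Ends ε = ∀ k → Near n ε (suc k) → ¬ EndsWith P (U ∷ F^ k)
    case-oddEven : ∀ {δ ε} → Parities s d δ ε → Odd s → Even d → Starts δ → Ends ε →
      (4 ≤ suc n → NoStart ⌊ suc n ∸ 4 /2⌋ P) × (3 ≤ suc n → NoEnd ⌊ suc n ∸ 3 /2⌋ P)
    case-oddEven (oddEven _ _)  s-odd d-even starts ends = start-1⁻ starts , end-0⁻ ends
    case-oddEven (oddOdd _ d-odd)  s-odd d-even _ _ = contradiction d-odd (even⇒¬odd d d-even)
    case-oddEven (evenOdd s-even _) s-odd d-even _ _ = contradiction s-odd (even⇒¬odd s s-even)
    case-oddOdd : ∀ {δ ε} → Parities s d δ ε → Odd s → Odd d → Starts δ → Ends ε →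
      (4 ≤ suc n → NoStart ⌊ suc n ∸ 4 /2⌋ P) × NoEnd (suc n ∸ 2) P
    case-oddOdd (oddEven _ d-even) s-odd d-odd _ _ = contradiction d-odd (even⇒¬odd d d-even)
    case-oddOdd (oddOdd _ _)   s-odd d-odd starts ends = start-1⁻ starts , end-1⁻ 1≤n ends
    case-oddOdd (evenOdd s-even _) s-odd d-odd _ _ = contradiction s-odd (even⇒¬odd s s-even)
    case-evenOdd : ∀ {δ ε} → Parities s d δ ε → Even s → Odd d → Starts δ → Ends ε →
      (3 ≤ suc n → NoStart ⌊ suc n ∸ 3 /2⌋ P) × NoEnd (suc n ∸ 2) P
    case-evenOdd (oddEven s-odd _) s-even d-odd _ _ = contradiction s-odd (even⇒¬odd s s-even)
    case-evenOdd (oddOdd s-odd _)  s-even d-odd _ _ = contradiction s-odd (even⇒¬odd s s-even)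
    case-evenOdd (evenOdd _ _)  s-even d-odd starts ends = start-0⁻ starts , end-1⁻ 1≤n ends

-- The abacus read through the boundary set

module _ (μ : Partition) (sc : SelfConjugate μ) where

  private
    M : ℤ → Set
    M = Maya (rows μ)

    abs-positive : ∀ u → ∣ + suc u ℤ.+ + suc u ℤ.- 1ℤ ∣ ≡ suc (u + u)
    abs-positive u = +-suc u u

    abs-negative : ∀ u → ∣ (1ℤ ℤ.- + suc u) ℤ.+ (1ℤ ℤ.- + suc u) ℤ.- 1ℤ ∣ ≡ suc (u + u)
    abs-negative u = trans (cong ∣_∣ (lemma (+ u))) (ℤₚ.∣-i∣≡∣i∣ (+ suc (u + u)))
      where
      lemma : ∀ u → (1ℤ ℤ.- (1ℤ ℤ.+ u)) ℤ.+ (1ℤ ℤ.- (1ℤ ℤ.+ u)) ℤ.- 1ℤ ≡ ℤ.- (1ℤ ℤ.+ (u ℤ.+ u))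
      lemma = solve-∀

    -- Both cases are indexed so that the label 2 x - 1 has absolute value 2 u + 1, the diagonal
    -- hook length that decides membership of x.
    data Sign : ℤ → Set where
      above-zero : ∀ u → Sign (+ suc u)
      below-zero : ∀ u → Sign (1ℤ ℤ.- + suc u)

    sign : ∀ x → Sign x
    sign (+ suc u) = above-zero u
    sign (+ zero)  = below-zero 0
    sign -[1+ u ]  = below-zero (suc u)

    label⁺ : ∀ u → 0ℤ ℤ.< + suc u ℤ.+ + suc u ℤ.- 1ℤ
    label⁺ u = subst (0ℤ ℤ.<_) (cong +_ (sym (+-suc u u))) (ℤ.+<+ z<s)

    label⁻ : ∀ u → (1ℤ ℤ.- + suc u) ℤ.+ (1ℤ ℤ.- + suc u) ℤ.- 1ℤ ℤ.< 0ℤ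
    label⁻ u = subst (ℤ._< 0ℤ) (lemma (+ u)) (ℤ.-<+ {u + u} {0})
      where
      lemma : ∀ u → ℤ.- (1ℤ ℤ.+ (u ℤ.+ u)) ≡ (1ℤ ℤ.- (1ℤ ℤ.+ u)) ℤ.+ (1ℤ ℤ.- (1ℤ ℤ.+ u)) ℤ.- 1ℤ
      lemma = solve-∀

  positive-bead⇒maya : ∀ x → MD μ ∣ x ℤ.+ x ℤ.- 1ℤ ∣ → 0ℤ ℤ.< x ℤ.+ x ℤ.- 1ℤ → M x
  positive-bead⇒maya x md pos with sign x
  ... | above-zero u = MD⇒maya μ sc u (subst (MD μ) (abs-positive u) md)
  ... | below-zero u = ⊥-elim (ℤₚ.<-asym pos (label⁻ u))

  -- The labels of x and 1 - x are opposite, so a spacer means that 1 - x is missing from the set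
  -- and x is present.
  negative-spacer⇒maya : ∀ x → ¬ MD μ ∣ x ℤ.+ x ℤ.- 1ℤ ∣ → x ℤ.+ x ℤ.- 1ℤ ℤ.< 0ℤ → M x
  negative-spacer⇒maya x ¬md neg with sign x
  ... | above-zero u = ⊥-elim (ℤₚ.<-asym neg (label⁺ u))
  ... | below-zero u with maya-total sc (+ suc u)
  ...   | inj₁ m = contradiction (subst (MD μ) (sym (abs-negative u)) (maya⇒MD μ sc u m)) ¬md
  ...   | inj₂ m = m

  maya⇒bead-or-spacer : ∀ x → M x → (MD μ ∣ x ℤ.+ x ℤ.- 1ℤ ∣ × 0ℤ ℤ.< x ℤ.+ x ℤ.- 1ℤ)
                                  ⊎ (¬ MD μ ∣ x ℤ.+ x ℤ.- 1ℤ ∣ × x ℤ.+ x ℤ.- 1ℤ ℤ.< 0ℤ)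
  maya⇒bead-or-spacer x m with sign x
  ... | above-zero u = inj₁ (subst (MD μ) (sym (abs-positive u)) (maya⇒MD μ sc u m) , label⁺ u)
  ... | below-zero u = inj₂ ((λ md → maya-exclusive sc (+ suc u)
      (MD⇒maya μ sc u (subst (MD μ) (abs-negative u) md)) m) , label⁻ u)

Largest-unique : ∀ {P : ℤ → Set} {i j} → Largest P i → Largest P j → i ≡ j
Largest-unique (pi , ub-i) (pj , ub-j) = ℤₚ.≤-antisym (ub-j _ pi) (ub-i _ pj)

module _ {s d : ℕ} .{{_ : NonZero s}} (set : Setting s d) where
  open Setting set

  place : ℤ → ℕ → ℤ
  place i j = e ℤ.+ + (s + d) ℤ.* i ℤ.+ + d ℤ.* + j

  label≡ : ∀ i j → label s d i j ≡ place i j ℤ.+ place i j ℤ.- 1ℤ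
  label≡ i j = trans
    (cong₂ ℤ._+_ (cong₂ (λ x y → x ℤ.+ y ℤ.* i) a≡ (ℤₚ.pos-* 2 (s + d)))
                 (trans (ℤₚ.pos-* (2 * d) j) (cong (ℤ._* + j) (ℤₚ.pos-* 2 d))))
    (lemma e (+ (s + d)) (+ d) i (+ j))
    where
    lemma : ∀ e T d i j → e ℤ.+ e ℤ.- 1ℤ ℤ.+ + 2 ℤ.* T ℤ.* i ℤ.+ + 2 ℤ.* d ℤ.* j ≡
            (e ℤ.+ T ℤ.* i ℤ.+ d ℤ.* j) ℤ.+ (e ℤ.+ T ℤ.* i ℤ.+ d ℤ.* j) ℤ.- 1ℤ
    lemma = solve-∀

  label-mono : ∀ {i i′} j → i ℤ.≤ i′ → label s d i j ℤ.≤ label s d i′ j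
  label-mono j i≤i′ = ℤₚ.+-monoˡ-≤ (+ (2 * d * j)) (ℤₚ.+-monoʳ-≤ (a s d) (ℤₚ.*-monoˡ-≤-nonNeg (+ (2 * (s + d))) i≤i′))

  module _ (μ : Partition) (sc : SelfConjugate μ) where

    private
      M : ℤ → Set
      M = Maya (rows μ)

      positive⇒maya : ∀ i j → Bead s d μ j i → 0ℤ ℤ.< label s d i j → M (place i j)
      positive⇒maya i j = subst (λ z → MD μ ∣ z ∣ → 0ℤ ℤ.< z → M (place i j)) (sym (label≡ i j))
        (positive-bead⇒maya μ sc (place i j))

      negative⇒maya : ∀ i j → Spacer s d μ j i → label s d i j ℤ.< 0ℤ → M (place i j)
      negative⇒maya i j = subst (λ z → ¬ MD μ ∣ z ∣ → z ℤ.< 0ℤ → M (place i j)) (sym (label≡ i j))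
        (negative-spacer⇒maya μ sc (place i j))

      maya⇒ : ∀ i j → M (place i j) → PositiveBead s d μ j i ⊎ NegativeSpacer s d μ j i
      maya⇒ i j m = subst (λ z → (MD μ ∣ z ∣ × 0ℤ ℤ.< z) ⊎ (¬ MD μ ∣ z ∣ × z ℤ.< 0ℤ)) (sym (label≡ i j))
        (maya⇒bead-or-spacer μ sc (place i j) m)

    -- The members of a column are its positive beads and negative spacers, and labels increase with
    -- the row. If there is a positive bead, then the largest bead is positive and lies above all
    -- negative spacers; otherwise only negative spacers are members. So both branches of the
    -- definition give the top of the column.
    abacusValue⇒largest : ∀ {i} j → IsAbacusValue s d μ j i → Largest (λ k → M (place k j)) i
    abacusValue⇒largest {i} j (inj₁ ((i₀ , bead₀ , pos₀) , bead , max)) = positive⇒maya i j bead pos , bound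
      where
      pos : 0ℤ ℤ.< label s d i j
      pos = ℤₚ.<-≤-trans pos₀ (label-mono j (max i₀ bead₀))
      bound : ∀ k → M (place k j) → k ℤ.≤ i
      bound k m with maya⇒ k j m
      ... | inj₁ (bead′ , _) = max k bead′
      ... | inj₂ (_ , neg) with ℤₚ.≤-total k i
      ...   | inj₁ k≤i = k≤i
      ...   | inj₂ i≤k = ⊥-elim (ℤₚ.<-asym neg (ℤₚ.<-≤-trans pos (label-mono j i≤k)))
    abacusValue⇒largest {i} j (inj₂ (none , (spacer , neg) , max)) = negative⇒maya i j spacer neg , bound
      where
      bound : ∀ k → M (place k j) → k ℤ.≤ i
      bound k m with maya⇒ k j m
      ... | inj₁ bead = contradiction (k , bead) none
      ... | inj₂ spacer′ = max k spacer′

    module _ (closed : ∀ n → M n → M (n ℤ.- + (s + d))) where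

      private
        descend : ∀ k i j → M (place i j) → M (place (i ℤ.- + k) j)
        descend zero    i j m = subst (λ z → M (place z j)) (sym (ℤₚ.+-identityʳ i)) m
        descend (suc k) i j m = subst M (lemma e (+ (s + d)) (+ d) i (+ j) (+ k))
          (closed (place (i ℤ.- + k) j) (descend k i j m))
          where
          lemma : ∀ e T d i j k → e ℤ.+ T ℤ.* (i ℤ.- k) ℤ.+ d ℤ.* j ℤ.- T ≡ e ℤ.+ T ℤ.* (i ℤ.- (1ℤ ℤ.+ k)) ℤ.+ d ℤ.* j
          lemma = solve-∀

      -- Subtracting s + d is one step down in a column, so closure fills the column below its top.
      abacus-below : ∀ i j → i ℤ.≤ abacusFunction s d μ j → M (place i j)
      abacus-below i j i≤f = subst (λ z → M (place z j)) i≡ (descend ∣ f ℤ.- i ∣ f j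
          (proj₁ (abacusValue⇒largest j (abacusFunction-spec s d μ j))))
        where
        f = abacusFunction s d μ j
        i≡ : f ℤ.- + ∣ f ℤ.- i ∣ ≡ i
        i≡ = trans (cong (λ z → f ℤ.- z) (ℤₚ.0≤i⇒+∣i∣≡i (ℤₚ.i≤j⇒0≤j-i i≤f))) (lemma f i)
          where
          lemma : ∀ f i → f ℤ.- (f ℤ.- i) ≡ i
          lemma = solve-∀

      abacus-above : ∀ i j → M (place i j) → i ℤ.≤ abacusFunction s d μ j
      abacus-above i j = proj₂ (abacusValue⇒largest j (abacusFunction-spec s d μ j)) i

-- Motzkin paths and their height sequences

endpoint-motzkin : ∀ {P} → Motzkin P → endpoint P ≡ (+ length P , total P)
endpoint-motzkin []            = refl
endpoint-motzkin (isU ∷ steps) rewrite endpoint-motzkin steps = refl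
endpoint-motzkin (isD ∷ steps) rewrite endpoint-motzkin steps = refl
endpoint-motzkin (isF ∷ steps) rewrite endpoint-motzkin steps = refl

motzkin-drop≤1 : ∀ {P} → Motzkin P → ∀ j → j < length P → height P j ℤ.- height P (suc j) ℤ.≤ 1ℤ
motzkin-drop≤1 (isU ∷ _) zero    _ = ℤ.-≤+
motzkin-drop≤1 (isD ∷ _) zero    _ = ℤ.+≤+ (s≤s z≤n)
motzkin-drop≤1 (isF ∷ _) zero    _ = ℤ.+≤+ z≤n
motzkin-drop≤1 {(_ , y) ∷ P} (_ ∷ steps) (suc j) (s≤s j<n) =
  subst (ℤ._≤ 1ℤ) (lemma y (height P j) (height P (suc j))) (motzkin-drop≤1 steps j j<n)
  where
  lemma : ∀ y a b → a ℤ.- b ≡ (y ℤ.+ a) ℤ.- (y ℤ.+ b)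
  lemma = solve-∀

height-bounded : ∀ {P} → Motzkin P → ∀ m → height P m ℤ.≤ + length P × ℤ.- height P m ℤ.≤ + length P
height-bounded _  zero = ℤ.+≤+ z≤n , ℤ.+≤+ z≤n
height-bounded [] (suc m) = ℤ.+≤+ z≤n , ℤ.+≤+ z≤n
height-bounded {(_ , y) ∷ P} (st ∷ steps) (suc m) =
    ℤₚ.+-mono-≤ (proj₁ (step≤1 st)) (proj₁ ih)
  , subst (ℤ._≤ + suc (length P)) (sym (ℤₚ.neg-distrib-+ y (height P m))) (ℤₚ.+-mono-≤ (proj₂ (step≤1 st)) (proj₂ ih))
  where
  ih = height-bounded steps m
  step≤1 : ∀ {x y} → (x , y) ∈ U ∷ D ∷ F ∷ [] → y ℤ.≤ 1ℤ × ℤ.- y ℤ.≤ 1ℤ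
  step≤1 isU = ℤ.+≤+ (s≤s z≤n) , ℤ.-≤+
  step≤1 isD = ℤ.-≤+ , ℤ.+≤+ (s≤s z≤n)
  step≤1 isF = ℤ.+≤+ z≤n , ℤ.+≤+ z≤n

applyUpTo-cong : ∀ {A : Set} {f g : ℕ → A} n → (∀ j → j < n → f j ≡ g j) → applyUpTo f n ≡ applyUpTo g n
applyUpTo-cong zero    f≗g = refl
applyUpTo-cong (suc n) f≗g = cong₂ _∷_ (f≗g 0 z<s) (applyUpTo-cong n λ j j<n → f≗g (suc j) (s<s j<n))

applyUpTo-height : ∀ {P} → Motzkin P → applyUpTo (λ j → 1ℤ , height P (suc j) ℤ.- height P j) (length P) ≡ P
applyUpTo-height [] = refl
applyUpTo-height {(x , y) ∷ P} (st ∷ steps) = cong₂ _∷_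
  (cong₂ _,_ (sym (x≡1 st)) (lemma y))
  (trans (applyUpTo-cong (length P) λ j _ → cong (1ℤ ,_) (lemma₂ y (height P (suc j)) (height P j)))
    (applyUpTo-height steps))
  where
  x≡1 : ∀ {x y} → (x , y) ∈ U ∷ D ∷ F ∷ [] → x ≡ 1ℤ
  x≡1 isU = refl
  x≡1 isD = refl
  x≡1 isF = refl
  lemma : ∀ y → y ℤ.+ 0ℤ ℤ.- 0ℤ ≡ y
  lemma = solve-∀
  lemma₂ : ∀ y a b → (y ℤ.+ a) ℤ.- (y ℤ.+ b) ≡ a ℤ.- b
  lemma₂ = solve-∀

unit-step : ∀ y → y ℤ.≤ 1ℤ → ℤ.- y ℤ.≤ 1ℤ → (1ℤ , y) ∈ U ∷ D ∷ F ∷ []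
unit-step (+ 0)           _ _ = isF
unit-step (+ 1)           _ _ = isU
unit-step (+ suc (suc n)) (ℤ.+≤+ (s≤s ())) _
unit-step -[1+ 0 ]        _ _ = isD
unit-step -[1+ suc n ]    _ (ℤ.+≤+ (s≤s ()))

Shape-cong : ∀ {n δ near h h′ W} → (∀ k → k ≤ W → h k ≡ h′ k) → Shape n δ near h W → Shape n δ near h′ W
Shape-cong {h = h} {h′} {W} h≗h′ shape = record
  { win   = λ j m j+m≤W m≤n → subst₂ (λ a b → a ℤ.- b ℤ.≤ 1ℤ) (h≗h′ (j + m) j+m≤W)
      (h≗h′ j (≤-trans (m≤m+n j m) j+m≤W)) (win j m j+m≤W m≤n)
  ; start = λ m m≤W near → subst (ℤ._≤ 0ℤ) (h≗h′ m m≤W) (start m m≤W near)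
  ; end   = λ j l j+l≡W near → subst₂ ℤ._≤_ (h≗h′ W ≤-refl)
      (h≗h′ j (≤-trans (m≤m+n j l) (≤-reflexive j+l≡W))) (end j l j+l≡W near)
  }
  where open Shape shape

if-∧-no : ∀ {A B C : Set} (a? : Dec A) (b? : Dec B) {x y : C} → ¬ (A × B) →
          (if ⌊ a? ⌋ ∧ ⌊ b? ⌋ then x else y) ≡ y
if-∧-no (yes a) (yes b) ¬ab = contradiction (a , b) ¬ab
if-∧-no (yes _) (no _)  _   = refl
if-∧-no (no _)  _       _   = refl

if-∧-yes : ∀ {A B C : Set} (a? : Dec A) (b? : Dec B) {x y : C} → A → B →
           (if ⌊ a? ⌋ ∧ ⌊ b? ⌋ then x else y) ≡ x
if-∧-yes (yes _) (yes _) _ _ = refl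
if-∧-yes (yes _) (no ¬b) _ b = contradiction b ¬b
if-∧-yes (no ¬a) _       a _ = contradiction a ¬a

-- The bijection

module Correspondence {s d : ℕ} .{{_ : NonZero s}} (set : Setting s d) {n : ℕ} (1≤n : 1 ≤ n) where
  open Setting set

  private
    ε≡1⇒odd : ε ≡ 1 → Odd d
    ε≡1⇒odd = go parities
      where
      go : ∀ {δ ε} → Parities s d δ ε → ε ≡ 1 → Odd d
      go (oddOdd _ d-odd)  _ = d-odd
      go (evenOdd _ d-odd) _ = d-odd

    odd⇒ε≡1 : Odd d → ε ≡ 1
    odd⇒ε≡1 = go parities
      where
      go : ∀ {δ ε} → Parities s d δ ε → Odd d → ε ≡ 1
      go (oddEven _ d-even) d-odd = contradiction d-odd (even⇒¬odd d d-even)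
      go (oddOdd _ _)       _     = refl
      go (evenOdd _ _)      _     = refl

    split : ∀ {j} → j ≤ W → j ≤ K ⊎ (j ≡ W × Odd d)
    split {j} j≤W with j ≤? K
    ... | yes j≤K = inj₁ j≤K
    ... | no j≰K  = inj₂ (≤-antisym j≤W (≤-trans W≤1+K (≰⇒> j≰K)) , ε≡1⇒odd (≤-antisym ε≤1 1≤ε))
      where
      W≤1+K : W ≤ suc K
      W≤1+K = ≤-trans (+-monoʳ-≤ K ε≤1) (≤-reflexive (+-comm K 1))
      1≤ε : 1 ≤ ε
      1≤ε = +-cancelˡ-≤ K 1 ε (≤-trans (≤-reflexive (+-comm K 1)) (≤-trans (≰⇒> j≰K) j≤W))

  extended-inner : ∀ μ {j} → j ≤ K → extendedAbacusFunction s d μ j ≡ abacusFunction s d μ j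
  extended-inner μ {j} j≤K = if-∧-no (odd? d) (j ≟ width s d) λ (d-odd , j≡) →
    <⇒≱ (subst (K <_) (trans (cong (λ z → K + z) (sym (odd⇒ε≡1 d-odd))) (trans (sym width≡W) (sym j≡)))
      (≤-reflexive (+-comm 1 K))) j≤K

  extended-last : ∀ μ → Odd d → extendedAbacusFunction s d μ W ≡ ℤ.- + Δ
  extended-last μ d-odd = trans (if-∧-yes (odd? d) (W ≟ width s d) d-odd (sym width≡W))
    (cong (λ z → ℤ.- + z) (sym Δ≡))

  private
    -- Recentring the progression at s + d, the vertical step of the abacus, turns k = 0, ..., p
    -- into m = k - 1 = -1, ..., p - 1, where p = n + 1.
    hook-size : ∀ k → + (s + k * d) ≡ + (s + d) ℤ.+ (+ k ℤ.- 1ℤ) ℤ.* + d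
    hook-size k = trans (cong (λ z → + s ℤ.+ z) (ℤₚ.pos-* k d)) (lemma (+ s) (+ d) (+ k))
      where
      lemma : ∀ s d k → s ℤ.+ k ℤ.* d ≡ s ℤ.+ d ℤ.+ (k ℤ.- 1ℤ) ℤ.* d
      lemma = solve-∀

    ClosedUnderHooks : (ℤ → Set) → Set
    ClosedUnderHooks M = ∀ m → -1ℤ ℤ.≤ m → m ℤ.≤ + n → ∀ x → M x → M (x ℤ.- (+ (s + d) ℤ.+ m ℤ.* + d))

  cores⇒closed : ∀ μ → 𝓢𝓒 (progression s d (suc n)) μ → ClosedUnderHooks (Maya (rows μ))
  cores⇒closed μ (sc , cores) m m≥ m≤ = go m m≥ m≤
    where
    step : ∀ k → k ≤ suc n → ∀ x → Maya (rows μ) x → Maya (rows μ) (x ℤ.- (+ (s + d) ℤ.+ (+ k ℤ.- 1ℤ) ℤ.* + d))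
    step k k≤ x = subst (λ t → Maya (rows μ) (x ℤ.- t)) (hook-size k) ∘
      core⇒maya-closed μ sc (s + k * d) (≤-trans (>-nonZero⁻¹ s) (m≤m+n s (k * d)))
        (Allₚ.applyUpTo⁻ (λ i → s + i * d) (suc (suc n)) cores (s≤s k≤)) x
    go : ∀ m → -1ℤ ℤ.≤ m → m ℤ.≤ + n → ∀ x → Maya (rows μ) x → Maya (rows μ) (x ℤ.- (+ (s + d) ℤ.+ m ℤ.* + d))
    go (+ m)        _ (ℤ.+≤+ m≤n) = step (suc m) (s≤s m≤n)
    go -[1+ zero ]  _ _           = step 0 z≤n
    go -[1+ suc m ] (ℤ.-≤- ()) _

  closed⇒cores : ∀ μ → SelfConjugate μ → ClosedUnderHooks (Maya (rows μ)) → 𝓢𝓒 (progression s d (suc n)) μ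
  closed⇒cores μ sc closed = sc , Allₚ.applyUpTo⁺₁ (λ i → s + i * d) (suc (suc n)) λ {k} k< →
    maya-closed⇒core μ sc (s + k * d) λ x m → subst (λ t → Maya (rows μ) (x ℤ.- t)) (sym (hook-size k))
      (closed (+ k ℤ.- 1ℤ) (lower k) (upper k (s≤s⁻¹ k<)) x m)
    where
    lower : ∀ k → -1ℤ ℤ.≤ + k ℤ.- 1ℤ
    lower zero    = ℤₚ.≤-refl
    lower (suc k) = ℤ.-≤+
    upper : ∀ k → k ≤ suc n → + k ℤ.- 1ℤ ℤ.≤ + n
    upper zero    _         = ℤ.-≤+
    upper (suc k) (s≤s k≤n) = ℤ.+≤+ k≤n

  module OfPartition (μ : Partition) (μ∈ : 𝓢𝓒 (progression s d (suc n)) μ) where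

    sc : SelfConjugate μ
    sc = proj₁ μ∈

    h : ℕ → ℤ
    h = extendedAbacusFunction s d μ

    open Profile params n 1≤n h

    private
      M : ℤ → Set
      M = Maya (rows μ)

      closed : ClosedUnderHooks M
      closed = cores⇒closed μ μ∈

      closed-T : ∀ x → M x → M (x ℤ.- + (s + d))
      closed-T x m = subst (λ t → M (x ℤ.- t)) (ℤₚ.+-identityʳ (+ (s + d))) (closed 0ℤ ℤ.-≤+ (ℤ.+≤+ z≤n) x m)

    below : ∀ {x a} → Column x a → ∀ i → i ℤ.≤ a → M (point i x)
    below (k , k≤K , refl , refl) i i≤ =
      abacus-below set μ sc closed-T i k (≤-ext i≤)
      where
      ≤-ext : i ℤ.≤ h k → i ℤ.≤ abacusFunction s d μ k
      ≤-ext = subst (i ℤ.≤_) (extended-inner μ k≤K)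

    above : ∀ {x a} → Column x a → ∀ i → M (point i x) → i ℤ.≤ a
    above (k , k≤K , refl , refl) i m =
      subst (i ℤ.≤_) (sym (extended-inner μ k≤K)) (abacus-above set μ sc closed-T i k m)

    good : Good
    good = closed⇒good (maya-exclusive sc) (maya-total sc) closed below above

    last : ε ≡ 1 → h W ≡ ℤ.- + Δ
    last ε≡1 = extended-last μ (ε≡1⇒odd ε≡1)

    h0 : h 0 ≡ 0ℤ
    h0 = good⇒h0 good last

    path-length : length (φ s d μ) ≡ W
    path-length = trans (length-applyUpTo _ (width s d)) width≡W

    path-height : ∀ k → k ≤ W → height (φ s d μ) k ≡ h k
    -- The path records only differences of `h`; they determine its values because h 0 = 0.
    path-height k k≤W = trans (height-applyUpTo h (width s d) k (subst (k ≤_) (sym width≡W) k≤W))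
      (trans (cong (λ z → h k ℤ.- z) h0) (ℤₚ.+-identityʳ (h k)))

    motzkin : Motzkin (φ s d μ)
    motzkin = Allₚ.applyUpTo⁺₁ _ (width s d) λ {j} j< →
      let up , down = good⇒steps good last j (subst (j <_) width≡W j<) in
      unit-step (h (suc j) ℤ.- h j) up (subst (ℤ._≤ 1ℤ) (minus-swap (h j) (h (suc j))) down)

    path-total : total (φ s d μ) ≡ ℤ.- + Δ
    path-total = begin
      total (φ s d μ)                          ≡⟨ height-total (φ s d μ) ⟨
      height (φ s d μ) (length (φ s d μ))      ≡⟨ cong (height (φ s d μ)) path-length ⟩
      height (φ s d μ) W                       ≡⟨ path-height W ≤-refl ⟩
      h W                                      ≡⟨ good⇒hW good last ⟩
      ℤ.- + Δ                                  ∎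
      where open ≡-Reasoning

    free : 𝓕 (width s d) (ℤ.- + ⌈ d /2⌉) (φ s d μ)
    free = motzkin , trans (endpoint-motzkin motzkin) (cong₂ _,_
      (cong +_ (trans path-length (sym width≡W))) (trans path-total (cong (λ z → ℤ.- + z) Δ≡)))

    admissible : Admissible s d (suc n) (φ s d μ)
    admissible = patterns⇒admissible parities 1≤n (shape⇒patterns n δ (Near n ε) (Near≤ n ε)
      (subst (Shape n δ (Near n ε) (height (φ s d μ))) (sym path-length)
        (Shape-cong (λ k k≤W → sym (path-height k k≤W)) (good⇒shape good last))))

  -- Equal paths have equal heights on 0, ..., K and so define the same `Member`. The boundary sets
  -- of μ and ν both coincide with it, and a symmetric diagram can be recovered from its boundary
  -- set.
  φ-injective : ∀ μ ν → 𝓢𝓒 (progression s d (suc n)) μ → 𝓢𝓒 (progression s d (suc n)) ν →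
                φ s d μ ≡ φ s d ν → μ ≡ ν
  φ-injective μ ν μ∈ ν∈ φ≡ = rows-injective (maya-injective P.sc Q.sc
      (λ x m → member⇒Q x (P⇒member x m)) (λ x m → member⇒P x (Q⇒member x m)))
    where
    module P = OfPartition μ μ∈
    module Q = OfPartition ν ν∈
    -- A single profile, with the heights of μ, serves both partitions; `h≡` carries the columns of
    -- ν over to it.
    open Profile params n 1≤n P.h

    h≡ : ∀ k → k ≤ K → P.h k ≡ Q.h k
    h≡ k k≤K = trans (sym (P.path-height k k≤W)) (trans (cong (λ R → height R k) φ≡) (Q.path-height k k≤W))
      where
      k≤W = ≤-trans k≤K (m≤m+n K ε)

    ν-below : ∀ {x a} → Column x a → ∀ i → i ℤ.≤ a → Maya (rows ν) (point i x)
    ν-below (k , k≤K , k≡ , a≡) i = Q.below (k , k≤K , k≡ , trans (sym (h≡ k k≤K)) a≡) i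

    ν-above : ∀ {x a} → Column x a → ∀ i → Maya (rows ν) (point i x) → i ℤ.≤ a
    ν-above (k , k≤K , k≡ , a≡) i = Q.above (k , k≤K , k≡ , trans (sym (h≡ k k≤K)) a≡) i

    P⇒member : ∀ x → Maya (rows μ) x → Member x
    P⇒member = ⇒member (maya-exclusive P.sc) (maya-total P.sc) (cores⇒closed μ μ∈) P.below P.above

    member⇒P : ∀ x → Member x → Maya (rows μ) x
    member⇒P = member⇒ (maya-exclusive P.sc) (maya-total P.sc) (cores⇒closed μ μ∈) P.below P.above

    Q⇒member : ∀ x → Maya (rows ν) x → Member x
    Q⇒member = ⇒member (maya-exclusive Q.sc) (maya-total Q.sc) (cores⇒closed ν ν∈) ν-below ν-above

    member⇒Q : ∀ x → Member x → Maya (rows ν) x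
    member⇒Q = member⇒ (maya-exclusive Q.sc) (maya-total Q.sc) (cores⇒closed ν ν∈) ν-below ν-above

  module OfPath (P : Path) (free : 𝓕 (width s d) (ℤ.- + ⌈ d /2⌉) P) (adm : Admissible s d (suc n) P) where

    private
      motzkin : Motzkin P
      motzkin = proj₁ free

      ends : (+ length P , total P) ≡ (+ width s d , ℤ.- + ⌈ d /2⌉)
      ends = trans (sym (endpoint-motzkin motzkin)) (proj₂ free)

      length≡ : length P ≡ W
      length≡ = trans (ℤₚ.+-injective (cong proj₁ ends)) width≡W

      h : ℕ → ℤ
      h = height P

      hW : h W ≡ ℤ.- + Δ
      hW = trans (cong h (sym length≡)) (trans (height-total P)
        (trans (cong proj₂ ends) (cong (λ z → ℤ.- + z) (sym Δ≡))))

    open Profile params n 1≤n h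

    good : Good
    good = shape⇒good refl hW (λ j j<W → motzkin-drop≤1 motzkin j (subst (j <_) (sym length≡) j<W))
      (subst (Shape n δ (Near n ε) h) length≡
        (patterns⇒shape n δ (Near n ε) (Near-mono n ε) (Near≤ n ε) motzkin (admissible⇒patterns parities adm)))

    private
      bound : ℕ
      -- Heights of a path are at most its length in absolute value, and columns are at most K.
      bound = ∣ point (+ length P) (+ K) ∣

      positive-bounded : ∀ u → Member (+ suc u) → u < bound
      positive-bounded u m = drop-+ (member-bounded good (+ length P)
        (λ { (k , _ , _ , refl) → height-bounded motzkin k }) (+ suc u) m)
        where
        drop-+ : ∀ {m z} → + m ℤ.≤ z → m ≤ ∣ z ∣
        drop-+ (ℤ.+≤+ m≤) = m≤

    module _ (μ : Partition) (sc : SelfConjugate μ)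
      (to : ∀ x → Maya (rows μ) x → Member x) (from : ∀ x → Member x → Maya (rows μ) x) where

      μ∈ : 𝓢𝓒 (progression s d (suc n)) μ
      μ∈ = closed⇒cores μ sc λ m m≥ m≤ x x∈ → from _ (member-closed good m m≥ m≤ x (to x x∈))

      private
        abacus≡h : ∀ k → k ≤ K → abacusFunction s d μ k ≡ h k
        abacus≡h k k≤K = Largest-unique (abacusValue⇒largest set μ sc k (abacusFunction-spec s d μ k))
          ( from _ (member⁺ good c right (h k) ℤₚ.≤-refl)
          , λ i m → member⁻ good c right i (to _ m))
          where
          c : Column (+ k) (h k)
          c = k , k≤K , refl , refl

        extended≡h : ∀ k → k ≤ W → extendedAbacusFunction s d μ k ≡ h k
        extended≡h k k≤W with split k≤W
        ... | inj₁ k≤K = trans (extended-inner μ k≤K) (abacus≡h k k≤K)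
        -- For odd d the last value is prescribed on the side of the abacus and is the endpoint on
        -- the side of the path.
        ... | inj₂ (refl , d-odd) = trans (extended-last μ d-odd) (sym hW)

      φμ≡P : φ s d μ ≡ P
      φμ≡P = trans (cong (applyUpTo _) (trans width≡W (sym length≡)))
        (trans (applyUpTo-cong (length P) λ j j< →
            cong (1ℤ ,_) (cong₂ ℤ._-_ (extended≡h (suc j) (subst (suc j ≤_) length≡ j<))
                                      (extended≡h j (<⇒≤ (subst (suc j ≤_) length≡ j<)))))
          (applyUpTo-height motzkin))

    preimage : ∃[ μ ] 𝓢𝓒 (progression s d (suc n)) μ × φ s d μ ≡ P
    preimage =
      let μ , sc , to , from = realise member? (member-exclusive good) (member-total good) bound positive-bounded
      in μ , μ∈ μ sc to from , φμ≡P μ sc to from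

theorem1p7 : ∀ (s d p : ℕ) .{{_ : NonZero s}} .{{_ : NonZero d}} →
    Coprime s d → 2 ≤ p →
    RestrictsToBijection (φ s d)
    (𝓢𝓒 (progression s d p))
    (λ P → 𝓕 (width s d) (- (+ ⌈ d /2⌉)) P × Admissible s d p P)
theorem1p7 s d (suc n) coprime (s≤s 1≤n) =
    (λ μ μ∈ → OfPartition.free μ μ∈ , OfPartition.admissible μ μ∈)
  , φ-injective
  , (λ P (free , adm) → OfPath.preimage P free adm)
  where
  open Correspondence (setting s d coprime) 1≤n
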